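{- Let $b$ and $d$ be integers satisfying $-2d<b<2d$. For $\operatorname{Im}\tau>0$, $q=e^{\pi i\tau}$ and $u,v\in\mathbf C$, let $$A_{d,b}(u,v|\tau)=\sum_{m,n\in\mathbf Z}q^{dm^2+bmn+dn^2}e^{2iu(m+n)}e^{2iv(m-n)}$$ and $$C_{d,b}(u,v|\tau)=\sum_{m,n\in\mathbf Z}q^{dm^2+bmn+dn^2+(d+b/2)m+(d+b/2)n+d/2+b/4}e^{2iu(m+n+1)}e^{2iv(m-n)}.$$ Then for all $u,v\in\mathbf C$ and all $\tau$ with $\operatorname{Im}\tau>0$, $$A_{d,b}(u,v|4\tau)-C_{d,b}(u,v|4\tau)=\vartheta_4(u|(2d+b)\tau)\,\vartheta_4(v|(2d-b)\tau).$$ Moreover, $$A_{d,b}^2(u,v|\tau)-C_{d,b}^2(u,v|\tau)=A_{d,b}^2(u,v+\pi/2|\tau)-C_{d,b}^2(u,v+\pi/2|\tau).$$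
   Context: For $\operatorname{Im}\tau>0$, $q=e^{\pi i\tau}$ with real powers $q^r=e^{\pi i r\tau}$; when the last argument is another value $\tau'$ (such as $4\tau$), $q$ is replaced throughout the definition by $e^{\pi i\tau'}$. The theta function is $\vartheta_4(z|\tau)=\sum_{n=-\infty}^\infty(-1)^nq^{n^2}e^{2niz}$. Squares such as $A_{d,b}^2(u,v|\tau)$ denote $(A_{d,b}(u,v|\tau))^2$. -}

module Defs where

open import Data.Nat as ℕ using (ℕ; zero; suc; _⊔_)
import Data.Nat.Properties as ℕₚ
import Data.Nat.Coprimality as Coprimality
open import Data.Integer as ℤ using (ℤ; +_; -[1+_]; 0ℤ)
import Data.Integer.Properties as ℤₚ
open import Data.Rational as ℚ using (ℚ; 0ℚ; 1ℚ; ½; _/_)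
import Data.Rational.Properties as ℚₚ
open import Algebra.Bundles using (CommutativeRing)
import Algebra.Properties.CommutativeSemigroup
open import Algebra.Properties.AbelianGroup ℚₚ.+-0-abelianGroup using (⁻¹-anti-homo‿-; ⁻¹-involutive)
open import Data.List using (List; foldr)
open import Data.List.Relation.Binary.Subset.Propositional using (_⊆_)
open import Data.List.Relation.Unary.Unique.Propositional using (Unique)
open import Data.Product using (Σ; ∃; ∃-syntax; _×_; _,_; proj₁; proj₂)
open import Data.Sum using (_⊎_; inj₁; inj₂)
open import Relation.Nullary using (¬_)
open import Relation.Binary.PropositionalEquality

infixl 6 _+ᴿ_ _-ᴿ_ _+ᶜ_ _-ᶜ_
infixl 7 _*ᴿ_ _*ᶜ_ _·_
infix  8 -ᴿ_
infix  4 _≃ᴿ_ _<ᴿ_ _≃ᶜ_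

record IsCauchy (s : ℕ → ℚ) : Set where
  constructor mkCauchy
  field
    modulus : ∀ ε → 0ℚ ℚ.< ε →
      ∃[ N ] ∀ m n → N ℕ.≤ m → N ℕ.≤ n → ℚ.∣ s m ℚ.- s n ∣ ℚ.< ε
open IsCauchy public

private
  module + = Algebra.Properties.CommutativeSemigroup
    (CommutativeRing.+-commutativeSemigroup ℚₚ.+-*-commutativeRing)
  module * = Algebra.Properties.CommutativeSemigroup
    (CommutativeRing.*-commutativeSemigroup ℚₚ.+-*-commutativeRing)

abstract

  telescope : ∀ a b c → (a ℚ.- b) ℚ.+ (b ℚ.- c) ≡ a ℚ.- c
  telescope a b c = trans (ℚₚ.+-assoc a (ℚ.- b) (b ℚ.- c)) (cong (a ℚ.+_)
    (trans (sym (ℚₚ.+-assoc (ℚ.- b) b (ℚ.- c)))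
      (trans (cong (ℚ._- c) (ℚₚ.+-inverseˡ b)) (ℚₚ.+-identityˡ (ℚ.- c)))))

  minus-plus : ∀ a b → (a ℚ.- b) ℚ.+ b ≡ a
  minus-plus a b = trans (ℚₚ.+-assoc a (ℚ.- b) b)
    (trans (cong (a ℚ.+_) (ℚₚ.+-inverseˡ b)) (ℚₚ.+-identityʳ a))

  neg-sub : ∀ a b → ℚ.- (a ℚ.- b) ≡ (ℚ.- a) ℚ.- (ℚ.- b)
  neg-sub a b = ℚₚ.neg-distrib-+ a (ℚ.- b)

  sub-swap : ∀ a b → ℚ.- (a ℚ.- b) ≡ b ℚ.- a
  sub-swap = ⁻¹-anti-homo‿-

  sub+sub : ∀ a b c d → (a ℚ.- b) ℚ.+ (c ℚ.- d) ≡ (a ℚ.+ c) ℚ.- (b ℚ.+ d)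
  sub+sub a b c d = trans (+.interchange a (ℚ.- b) c (ℚ.- d))
    (cong ((a ℚ.+ c) ℚ.+_) (sym (ℚₚ.neg-distrib-+ b d)))

  product-sub : ∀ a b c d → a ℚ.* (c ℚ.- d) ℚ.+ (a ℚ.- b) ℚ.* d ≡ a ℚ.* c ℚ.- b ℚ.* d
  product-sub a b c d = trans
    (cong₂ ℚ._+_
      (trans (ℚₚ.*-distribˡ-+ a c (ℚ.- d)) (cong (a ℚ.* c ℚ.+_) (sym (ℚₚ.neg-distribʳ-* a d))))
      (trans (ℚₚ.*-distribʳ-+ d a (ℚ.- b)) (cong (a ℚ.* d ℚ.+_) (sym (ℚₚ.neg-distribˡ-* b d)))))
    (telescope (a ℚ.* c) (a ℚ.* d) (b ℚ.* d))

  distrib′ : ∀ a b d → (a ℚ.+ b) ℚ.* d ≡ a ℚ.* d ℚ.+ d ℚ.* b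
  distrib′ a b d = trans (ℚₚ.*-distribʳ-+ d a b) (cong (a ℚ.* d ℚ.+_) (ℚₚ.*-comm b d))

  expand : ∀ a b c d →
    (a ℚ.* c ℚ.+ b ℚ.* d) ℚ.+ (a ℚ.* d ℚ.+ b ℚ.* c) ≡ (a ℚ.+ b) ℚ.* (c ℚ.+ d)
  expand a b c d = trans (+.interchange (a ℚ.* c) (b ℚ.* d) (a ℚ.* d) (b ℚ.* c))
    (trans (cong₂ ℚ._+_ (sym (ℚₚ.*-distribˡ-+ a c d))
             (trans (ℚₚ.+-comm (b ℚ.* d) (b ℚ.* c)) (sym (ℚₚ.*-distribˡ-+ b c d))))
      (sym (ℚₚ.*-distribʳ-+ (c ℚ.+ d) a b)))

  double : ∀ h r b → h ℚ.* (r ℚ.* (b ℚ.+ b)) ≡ h ℚ.* (r ℚ.* b) ℚ.+ h ℚ.* (r ℚ.* b)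
  double h r b = trans (cong (h ℚ.*_) (ℚₚ.*-distribˡ-+ r b b)) (ℚₚ.*-distribˡ-+ h _ _)

  double′ : ∀ h a b c →
    h ℚ.* a ℚ.* (b ℚ.* (c ℚ.+ c)) ≡ h ℚ.* (b ℚ.* (a ℚ.* c)) ℚ.+ h ℚ.* (b ℚ.* (a ℚ.* c))
  double′ h a b c = trans (ℚₚ.*-assoc h a _) (trans
    (cong (h ℚ.*_) (trans (*.x∙yz≈y∙xz a b (c ℚ.+ c)) (cong (b ℚ.*_) (ℚₚ.*-distribˡ-+ a c c))))
    (double h b (a ℚ.* c)))

  ½+½ : ∀ a → ½ ℚ.* a ℚ.+ ½ ℚ.* a ≡ a
  ½+½ a = trans (sym (ℚₚ.*-distribʳ-+ a ½ ½)) (ℚₚ.*-identityˡ a)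

  triangle : ∀ a b c → ℚ.∣ a ℚ.- c ∣ ℚ.≤ ℚ.∣ a ℚ.- b ∣ ℚ.+ ℚ.∣ b ℚ.- c ∣
  triangle a b c = subst (λ t → ℚ.∣ t ∣ ℚ.≤ ℚ.∣ a ℚ.- b ∣ ℚ.+ ℚ.∣ b ℚ.- c ∣)
    (telescope a b c) (ℚₚ.∣p+q∣≤∣p∣+∣q∣ (a ℚ.- b) (b ℚ.- c))

  ∣-∣-comm : ∀ x y → ℚ.∣ x ℚ.- y ∣ ≡ ℚ.∣ y ℚ.- x ∣
  ∣-∣-comm x y = trans (sym (ℚₚ.∣-p∣≡∣p∣ (x ℚ.- y))) (cong ℚ.∣_∣ (sub-swap x y))

  *-pos : ∀ a b → 0ℚ ℚ.< a → 0ℚ ℚ.< b → 0ℚ ℚ.< a ℚ.* b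
  *-pos a b 0<a 0<b = ℚₚ.positive⁻¹ (a ℚ.* b)
    {{ℚₚ.pos*pos⇒pos a {{ℚ.positive 0<a}} b {{ℚ.positive 0<b}}}}

  p≤p+q : ∀ p q → 0ℚ ℚ.≤ q → p ℚ.≤ p ℚ.+ q
  p≤p+q p q 0≤q = subst (ℚ._≤ p ℚ.+ q) (ℚₚ.+-identityʳ p) (ℚₚ.+-monoʳ-≤ p 0≤q)

  *-nonNeg : ∀ a b → 0ℚ ℚ.≤ a → 0ℚ ℚ.≤ b → 0ℚ ℚ.≤ a ℚ.* b
  *-nonNeg a b p q = ℚₚ.nonNegative⁻¹ (a ℚ.* b)
    {{ℚₚ.nonNeg*nonNeg⇒nonNeg a {{ℚ.nonNegative p}} b {{ℚ.nonNegative q}}}}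

  *-mono : ∀ a b c d → 0ℚ ℚ.≤ b → 0ℚ ℚ.≤ c → a ℚ.≤ b → c ℚ.≤ d → a ℚ.* c ℚ.≤ b ℚ.* d
  *-mono a b c d 0≤b 0≤c a≤b c≤d = ℚₚ.≤-trans
    (ℚₚ.*-monoʳ-≤-nonNeg c {{ℚ.nonNegative 0≤c}} a≤b)
    (ℚₚ.*-monoˡ-≤-nonNeg b {{ℚ.nonNegative 0≤b}} c≤d)

  0<½ : 0ℚ ℚ.< ½
  0<½ = ℚₚ.positive⁻¹ ½

  0<1 : 0ℚ ℚ.< 1ℚ
  0<1 = ℚₚ.positive⁻¹ 1ℚ

  half-pos : ∀ ε → 0ℚ ℚ.< ε → 0ℚ ℚ.< ½ ℚ.* ε
  half-pos ε = *-pos ½ ε 0<½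

  +-pos : ∀ {a b} → 0ℚ ℚ.≤ a → 0ℚ ℚ.< b → 0ℚ ℚ.< a ℚ.+ b
  +-pos p q = ℚₚ.+-mono-≤-< p q

  halves : ∀ a b c ε → c ℚ.≤ a ℚ.+ b → a ℚ.< ½ ℚ.* ε → b ℚ.< ½ ℚ.* ε → c ℚ.< ε
  halves a b c ε p q r = ℚₚ.≤-<-trans p
    (subst (a ℚ.+ b ℚ.<_) (½+½ ε) (ℚₚ.+-mono-< q r))

  shrink : ∀ B ε → 0ℚ ℚ.≤ B → 0ℚ ℚ.< ε → ∃[ δ ] 0ℚ ℚ.< δ × B ℚ.* δ ℚ.< ε
  shrink B ε 0≤B 0<ε = δ , 0<δ , lt
    where
    C : ℚ
    C = B ℚ.+ 1ℚ
    0<C : 0ℚ ℚ.< C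
    0<C = +-pos 0≤B 0<1
    instance
      C⁺ : ℚ.Positive C
      C⁺ = ℚ.positive 0<C
      C≠ : ℚ.NonZero C
      C≠ = ℚₚ.pos⇒nonZero C
    δ : ℚ
    δ = ℚ.1/ C ℚ.* ε
    0<δ : 0ℚ ℚ.< δ
    0<δ = *-pos (ℚ.1/ C) ε (ℚₚ.positive⁻¹ (ℚ.1/ C) {{ℚₚ.1/pos⇒pos C}}) 0<ε
    eq : C ℚ.* δ ≡ ε
    eq = trans (sym (ℚₚ.*-assoc C (ℚ.1/ C) ε))
      (trans (cong (ℚ._* ε) (ℚₚ.*-inverseʳ C)) (ℚₚ.*-identityˡ ε))
    B<C : B ℚ.< C
    B<C = subst (ℚ._< C) (ℚₚ.+-identityʳ B) (ℚₚ.+-monoʳ-< B 0<1)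
    lt : B ℚ.* δ ℚ.< ε
    lt = subst (B ℚ.* δ ℚ.<_) eq (ℚₚ.*-monoˡ-<-pos δ {{ℚ.positive 0<δ}} B<C)

  cauchy-bound : ∀ {s} → IsCauchy s →
    ∃[ B ] ∃[ N ] 0ℚ ℚ.≤ B × (∀ n → N ℕ.≤ n → ℚ.∣ s n ∣ ℚ.≤ B)
  cauchy-bound {s} c with modulus c 1ℚ 0<1
  ... | N , h = 1ℚ ℚ.+ ℚ.∣ s N ∣ , N
      , ℚₚ.+-mono-≤ (ℚₚ.<⇒≤ 0<1) (ℚₚ.0≤∣p∣ (s N)) , λ n N≤n →
        ℚₚ.≤-trans
          (subst (λ t → ℚ.∣ t ∣ ℚ.≤ ℚ.∣ s n ℚ.- s N ∣ ℚ.+ ℚ.∣ s N ∣)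
            (minus-plus (s n) (s N))
            (ℚₚ.∣p+q∣≤∣p∣+∣q∣ (s n ℚ.- s N) (s N)))
          (ℚₚ.+-monoˡ-≤ ℚ.∣ s N ∣ (ℚₚ.<⇒≤ (h n N N≤n ℕₚ.≤-refl)))

  cauchy-const : ∀ r → IsCauchy (λ _ → r)
  cauchy-const r = mkCauchy λ ε 0<ε → 0 , λ _ _ _ _ →
    subst (λ t → ℚ.∣ t ∣ ℚ.< ε) (sym (ℚₚ.+-inverseʳ r)) 0<ε

  cauchy-neg : ∀ {s} → IsCauchy s → IsCauchy (λ n → ℚ.- s n)
  cauchy-neg {s} c = mkCauchy λ ε 0<ε → let (N , h) = modulus c ε 0<ε in N , λ m n p q →
    subst (ℚ._< ε)
      (trans (sym (ℚₚ.∣-p∣≡∣p∣ (s m ℚ.- s n)))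
        (cong ℚ.∣_∣ (neg-sub (s m) (s n))))
      (h m n p q)

  cauchy-+ : ∀ {s t} → IsCauchy s → IsCauchy t → IsCauchy (λ n → s n ℚ.+ t n)
  cauchy-+ {s} {t} c d = mkCauchy λ ε 0<ε →
    let (M , g) = modulus c (½ ℚ.* ε) (half-pos ε 0<ε)
        (N , h) = modulus d (½ ℚ.* ε) (half-pos ε 0<ε)
    in M ⊔ N , λ m n p q →
    halves _ _ _ ε
      (subst (λ x → ℚ.∣ x ∣ ℚ.≤ ℚ.∣ s m ℚ.- s n ∣ ℚ.+ ℚ.∣ t m ℚ.- t n ∣)
        (sub+sub (s m) (s n) (t m) (t n))
        (ℚₚ.∣p+q∣≤∣p∣+∣q∣ (s m ℚ.- s n) (t m ℚ.- t n)))
      (g m n (ℕₚ.m⊔n≤o⇒m≤o M N p) (ℕₚ.m⊔n≤o⇒m≤o M N q))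
      (h m n (ℕₚ.m⊔n≤o⇒n≤o M N p) (ℕₚ.m⊔n≤o⇒n≤o M N q))

  product-close : ∀ a b c d A B δ → 0ℚ ℚ.≤ A → 0ℚ ℚ.≤ δ →
    ℚ.∣ a ∣ ℚ.≤ A → ℚ.∣ c ℚ.- d ∣ ℚ.≤ δ → ℚ.∣ a ℚ.- b ∣ ℚ.≤ δ → ℚ.∣ d ∣ ℚ.≤ B →
    ℚ.∣ a ℚ.* c ℚ.- b ℚ.* d ∣ ℚ.≤ (A ℚ.+ B) ℚ.* δ
  product-close a b c d A B δ 0≤A 0≤δ a≤A cd≤δ ab≤δ d≤B = begin
    ℚ.∣ a ℚ.* c ℚ.- b ℚ.* d ∣
      ≡⟨ cong ℚ.∣_∣ (product-sub a b c d) ⟨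
    ℚ.∣ a ℚ.* (c ℚ.- d) ℚ.+ (a ℚ.- b) ℚ.* d ∣
      ≤⟨ ℚₚ.∣p+q∣≤∣p∣+∣q∣ (a ℚ.* (c ℚ.- d)) ((a ℚ.- b) ℚ.* d) ⟩
    ℚ.∣ a ℚ.* (c ℚ.- d) ∣ ℚ.+ ℚ.∣ (a ℚ.- b) ℚ.* d ∣
      ≡⟨ cong₂ ℚ._+_ (ℚₚ.∣p*q∣≡∣p∣*∣q∣ a (c ℚ.- d)) (ℚₚ.∣p*q∣≡∣p∣*∣q∣ (a ℚ.- b) d) ⟩
    ℚ.∣ a ∣ ℚ.* ℚ.∣ c ℚ.- d ∣ ℚ.+ ℚ.∣ a ℚ.- b ∣ ℚ.* ℚ.∣ d ∣
      ≤⟨ ℚₚ.+-mono-≤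
           (*-mono ℚ.∣ a ∣ A ℚ.∣ c ℚ.- d ∣ δ 0≤A (ℚₚ.0≤∣p∣ (c ℚ.- d)) a≤A cd≤δ)
           (*-mono ℚ.∣ a ℚ.- b ∣ δ ℚ.∣ d ∣ B 0≤δ (ℚₚ.0≤∣p∣ d) ab≤δ d≤B) ⟩
    A ℚ.* δ ℚ.+ δ ℚ.* B
      ≡⟨ distrib′ A B δ ⟨
    (A ℚ.+ B) ℚ.* δ ∎
    where open ℚₚ.≤-Reasoning

  cauchy-* : ∀ {s t} → IsCauchy s → IsCauchy t → IsCauchy (λ n → s n ℚ.* t n)
  cauchy-* {s} {t} c d = mkCauchy λ ε 0<ε →
    let (A , K , 0≤A , a≤) = cauchy-bound c
        (B , L , 0≤B , b≤) = cauchy-bound d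
        (δ , 0<δ , δ<ε)    = shrink (A ℚ.+ B) ε (ℚₚ.+-mono-≤ 0≤A 0≤B) 0<ε
        (M , g)            = modulus c δ 0<δ
        (N , h)            = modulus d δ 0<δ
    in (K ⊔ L) ⊔ (M ⊔ N) , λ m n p q →
    let p₁ = ℕₚ.m⊔n≤o⇒m≤o (K ⊔ L) (M ⊔ N) p
        p₂ = ℕₚ.m⊔n≤o⇒n≤o (K ⊔ L) (M ⊔ N) p
        q₁ = ℕₚ.m⊔n≤o⇒m≤o (K ⊔ L) (M ⊔ N) q
        q₂ = ℕₚ.m⊔n≤o⇒n≤o (K ⊔ L) (M ⊔ N) q
    in ℚₚ.≤-<-trans
      (product-close (s m) (s n) (t m) (t n) A B δ 0≤A (ℚₚ.<⇒≤ 0<δ)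
        (a≤ m (ℕₚ.m⊔n≤o⇒m≤o K L p₁))
        (ℚₚ.<⇒≤ (h m n (ℕₚ.m⊔n≤o⇒n≤o M N p₂) (ℕₚ.m⊔n≤o⇒n≤o M N q₂)))
        (ℚₚ.<⇒≤ (g m n (ℕₚ.m⊔n≤o⇒m≤o M N p₂) (ℕₚ.m⊔n≤o⇒m≤o M N q₂)))
        (b≤ n (ℕₚ.m⊔n≤o⇒n≤o K L q₁)))
      δ<ε

-- Real numbers as Cauchy sequences of rationals, with equality _≃ᴿ_.
record ℝ : Set where
  constructor mkℝ
  field
    seq    : ℕ → ℚ
    cauchy : IsCauchy seq
open ℝ public

record _≃ᴿ_ (x y : ℝ) : Set where
  constructor mk≃
  field
    close : ∀ ε → 0ℚ ℚ.< ε → ∃[ N ] ∀ n → N ℕ.≤ n → ℚ.∣ seq x n ℚ.- seq y n ∣ ℚ.< ε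
open _≃ᴿ_ public

record _<ᴿ_ (x y : ℝ) : Set where
  constructor mk<
  field
    gap     : ℚ
    gap-pos : 0ℚ ℚ.< gap
    apart   : ∃[ N ] ∀ n → N ℕ.≤ n → seq x n ℚ.+ gap ℚ.< seq y n
open _<ᴿ_ public

ofℚ : ℚ → ℝ
ofℚ r = mkℝ (λ _ → r) (cauchy-const r)

0ᴿ 1ᴿ : ℝ
0ᴿ = ofℚ 0ℚ
1ᴿ = ofℚ 1ℚ

-ᴿ_ : ℝ → ℝ
-ᴿ x   = mkℝ (λ n → ℚ.- seq x n) (cauchy-neg (cauchy x))

_+ᴿ_ _-ᴿ_ _*ᴿ_ : ℝ → ℝ → ℝ
x +ᴿ y = mkℝ (λ n → seq x n ℚ.+ seq y n) (cauchy-+ (cauchy x) (cauchy y))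
x -ᴿ y = x +ᴿ (-ᴿ y)
x *ᴿ y = mkℝ (λ n → seq x n ℚ.* seq y n) (cauchy-* (cauchy x) (cauchy y))

record ℂ : Set where
  constructor _+i_
  field
    re im : ℝ
open ℂ public

record _≃ᶜ_ (z w : ℂ) : Set where
  constructor mk≃ᶜ
  field
    re≃ : re z ≃ᴿ re w
    im≃ : im z ≃ᴿ im w
open _≃ᶜ_ public

ofℝ : ℝ → ℂ
ofℝ x = x +i 0ᴿ

ofℤ : ℤ → ℂ
ofℤ k = ofℝ (ofℚ (k / 1))

0ᶜ 1ᶜ 𝕚 : ℂ
0ᶜ = ofℝ 0ᴿ
1ᶜ = ofℝ 1ᴿ
𝕚 = 0ᴿ +i 1ᴿ

_+ᶜ_ _-ᶜ_ _*ᶜ_ : ℂ → ℂ → ℂ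
z +ᶜ w = (re z +ᴿ re w) +i (im z +ᴿ im w)
z -ᶜ w = (re z -ᴿ re w) +i (im z -ᴿ im w)
z *ᶜ w = (re z *ᴿ re w -ᴿ im z *ᴿ im w) +i (re z *ᴿ im w +ᴿ im z *ᴿ re w)

_² : ℂ → ℂ
z ² = z *ᶜ z

_·_ : ℚ → ℂ → ℂ
r · z = (ofℚ r *ᴿ re z) +i (ofℚ r *ᴿ im z)

∣_∣² : ℂ → ℝ
∣ z ∣² = re z *ᴿ re z +ᴿ im z *ᴿ im z

-- z ^ k / k !
expTerm : ℂ → ℕ → ℂ
expTerm z zero    = 1ᶜ
expTerm z (suc k) = (+ 1 / suc k) · (z *ᶜ expTerm z k)

expSum : ℂ → ℕ → ℂ
expSum z zero    = 0ᶜ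
expSum z (suc n) = expSum z n +ᶜ expTerm z n

‖_‖_ : ℂ → ℕ → ℚ
‖ z ‖ j = ℚ.∣ seq (re z) j ∣ ℚ.+ ℚ.∣ seq (im z) j ∣

dist : ℂ → ℂ → ℕ → ℚ
dist z w j = ℚ.∣ seq (re z) j ℚ.- seq (re w) j ∣ ℚ.+ ℚ.∣ seq (im z) j ℚ.- seq (im w) j ∣

Uniform : ℂ → ℚ → Set
Uniform z ε = ∃[ M ] ∃[ J ] ∀ n j → M ℕ.≤ n → J ℕ.≤ j →
  dist (expSum z n) (expSum z M) j ℚ.< ε

ι : ℕ → ℚ
ι n = + n / 1

term-bound : ℚ → ℕ → ℚ
term-bound B zero    = 1ℚ
term-bound B (suc k) = (+ 1 / suc k) ℚ.* B ℚ.* term-bound B k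

½^ : ℕ → ℚ
½^ zero    = 1ℚ
½^ (suc n) = ½ ℚ.* ½^ n

abstract

  ι≡ : ∀ n → ι n ≡ ℚ.mkℚ (+ n) 0 (Coprimality.sym (Coprimality.1-coprimeTo n))
  ι≡ n = ℚₚ.normalize-coprime (Coprimality.sym (Coprimality.1-coprimeTo n))

  ι-mono : ∀ {m n} → m ℕ.≤ n → ι m ℚ.≤ ι n
  ι-mono {m} {n} m≤n with ι≡ m | ι≡ n
  ... | p | q rewrite p | q =
    ℚ.*≤* (ℤₚ.*-monoʳ-≤-nonNeg (+ 1) (ℤ.+≤+ m≤n))

  archimedean : ∀ p → ∃[ n ] p ℚ.≤ ι n
  archimedean p = ℤ.∣ ℚ.↥ p ∣ , go
    where
    go : p ℚ.≤ ι ℤ.∣ ℚ.↥ p ∣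
    go with ι≡ ℤ.∣ ℚ.↥ p ∣
    ... | e rewrite e = ℚ.*≤* (begin
      ℚ.↥ p ℤ.* + 1                       ≡⟨ ℤₚ.*-identityʳ (ℚ.↥ p) ⟩
      ℚ.↥ p                               ≤⟨ i≤∣i∣ (ℚ.↥ p) ⟩
      + ℤ.∣ ℚ.↥ p ∣                       ≡⟨ ℤₚ.*-identityʳ _ ⟨
      + ℤ.∣ ℚ.↥ p ∣ ℤ.* + 1               ≤⟨ ℤₚ.*-monoˡ-≤-nonNeg (+ ℤ.∣ ℚ.↥ p ∣) (ℤ.+≤+ (ℕ.s≤s ℕ.z≤n)) ⟩
      + ℤ.∣ ℚ.↥ p ∣ ℤ.* ℚ.↧ p             ∎)
      where
      open ℤₚ.≤-Reasoning
      i≤∣i∣ : ∀ i → i ℤ.≤ + ℤ.∣ i ∣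
      i≤∣i∣ (+ n)    = ℤₚ.≤-refl
      i≤∣i∣ -[1+ n ] = ℤ.-≤+

  recip : ∀ k → (+ 1 / suc k) ℚ.* ι (suc k) ≡ 1ℚ
  recip k = ℚₚ.toℚᵘ-injective (begin
    ℚ.toℚᵘ ((+ 1 / suc k) ℚ.* ι (suc k))          ≈⟨ ℚₚ.toℚᵘ-homo-* (+ 1 / suc k) (ι (suc k)) ⟩
    ℚ.toℚᵘ (+ 1 / suc k) ℚᵘ.* ℚ.toℚᵘ (ι (suc k))  ≈⟨ ℚᵘₚ.*-cong (ℚₚ.toℚᵘ-fromℚᵘ (ℚᵘ.mkℚᵘ (+ 1) k)) (ℚₚ.toℚᵘ-fromℚᵘ (ℚᵘ.mkℚᵘ (+ suc k) 0)) ⟩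
    ℚᵘ.mkℚᵘ (+ 1) k ℚᵘ.* ℚᵘ.mkℚᵘ (+ suc k) 0      ≈⟨ ℚᵘ.*≡* (cong +_ (cong suc (lem k))) ⟩
    ℚ.toℚᵘ 1ℚ                                     ∎)
    where
    import Data.Rational.Unnormalised as ℚᵘ
    import Data.Rational.Unnormalised.Properties as ℚᵘₚ
    open ℚᵘₚ.≃-Reasoning
    lem : ∀ k → (k ℕ.+ 0) ℕ.* 1 ≡ k ℕ.* 1 ℕ.+ 0
    lem k = trans (cong (ℕ._* 1) (ℕₚ.+-identityʳ k)) (sym (ℕₚ.+-identityʳ (k ℕ.* 1)))

  0≤1/ : ∀ k → 0ℚ ℚ.≤ + 1 / suc k
  0≤1/ k = ℚₚ.nonNegative⁻¹ (+ 1 / suc k) {{ℚₚ.normalize-nonNeg 1 (suc k)}}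

  ‖‖-nonNeg : ∀ z j → 0ℚ ℚ.≤ ‖ z ‖ j
  ‖‖-nonNeg z j = ℚₚ.+-mono-≤ (ℚₚ.0≤∣p∣ (seq (re z) j)) (ℚₚ.0≤∣p∣ (seq (im z) j))

  ‖*‖ : ∀ z w j → ‖ z *ᶜ w ‖ j ℚ.≤ ‖ z ‖ j ℚ.* ‖ w ‖ j
  ‖*‖ z w j = go (seq (re z) j) (seq (im z) j) (seq (re w) j) (seq (im w) j)
    where
    open ℚₚ.≤-Reasoning
    go : ∀ a b c d → ℚ.∣ a ℚ.* c ℚ.- b ℚ.* d ∣ ℚ.+ ℚ.∣ a ℚ.* d ℚ.+ b ℚ.* c ∣
                   ℚ.≤ (ℚ.∣ a ∣ ℚ.+ ℚ.∣ b ∣) ℚ.* (ℚ.∣ c ∣ ℚ.+ ℚ.∣ d ∣)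
    go a b c d = begin
      ℚ.∣ a ℚ.* c ℚ.- b ℚ.* d ∣ ℚ.+ ℚ.∣ a ℚ.* d ℚ.+ b ℚ.* c ∣
        ≤⟨ ℚₚ.+-mono-≤ (ℚₚ.∣p-q∣≤∣p∣+∣q∣ (a ℚ.* c) (b ℚ.* d)) (ℚₚ.∣p+q∣≤∣p∣+∣q∣ (a ℚ.* d) (b ℚ.* c)) ⟩
      (ℚ.∣ a ℚ.* c ∣ ℚ.+ ℚ.∣ b ℚ.* d ∣) ℚ.+ (ℚ.∣ a ℚ.* d ∣ ℚ.+ ℚ.∣ b ℚ.* c ∣)
        ≡⟨ cong₂ ℚ._+_ (cong₂ ℚ._+_ (ℚₚ.∣p*q∣≡∣p∣*∣q∣ a c) (ℚₚ.∣p*q∣≡∣p∣*∣q∣ b d))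
                       (cong₂ ℚ._+_ (ℚₚ.∣p*q∣≡∣p∣*∣q∣ a d) (ℚₚ.∣p*q∣≡∣p∣*∣q∣ b c)) ⟩
      (ℚ.∣ a ∣ ℚ.* ℚ.∣ c ∣ ℚ.+ ℚ.∣ b ∣ ℚ.* ℚ.∣ d ∣) ℚ.+ (ℚ.∣ a ∣ ℚ.* ℚ.∣ d ∣ ℚ.+ ℚ.∣ b ∣ ℚ.* ℚ.∣ c ∣)
        ≡⟨ expand ℚ.∣ a ∣ ℚ.∣ b ∣ ℚ.∣ c ∣ ℚ.∣ d ∣ ⟩
      (ℚ.∣ a ∣ ℚ.+ ℚ.∣ b ∣) ℚ.* (ℚ.∣ c ∣ ℚ.+ ℚ.∣ d ∣) ∎

  ‖·‖ : ∀ r z j → 0ℚ ℚ.≤ r → ‖ r · z ‖ j ≡ r ℚ.* ‖ z ‖ j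
  ‖·‖ r z j 0≤r = trans
    (cong₂ ℚ._+_
      (trans (ℚₚ.∣p*q∣≡∣p∣*∣q∣ r (seq (re z) j)) (cong (ℚ._* _) (ℚₚ.0≤p⇒∣p∣≡p 0≤r)))
      (trans (ℚₚ.∣p*q∣≡∣p∣*∣q∣ r (seq (im z) j)) (cong (ℚ._* _) (ℚₚ.0≤p⇒∣p∣≡p 0≤r))))
    (sym (ℚₚ.*-distribˡ-+ r _ _))

  term-step : ∀ z j B → ‖ z ‖ j ℚ.≤ B → ∀ k →
    ‖ expTerm z (suc k) ‖ j ℚ.≤ (+ 1 / suc k) ℚ.* B ℚ.* ‖ expTerm z k ‖ j
  term-step z j B z≤B k = begin
    ‖ expTerm z (suc k) ‖ j                     ≡⟨ ‖·‖ r (z *ᶜ expTerm z k) j (0≤1/ k) ⟩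
    r ℚ.* ‖ z *ᶜ expTerm z k ‖ j                ≤⟨ ℚₚ.*-monoˡ-≤-nonNeg r {{ℚ.nonNegative (0≤1/ k)}} (‖*‖ z (expTerm z k) j) ⟩
    r ℚ.* (‖ z ‖ j ℚ.* t)                       ≤⟨ ℚₚ.*-monoˡ-≤-nonNeg r {{ℚ.nonNegative (0≤1/ k)}}
                                                    (ℚₚ.*-monoʳ-≤-nonNeg t {{ℚ.nonNegative (‖‖-nonNeg (expTerm z k) j)}} z≤B) ⟩
    r ℚ.* (B ℚ.* t)                             ≡⟨ ℚₚ.*-assoc r B t ⟨
    r ℚ.* B ℚ.* t                               ∎
    where
    open ℚₚ.≤-Reasoning
    r t : ℚ
    r = + 1 / suc k
    t = ‖ expTerm z k ‖ j

  term-bound-nonNeg : ∀ B → 0ℚ ℚ.≤ B → ∀ k → 0ℚ ℚ.≤ term-bound B k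
  term-bound-nonNeg B 0≤B zero    = ℚₚ.<⇒≤ 0<1
  term-bound-nonNeg B 0≤B (suc k) = *-nonNeg (+ 1 / suc k ℚ.* B) (term-bound B k)
    (*-nonNeg (+ 1 / suc k) B (0≤1/ k) 0≤B) (term-bound-nonNeg B 0≤B k)

  term-bounded : ∀ z j B → 0ℚ ℚ.≤ B → ‖ z ‖ j ℚ.≤ B → ∀ k →
    ‖ expTerm z k ‖ j ℚ.≤ term-bound B k
  term-bounded z j B 0≤B z≤B zero    = ℚₚ.≤-refl
  term-bounded z j B 0≤B z≤B (suc k) = ℚₚ.≤-trans (term-step z j B z≤B k)
    (ℚₚ.*-monoˡ-≤-nonNeg (+ 1 / suc k ℚ.* B)
      {{ℚ.nonNegative (*-nonNeg (+ 1 / suc k) B (0≤1/ k) 0≤B)}} (term-bounded z j B 0≤B z≤B k))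

  ratio : ∀ B K → B ℚ.+ B ℚ.≤ ι K → ∀ k → K ℕ.≤ k → (+ 1 / suc k) ℚ.* B ℚ.≤ ½
  ratio B K 2B≤K k K≤k = begin
    r ℚ.* B                       ≡⟨ trans (double ½ r B) (½+½ (r ℚ.* B)) ⟨
    ½ ℚ.* (r ℚ.* (B ℚ.+ B))       ≤⟨ ℚₚ.*-monoˡ-≤-nonNeg ½ (ℚₚ.*-monoˡ-≤-nonNeg r {{ℚ.nonNegative (0≤1/ k)}}
                                      (ℚₚ.≤-trans 2B≤K (ι-mono (ℕₚ.m≤n⇒m≤1+n K≤k)))) ⟩
    ½ ℚ.* (r ℚ.* ι (suc k))       ≡⟨ cong (½ ℚ.*_) (recip k) ⟩
    ½ ℚ.* 1ℚ                      ≡⟨ ℚₚ.*-identityʳ ½ ⟩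
    ½                             ∎
    where
    open ℚₚ.≤-Reasoning
    r : ℚ
    r = + 1 / suc k

  ½^-nonNeg : ∀ n → 0ℚ ℚ.≤ ½^ n
  ½^-nonNeg zero    = ℚₚ.<⇒≤ 0<1
  ½^-nonNeg (suc n) = *-nonNeg ½ (½^ n) (ℚₚ.<⇒≤ 0<½) (½^-nonNeg n)

  ½^-≤ : ∀ n → ½^ n ℚ.≤ + 1 / suc n
  ½^-≤ zero    = ℚₚ.≤-refl
  ½^-≤ (suc n) = ℚₚ.≤-trans (ℚₚ.*-monoˡ-≤-nonNeg ½ (½^-≤ n)) (begin
    ½ ℚ.* a                               ≡⟨ ℚₚ.*-identityʳ _ ⟨
    ½ ℚ.* a ℚ.* 1ℚ                        ≡⟨ cong (½ ℚ.* a ℚ.*_) (recip (suc n)) ⟨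
    ½ ℚ.* a ℚ.* (b ℚ.* ι (suc (suc n)))   ≤⟨ ℚₚ.*-monoˡ-≤-nonNeg (½ ℚ.* a) {{ℚ.nonNegative (*-nonNeg ½ a (ℚₚ.<⇒≤ 0<½) (0≤1/ n))}}
                                              (ℚₚ.*-monoˡ-≤-nonNeg b {{ℚ.nonNegative (0≤1/ (suc n))}} ι≤) ⟩
    ½ ℚ.* a ℚ.* (b ℚ.* (ι (suc n) ℚ.+ ι (suc n)))
                                          ≡⟨ trans (double′ ½ a b (ι (suc n))) (½+½ (b ℚ.* (a ℚ.* ι (suc n)))) ⟩
    b ℚ.* (a ℚ.* ι (suc n))               ≡⟨ cong (b ℚ.*_) (recip n) ⟩
    b ℚ.* 1ℚ                              ≡⟨ ℚₚ.*-identityʳ b ⟩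
    b                                     ∎)
    where
    open ℚₚ.≤-Reasoning
    a b : ℚ
    a = + 1 / suc n
    b = + 1 / suc (suc n)
    ι-+ : ∀ m n → ι m ℚ.+ ι n ≡ ι (m ℕ.+ n)
    ι-+ m n with ι≡ m | ι≡ n
    ... | p | q rewrite p | q =
      cong (_/ 1) (cong₂ ℤ._+_ (ℤₚ.*-identityʳ (+ m)) (ℤₚ.*-identityʳ (+ n)))
    ι≤ : ι (suc (suc n)) ℚ.≤ ι (suc n) ℚ.+ ι (suc n)
    ι≤ = subst (ι (suc (suc n)) ℚ.≤_) (sym (ι-+ (suc n) (suc n)))
      (ι-mono (ℕ.s≤s (ℕₚ.m≤n+m (suc n) n)))

  inverse : ∀ δ → 0ℚ ℚ.< δ → ∃[ e ] e ℚ.* δ ≡ 1ℚ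
  inverse δ 0<δ = (ℚ.1/ δ) {{≠}} , ℚₚ.*-inverseˡ δ {{≠}}
    where
    ≠ : ℚ.NonZero δ
    ≠ = ℚₚ.pos⇒nonZero δ {{ℚ.positive 0<δ}}

  recip≤ : ∀ i δ e r → 0ℚ ℚ.≤ r → r ℚ.* ι (suc i) ≡ 1ℚ → 0ℚ ℚ.< δ → e ℚ.* δ ≡ 1ℚ → e ℚ.≤ ι i → r ℚ.≤ δ
  recip≤ i δ e r 0≤r r* 0<δ eδ e≤i = begin
    r                            ≡⟨ ℚₚ.*-identityʳ r ⟨
    r ℚ.* 1ℚ                     ≡⟨ cong (r ℚ.*_) eδ ⟨
    r ℚ.* (e ℚ.* δ)              ≤⟨ ℚₚ.*-monoˡ-≤-nonNeg r {{ℚ.nonNegative 0≤r}}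
                                      (ℚₚ.*-monoʳ-≤-nonNeg δ {{ℚ.nonNegative (ℚₚ.<⇒≤ 0<δ)}}
                                        (ℚₚ.≤-trans e≤i (ι-mono (ℕₚ.n≤1+n i)))) ⟩
    r ℚ.* (ι (suc i) ℚ.* δ)      ≡⟨ ℚₚ.*-assoc r (ι (suc i)) δ ⟨
    r ℚ.* ι (suc i) ℚ.* δ        ≡⟨ cong (ℚ._* δ) r* ⟩
    1ℚ ℚ.* δ                     ≡⟨ ℚₚ.*-identityˡ δ ⟩
    δ                            ∎
    where open ℚₚ.≤-Reasoning

  ½^-small : ∀ C ε → 0ℚ ℚ.≤ C → 0ℚ ℚ.< ε → ∃[ i ] C ℚ.* ½^ i ℚ.< ε
  ½^-small C ε 0≤C 0<ε = from-δ (shrink C ε 0≤C 0<ε)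
    where
    from-e : ∀ δ → 0ℚ ℚ.< δ → C ℚ.* δ ℚ.< ε → ∀ e → e ℚ.* δ ≡ 1ℚ →
      (∃[ i ] e ℚ.≤ ι i) → ∃[ i ] C ℚ.* ½^ i ℚ.< ε
    from-e δ 0<δ Cδ<ε e eδ≡1 (i , e≤i) = i , ℚₚ.≤-<-trans
      (ℚₚ.*-monoˡ-≤-nonNeg C {{ℚ.nonNegative 0≤C}} {½^ i} {δ}
        (ℚₚ.≤-trans (½^-≤ i) (recip≤ i δ e (+ 1 / suc i) (0≤1/ i) (recip i) 0<δ eδ≡1 e≤i)))
      Cδ<ε
    from-δ : (∃[ δ ] 0ℚ ℚ.< δ × C ℚ.* δ ℚ.< ε) → ∃[ i ] C ℚ.* ½^ i ℚ.< ε
    from-δ (δ , 0<δ , Cδ<ε) = let (e , eδ≡1) = inverse δ 0<δ in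
      from-e δ 0<δ Cδ<ε e eδ≡1 (archimedean e)

  re≤dist : ∀ z w j → ℚ.∣ seq (re z) j ℚ.- seq (re w) j ∣ ℚ.≤ dist z w j
  re≤dist z w j = p≤p+q ℚ.∣ seq (re z) j ℚ.- seq (re w) j ∣ ℚ.∣ seq (im z) j ℚ.- seq (im w) j ∣
    (ℚₚ.0≤∣p∣ (seq (im z) j ℚ.- seq (im w) j))

  im≤dist : ∀ z w j → ℚ.∣ seq (im z) j ℚ.- seq (im w) j ∣ ℚ.≤ dist z w j
  im≤dist z w j = subst (ℚ.∣ seq (im z) j ℚ.- seq (im w) j ∣ ℚ.≤_)
    (ℚₚ.+-comm ℚ.∣ seq (im z) j ℚ.- seq (im w) j ∣ ℚ.∣ seq (re z) j ℚ.- seq (re w) j ∣)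
    (p≤p+q ℚ.∣ seq (im z) j ℚ.- seq (im w) j ∣ ℚ.∣ seq (re z) j ℚ.- seq (re w) j ∣
      (ℚₚ.0≤∣p∣ (seq (re z) j ℚ.- seq (re w) j)))

  dist-step : ∀ z w t j → dist (z +ᶜ t) w j ℚ.≤ dist z w j ℚ.+ ‖ t ‖ j
  dist-step z w t j = go (seq (re z) j) (seq (re w) j) (seq (re t) j)
                         (seq (im z) j) (seq (im w) j) (seq (im t) j)
    where
    lem : ∀ a b c → ℚ.∣ a ℚ.+ c ℚ.- b ∣ ℚ.≤ ℚ.∣ a ℚ.- b ∣ ℚ.+ ℚ.∣ c ∣
    lem a b c = subst (λ x → ℚ.∣ x ∣ ℚ.≤ ℚ.∣ a ℚ.- b ∣ ℚ.+ ℚ.∣ c ∣)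
      (+.xy∙z≈xz∙y a (ℚ.- b) c)
      (ℚₚ.∣p+q∣≤∣p∣+∣q∣ (a ℚ.- b) c)
    go : ∀ a b c a′ b′ c′ →
      ℚ.∣ a ℚ.+ c ℚ.- b ∣ ℚ.+ ℚ.∣ a′ ℚ.+ c′ ℚ.- b′ ∣
        ℚ.≤ (ℚ.∣ a ℚ.- b ∣ ℚ.+ ℚ.∣ a′ ℚ.- b′ ∣) ℚ.+ (ℚ.∣ c ∣ ℚ.+ ℚ.∣ c′ ∣)
    go a b c a′ b′ c′ = subst (ℚ.∣ a ℚ.+ c ℚ.- b ∣ ℚ.+ ℚ.∣ a′ ℚ.+ c′ ℚ.- b′ ∣ ℚ.≤_)
      (+.interchange ℚ.∣ a ℚ.- b ∣ ℚ.∣ c ∣ ℚ.∣ a′ ℚ.- b′ ∣ ℚ.∣ c′ ∣)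
      (ℚₚ.+-mono-≤ (lem a b c) (lem a′ b′ c′))

  dist-self : ∀ z j → dist z z j ≡ 0ℚ
  dist-self z j = cong₂ ℚ._+_ (zero-diff (seq (re z) j)) (zero-diff (seq (im z) j))
    where
    zero-diff : ∀ a → ℚ.∣ a ℚ.- a ∣ ≡ 0ℚ
    zero-diff a = cong ℚ.∣_∣ (ℚₚ.+-inverseʳ a)

  module Tail (z : ℂ) (j : ℕ) (B : ℚ) (0≤B : 0ℚ ℚ.≤ B) (z≤B : ‖ z ‖ j ℚ.≤ B)
              (K : ℕ) (2B≤K : B ℚ.+ B ℚ.≤ ι K) where
    open ℚₚ.≤-Reasoning

    t : ℕ → ℚ
    t k = ‖ expTerm z k ‖ j

    halve : ∀ k → K ℕ.≤ k → t (suc k) ℚ.≤ ½ ℚ.* t k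
    halve k K≤k = ℚₚ.≤-trans (term-step z j B z≤B k)
      (ℚₚ.*-monoʳ-≤-nonNeg (t k) {{ℚ.nonNegative (‖‖-nonNeg (expTerm z k) j)}} (ratio B K 2B≤K k K≤k))

    decay : ∀ i → t (i ℕ.+ K) ℚ.≤ term-bound B K ℚ.* ½^ i
    decay zero    = ℚₚ.≤-trans (term-bounded z j B 0≤B z≤B K) (ℚₚ.≤-reflexive (sym (ℚₚ.*-identityʳ (term-bound B K))))
    decay (suc i) = begin
      t (suc (i ℕ.+ K))                    ≤⟨ halve (i ℕ.+ K) (ℕₚ.m≤n+m K i) ⟩
      ½ ℚ.* t (i ℕ.+ K)                    ≤⟨ ℚₚ.*-monoˡ-≤-nonNeg ½ (decay i) ⟩
      ½ ℚ.* (term-bound B K ℚ.* ½^ i)      ≡⟨ *.x∙yz≈y∙xz ½ (term-bound B K) (½^ i) ⟩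
      term-bound B K ℚ.* (½ ℚ.* ½^ i)      ∎

    tail : ∀ n l → K ℕ.≤ n →
      dist (expSum z (l ℕ.+ n)) (expSum z n) j ℚ.+ (t (l ℕ.+ n) ℚ.+ t (l ℕ.+ n)) ℚ.≤ t n ℚ.+ t n
    tail n zero    K≤n = ℚₚ.≤-reflexive
      (trans (cong (ℚ._+ (t n ℚ.+ t n)) (dist-self (expSum z n) j)) (ℚₚ.+-identityˡ _))
    tail n (suc l) K≤n = begin
      dist (expSum z m +ᶜ expTerm z m) (expSum z n) j ℚ.+ (t (suc m) ℚ.+ t (suc m))
        ≤⟨ ℚₚ.+-mono-≤ (dist-step (expSum z m) (expSum z n) (expTerm z m) j) (ℚₚ.+-mono-≤ h h) ⟩
      (D ℚ.+ t m) ℚ.+ (½ ℚ.* t m ℚ.+ ½ ℚ.* t m)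
        ≡⟨ trans (cong (D ℚ.+ t m ℚ.+_) (½+½ (t m))) (ℚₚ.+-assoc D (t m) (t m)) ⟩
      D ℚ.+ (t m ℚ.+ t m)
        ≤⟨ tail n l K≤n ⟩
      t n ℚ.+ t n ∎
      where
      m : ℕ
      m = l ℕ.+ n
      D : ℚ
      D = dist (expSum z m) (expSum z n) j
      h : t (suc m) ℚ.≤ ½ ℚ.* t m
      h = halve m (ℕₚ.≤-trans K≤n (ℕₚ.m≤n+m n l))

    dist-tail : ∀ n l → K ℕ.≤ n → dist (expSum z (l ℕ.+ n)) (expSum z n) j ℚ.≤ t n ℚ.+ t n
    dist-tail n l K≤n = ℚₚ.≤-trans
      (p≤p+q (dist (expSum z (l ℕ.+ n)) (expSum z n) j) (t (l ℕ.+ n) ℚ.+ t (l ℕ.+ n))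
        (ℚₚ.+-mono-≤ (‖‖-nonNeg (expTerm z (l ℕ.+ n)) j) (‖‖-nonNeg (expTerm z (l ℕ.+ n)) j)))
      (tail n l K≤n)

  tail-small : ∀ z ε B → 0ℚ ℚ.≤ B → ∀ K → B ℚ.+ B ℚ.≤ ι K →
    ∀ i → term-bound B K ℚ.* ½^ i ℚ.< ½ ℚ.* ε →
    ∀ j → ‖ z ‖ j ℚ.≤ B → ∀ n → i ℕ.+ K ℕ.≤ n →
    dist (expSum z n) (expSum z (i ℕ.+ K)) j ℚ.< ε
  tail-small z ε B 0≤B K 2B≤K i small j z≤B n M≤n =
    halves (T.t (i ℕ.+ K)) (T.t (i ℕ.+ K)) (dist (expSum z n) (expSum z (i ℕ.+ K)) j) ε
      (subst (λ m → dist (expSum z m) (expSum z (i ℕ.+ K)) j ℚ.≤ T.t (i ℕ.+ K) ℚ.+ T.t (i ℕ.+ K))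
        (ℕₚ.m∸n+n≡m M≤n)
        (T.dist-tail (i ℕ.+ K) (n ℕ.∸ (i ℕ.+ K)) (ℕₚ.m≤n+m K i)))
      t< t<
    where
    module T = Tail z j B 0≤B z≤B K 2B≤K
    t< : T.t (i ℕ.+ K) ℚ.< ½ ℚ.* ε
    t< = ℚₚ.≤-<-trans (T.decay i) small

  ‖‖-bound : ∀ z → ∃[ B ] 0ℚ ℚ.≤ B × ∃[ J ] ∀ j → J ℕ.≤ j → ‖ z ‖ j ℚ.≤ B
  ‖‖-bound z =
    let (A , I , 0≤A , a≤) = cauchy-bound (cauchy (re z))
        (B , J , 0≤B , b≤) = cauchy-bound (cauchy (im z))
    in A ℚ.+ B , ℚₚ.+-mono-≤ 0≤A 0≤B , I ⊔ J , λ j IJ≤j →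
      ℚₚ.+-mono-≤ (a≤ j (ℕₚ.m⊔n≤o⇒m≤o I J IJ≤j)) (b≤ j (ℕₚ.m⊔n≤o⇒n≤o I J IJ≤j))

  expSum-uniform : ∀ z ε → 0ℚ ℚ.< ε → Uniform z ε
  expSum-uniform z ε 0<ε = from-bound (‖‖-bound z)
    where
    from-small : ∀ B → 0ℚ ℚ.≤ B → ∀ J → (∀ j → J ℕ.≤ j → ‖ z ‖ j ℚ.≤ B) →
      ∀ K → B ℚ.+ B ℚ.≤ ι K → (∃[ i ] term-bound B K ℚ.* ½^ i ℚ.< ½ ℚ.* ε) → Uniform z ε
    from-small B 0≤B J z≤B K 2B≤K (i , small) = i ℕ.+ K , J , λ n j M≤n J≤j →
      tail-small z ε B 0≤B K 2B≤K i small j (z≤B j J≤j) n M≤n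
    from-arch : ∀ B → 0ℚ ℚ.≤ B → ∀ J → (∀ j → J ℕ.≤ j → ‖ z ‖ j ℚ.≤ B) →
      (∃[ K ] B ℚ.+ B ℚ.≤ ι K) → Uniform z ε
    from-arch B 0≤B J z≤B (K , 2B≤K) = from-small B 0≤B J z≤B K 2B≤K
      (½^-small (term-bound B K) (½ ℚ.* ε) (term-bound-nonNeg B 0≤B K) (half-pos ε 0<ε))
    from-bound : (∃[ B ] 0ℚ ℚ.≤ B × ∃[ J ] ∀ j → J ℕ.≤ j → ‖ z ‖ j ℚ.≤ B) → Uniform z ε
    from-bound (B , 0≤B , J , z≤B) = from-arch B 0≤B J z≤B (archimedean (B ℚ.+ B))

  diagonal-cauchy : (s : ℕ → ℝ) →
    (∀ ε → 0ℚ ℚ.< ε → ∃[ M ] ∃[ J ] ∀ n j → M ℕ.≤ n → J ℕ.≤ j →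
      ℚ.∣ seq (s n) j ℚ.- seq (s M) j ∣ ℚ.< ε) →
    IsCauchy (λ n → seq (s n) n)
  diagonal-cauchy s u = mkCauchy go
    where
    three : ∀ ε a b c d → ℚ.∣ a ℚ.- b ∣ ℚ.< ½ ℚ.* (½ ℚ.* ε) → ℚ.∣ b ℚ.- c ∣ ℚ.< ½ ℚ.* ε →
      ℚ.∣ d ℚ.- c ∣ ℚ.< ½ ℚ.* (½ ℚ.* ε) → ℚ.∣ a ℚ.- d ∣ ℚ.< ε
    three ε a b c d ab bc dc = halves ℚ.∣ b ℚ.- c ∣ (ℚ.∣ a ℚ.- b ∣ ℚ.+ ℚ.∣ c ℚ.- d ∣) ℚ.∣ a ℚ.- d ∣ ε
      (ℚₚ.≤-trans (triangle a c d) (ℚₚ.≤-trans (ℚₚ.+-monoˡ-≤ ℚ.∣ c ℚ.- d ∣ (triangle a b c))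
        (ℚₚ.≤-reflexive (+.xy∙z≈y∙xz ℚ.∣ a ℚ.- b ∣ ℚ.∣ b ℚ.- c ∣ ℚ.∣ c ℚ.- d ∣))))
      bc
      (halves ℚ.∣ a ℚ.- b ∣ ℚ.∣ c ℚ.- d ∣ _ (½ ℚ.* ε) ℚₚ.≤-refl ab
        (subst (ℚ._< ½ ℚ.* (½ ℚ.* ε)) (∣-∣-comm d c) dc))
    go : ∀ ε → 0ℚ ℚ.< ε →
      ∃[ N ] ∀ m n → N ℕ.≤ m → N ℕ.≤ n → ℚ.∣ seq (s m) m ℚ.- seq (s n) n ∣ ℚ.< ε
    go ε 0<ε with u (½ ℚ.* (½ ℚ.* ε)) (half-pos (½ ℚ.* ε) (half-pos ε 0<ε))
    ... | M , J , h with modulus (cauchy (s M)) (½ ℚ.* ε) (half-pos ε 0<ε)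
    ... | N , g = (M ⊔ J) ⊔ N , λ m n p q →
      let pMJ = ℕₚ.m⊔n≤o⇒m≤o (M ⊔ J) N p
          qMJ = ℕₚ.m⊔n≤o⇒m≤o (M ⊔ J) N q
      in three ε (seq (s m) m) (seq (s M) m) (seq (s M) n) (seq (s n) n)
           (h m m (ℕₚ.m⊔n≤o⇒m≤o M J pMJ) (ℕₚ.m⊔n≤o⇒n≤o M J pMJ))
           (g m n (ℕₚ.m⊔n≤o⇒n≤o (M ⊔ J) N p) (ℕₚ.m⊔n≤o⇒n≤o (M ⊔ J) N q))
           (h n n (ℕₚ.m⊔n≤o⇒m≤o M J qMJ) (ℕₚ.m⊔n≤o⇒n≤o M J qMJ))

  exp-re-cauchy : ∀ z → IsCauchy (λ n → seq (re (expSum z n)) n)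
  exp-re-cauchy z = diagonal-cauchy (λ n → re (expSum z n)) λ ε 0<ε →
    let (M , J , h) = expSum-uniform z ε 0<ε
    in M , J , λ n j p q → ℚₚ.≤-<-trans (re≤dist (expSum z n) (expSum z M) j) (h n j p q)

  exp-im-cauchy : ∀ z → IsCauchy (λ n → seq (im (expSum z n)) n)
  exp-im-cauchy z = diagonal-cauchy (λ n → im (expSum z n)) λ ε 0<ε →
    let (M , J , h) = expSum-uniform z ε 0<ε
    in M , J , λ n j p q → ℚₚ.≤-<-trans (im≤dist (expSum z n) (expSum z M) j) (h n j p q)

-- The limit of the partial sums Σ_{k<n} zᵏ/k!. Their rational approximants
-- converge uniformly in the approximation index, so the diagonal is a Cauchy
-- sequence representing the limit; expSum-converges confirms this.
exp : ℂ → ℂ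
exp z = mkℝ (λ n → seq (re (expSum z n)) n) (exp-re-cauchy z)
     +i mkℝ (λ n → seq (im (expSum z n)) n) (exp-im-cauchy z)

-- ∣ z - w ∣ < ε
Within : ℚ → ℂ → ℂ → Set
Within ε z w = ∣ z -ᶜ w ∣² <ᴿ ofℚ (ε ℚ.* ε)

abstract

  square-abs : ∀ a → a ℚ.* a ≡ ℚ.∣ a ∣ ℚ.* ℚ.∣ a ∣
  square-abs a = sym (∣a*a∣ (ℚₚ.∣p∣≡p∨∣p∣≡-p a))
    where
    neg-neg : (ℚ.- a) ℚ.* (ℚ.- a) ≡ a ℚ.* a
    neg-neg = trans (sym (ℚₚ.neg-distribˡ-* a (ℚ.- a)))
      (trans (cong ℚ.-_ (sym (ℚₚ.neg-distribʳ-* a a))) (⁻¹-involutive (a ℚ.* a)))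
    ∣a*a∣ : ℚ.∣ a ∣ ≡ a ⊎ ℚ.∣ a ∣ ≡ ℚ.- a → ℚ.∣ a ∣ ℚ.* ℚ.∣ a ∣ ≡ a ℚ.* a
    ∣a*a∣ (inj₁ e) = cong₂ ℚ._*_ e e
    ∣a*a∣ (inj₂ e) = trans (cong₂ ℚ._*_ e e) neg-neg

  square-bound : ∀ a b ε → 0ℚ ℚ.< ε → ℚ.∣ a ∣ ℚ.+ ℚ.∣ b ∣ ℚ.< ½ ℚ.* ε →
    a ℚ.* a ℚ.+ b ℚ.* b ℚ.+ (½ ℚ.* ε) ℚ.* (½ ℚ.* ε) ℚ.< ε ℚ.* ε
  square-bound a b ε 0<ε small = begin-strict
    a ℚ.* a ℚ.+ b ℚ.* b ℚ.+ h ℚ.* h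
      ≡⟨ cong (ℚ._+ h ℚ.* h) (cong₂ ℚ._+_ (square-abs a) (square-abs b)) ⟩
    x ℚ.* x ℚ.+ y ℚ.* y ℚ.+ h ℚ.* h
      ≤⟨ ℚₚ.+-monoˡ-≤ (h ℚ.* h) (p≤p+q (x ℚ.* x ℚ.+ y ℚ.* y) (x ℚ.* y ℚ.+ y ℚ.* x)
           (ℚₚ.+-mono-≤ (*-nonNeg x y 0≤x 0≤y) (*-nonNeg y x 0≤y 0≤x))) ⟩
    (x ℚ.* x ℚ.+ y ℚ.* y) ℚ.+ (x ℚ.* y ℚ.+ y ℚ.* x) ℚ.+ h ℚ.* h
      ≡⟨ cong (ℚ._+ h ℚ.* h) (expand x y x y) ⟩
    (x ℚ.+ y) ℚ.* (x ℚ.+ y) ℚ.+ h ℚ.* h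
      ≤⟨ ℚₚ.+-monoˡ-≤ (h ℚ.* h) (*-mono (x ℚ.+ y) h (x ℚ.+ y) h (ℚₚ.<⇒≤ 0<h)
           (ℚₚ.+-mono-≤ 0≤x 0≤y) (ℚₚ.<⇒≤ small) (ℚₚ.<⇒≤ small)) ⟩
    h ℚ.* h ℚ.+ h ℚ.* h
      ≡⟨ ℚₚ.+-identityʳ (h ℚ.* h ℚ.+ h ℚ.* h) ⟨
    (h ℚ.* h ℚ.+ h ℚ.* h) ℚ.+ 0ℚ
      <⟨ ℚₚ.+-monoʳ-< (h ℚ.* h ℚ.+ h ℚ.* h) (ℚₚ.+-mono-< (*-pos h h 0<h 0<h) (*-pos h h 0<h 0<h)) ⟩
    (h ℚ.* h ℚ.+ h ℚ.* h) ℚ.+ (h ℚ.* h ℚ.+ h ℚ.* h)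
      ≡⟨ expand h h h h ⟩
    (h ℚ.+ h) ℚ.* (h ℚ.+ h)
      ≡⟨ cong₂ ℚ._*_ (½+½ ε) (½+½ ε) ⟩
    ε ℚ.* ε ∎
    where
    open ℚₚ.≤-Reasoning
    h x y : ℚ
    h = ½ ℚ.* ε
    x = ℚ.∣ a ∣
    y = ℚ.∣ b ∣
    0<h : 0ℚ ℚ.< h
    0<h = half-pos ε 0<ε
    0≤x : 0ℚ ℚ.≤ x
    0≤x = ℚₚ.0≤∣p∣ a
    0≤y : 0ℚ ℚ.≤ y
    0≤y = ℚₚ.0≤∣p∣ b

  dist-via : ∀ u z w j → dist z w j ℚ.≤ dist z u j ℚ.+ dist w u j
  dist-via u z w j = go (seq (re z) j) (seq (re u) j) (seq (re w) j)
                        (seq (im z) j) (seq (im u) j) (seq (im w) j)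
    where
    tri : ∀ a b c → ℚ.∣ a ℚ.- c ∣ ℚ.≤ ℚ.∣ a ℚ.- b ∣ ℚ.+ ℚ.∣ c ℚ.- b ∣
    tri a b c = subst (λ t → ℚ.∣ a ℚ.- c ∣ ℚ.≤ ℚ.∣ a ℚ.- b ∣ ℚ.+ t) (∣-∣-comm b c) (triangle a b c)
    go : ∀ a b c a′ b′ c′ → ℚ.∣ a ℚ.- c ∣ ℚ.+ ℚ.∣ a′ ℚ.- c′ ∣
      ℚ.≤ (ℚ.∣ a ℚ.- b ∣ ℚ.+ ℚ.∣ a′ ℚ.- b′ ∣) ℚ.+ (ℚ.∣ c ℚ.- b ∣ ℚ.+ ℚ.∣ c′ ℚ.- b′ ∣)
    go a b c a′ b′ c′ = subst (ℚ.∣ a ℚ.- c ∣ ℚ.+ ℚ.∣ a′ ℚ.- c′ ∣ ℚ.≤_)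
      (+.interchange ℚ.∣ a ℚ.- b ∣ ℚ.∣ c ℚ.- b ∣ ℚ.∣ a′ ℚ.- b′ ∣ ℚ.∣ c′ ℚ.- b′ ∣)
      (ℚₚ.+-mono-≤ (tri a b c) (tri a′ b′ c′))

  expSum-converges : ∀ z ε → 0ℚ ℚ.< ε → ∃[ M ] ∀ n → M ℕ.≤ n → Within ε (expSum z n) (exp z)
  expSum-converges z ε 0<ε =
    let (M , J , near) = expSum-uniform z (½ ℚ.* (½ ℚ.* ε)) (half-pos (½ ℚ.* ε) (half-pos ε 0<ε))
    in M , λ n M≤n →
      mk< ((½ ℚ.* ε) ℚ.* (½ ℚ.* ε)) (*-pos (½ ℚ.* ε) (½ ℚ.* ε) (half-pos ε 0<ε) (half-pos ε 0<ε))
        (M ⊔ J , λ j MJ≤j →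
          let M≤j = ℕₚ.m⊔n≤o⇒m≤o M J MJ≤j
              J≤j = ℕₚ.m⊔n≤o⇒n≤o M J MJ≤j
          in square-bound (seq (re (expSum z n)) j ℚ.- seq (re (expSum z j)) j)
                          (seq (im (expSum z n)) j ℚ.- seq (im (expSum z j)) j) ε 0<ε
               (halves (dist (expSum z n) (expSum z M) j) (dist (expSum z j) (expSum z M) j)
                       (dist (expSum z n) (expSum z j) j) (½ ℚ.* ε)
                 (dist-via (expSum z M) (expSum z n) (expSum z j) j)
                 (near n j M≤n J≤j) (near j j M≤j J≤j)))

-- Unordered summation: for every ε > 0, all finite sums over index sets
-- containing a suitable finite set lie within ε of the value.
sumOver : {I : Set} → List I → (I → ℂ) → ℂ
sumOver S f = foldr (λ i z → f i +ᶜ z) 0ᶜ S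

HasSum : {I : Set} → (I → ℂ) → ℂ → Set
HasSum {I} f s = ∀ ε → 0ℚ ℚ.< ε →
  Σ (List I) λ S₀ → ∀ S → Unique S → S₀ ⊆ S → Within ε (sumOver S f) s

sin : ℝ → ℝ
sin x = im (exp (𝕚 *ᶜ ofℝ x))

-- π is the least positive zero of sin.
record IsPi (π : ℝ) : Set where
  field
    0<π   : 0ᴿ <ᴿ π
    sinπ  : sin π ≃ᴿ 0ᴿ
    least : ∀ x → 0ᴿ <ᴿ x → x <ᴿ π → ¬ (sin x ≃ᴿ 0ᴿ)

-- The upper half-plane, the domain of τ.
record ℍ : Set where
  constructor mkℍ
  field
    point  : ℂ
    im-pos : 0ᴿ <ᴿ im point
open ℍ public

abstract
  scale-pos : ∀ k y → 0ℤ ℤ.< k → 0ᴿ <ᴿ y → 0ᴿ <ᴿ ofℚ (k / 1) *ᴿ y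
  scale-pos (+ suc n) y (ℤ.+<+ _) (mk< g 0<g (N , h)) = mk< g 0<g (N , λ j N≤j →
    ℚₚ.<-≤-trans (h j N≤j)
      (ℚₚ.≤-trans (ℚₚ.≤-reflexive (sym (ℚₚ.*-identityˡ (seq y j))))
        (ℚₚ.*-monoʳ-≤-nonNeg (seq y j) {{ℚ.nonNegative (y≥0 j N≤j)}} {1ℚ} {ι (suc n)} 1≤)))
    where
    1≤ : 1ℚ ℚ.≤ ι (suc n)
    1≤ = ι-mono {1} {suc n} (ℕ.s≤s ℕ.z≤n)
    y≥0 : ∀ j → N ℕ.≤ j → 0ℚ ℚ.≤ seq y j
    y≥0 j N≤j = ℚₚ.<⇒≤ (ℚₚ.<-trans 0<g (subst (ℚ._< seq y j) (ℚₚ.+-identityˡ g) (h j N≤j)))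

  0<2d+b : ∀ d b → ℤ.- (+ 2 ℤ.* d) ℤ.< b → 0ℤ ℤ.< + 2 ℤ.* d ℤ.+ b
  0<2d+b d b lt = subst (ℤ._< + 2 ℤ.* d ℤ.+ b) (ℤₚ.+-inverseʳ (+ 2 ℤ.* d)) (ℤₚ.+-monoʳ-< (+ 2 ℤ.* d) lt)

  0<2d-b : ∀ d b → b ℤ.< + 2 ℤ.* d → 0ℤ ℤ.< + 2 ℤ.* d ℤ.- b
  0<2d-b d b lt = subst (ℤ._< + 2 ℤ.* d ℤ.- b) (ℤₚ.+-inverseʳ b) (ℤₚ.+-monoˡ-< (ℤ.- b) lt)

scale : (k : ℤ) → 0ℤ ℤ.< k → ℍ → ℍ
scale k 0<k τ = mkℍ ((k / 1) · point τ) (scale-pos k (im (point τ)) 0<k (im-pos τ))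

module Theta (π : ℝ) where

  -- qʳ = exp (π i r τ)
  q^ : ℍ → ℚ → ℂ
  q^ τ r = exp (ofℝ π *ᶜ 𝕚 *ᶜ ofℝ (ofℚ r) *ᶜ point τ)

  -- exp (2 i z n)
  e^2i : ℂ → ℤ → ℂ
  e^2i z n = exp (ofℤ (+ 2) *ᶜ 𝕚 *ᶜ z *ᶜ ofℤ n)

  [-1]^ : ℤ → ℂ
  [-1]^ n = ofℤ ((ℤ.- (+ 1)) ℤ.^ ℤ.∣ n ∣)

  ϑ₄-term : ℂ → ℍ → ℤ → ℂ
  ϑ₄-term z τ n = [-1]^ n *ᶜ q^ τ ((n ℤ.* n) / 1) *ᶜ e^2i z n

  A-term : (d b : ℤ) → ℂ → ℂ → ℍ → ℤ × ℤ → ℂ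
  A-term d b u v τ (m , n) =
    q^ τ ((d ℤ.* m ℤ.* m ℤ.+ b ℤ.* m ℤ.* n ℤ.+ d ℤ.* n ℤ.* n) / 1)
      *ᶜ e^2i u (m ℤ.+ n) *ᶜ e^2i v (m ℤ.- n)

  C-term : (d b : ℤ) → ℂ → ℂ → ℍ → ℤ × ℤ → ℂ
  C-term d b u v τ (m , n) =
    q^ τ ((d ℤ.* m ℤ.* m ℤ.+ b ℤ.* m ℤ.* n ℤ.+ d ℤ.* n ℤ.* n) / 1
          ℚ.+ (d / 1 ℚ.+ b / 2) ℚ.* (m / 1) ℚ.+ (d / 1 ℚ.+ b / 2) ℚ.* (n / 1)
          ℚ.+ d / 2 ℚ.+ b / 4)
      *ᶜ e^2i u (m ℤ.+ n ℤ.+ + 1) *ᶜ e^2i v (m ℤ.- n)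

  π/2 : ℂ
  π/2 = ofℝ (ofℚ ½ *ᴿ π)

{-# OPTIONS --safe #-}

-- Put s = m + n, t = m - n for A and s = m + n + 1, t = m - n for C. Both exponents become
-- ((2d + b) s² + (2d - b) t²) / 4, where (s , t) ranges over the pairs of equal parity for A and over
-- those of opposite parity for C. Hence A = UₑVₑ + UₒVₒ and C = UₒVₑ + UₑVₒ, where Uₑ, Uₒ, Vₑ, Vₒ are the
-- one-dimensional theta series over the even and the odd integers, and A - C = (Uₑ - Uₒ)(Vₑ - Vₒ) is a
-- product of two ϑ₄. Shifting v by π/2 fixes Vₑ and negates Vₒ, which leaves
-- A² - C² = (Uₑ² - Uₒ²)(Vₑ² - Vₒ²) unchanged.
--
-- The analysis rests on one principle: a family bounded by rational weights whose sums over an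
-- exhausting sequence of finite sets are Cauchy is summable, and its unordered sum may be computed
-- along any exhausting sequence. On ℕ × ℕ, with squares and triangles, it yields exp (z + w) = exp z exp w.

module Submission where

open import Defs
open import Level using (Level; 0ℓ)
open import Algebra.Bundles using (CommutativeRing)
import Algebra.Solver.Ring
import Algebra.Solver.Ring.AlmostCommutativeRing as ACR
open import Data.Empty using (⊥-elim)
open import Data.Integer as ℤ using (ℤ; +_; -[1+_])
import Data.Integer.DivMod as ℤ-DivMod
import Data.Integer.Properties as ℤₚ
import Data.Integer.Tactic.RingSolver as ℤ-Solver
open import Data.List using (List; []; _∷_; _++_; foldr; map; cartesianProduct; downFrom)
open import Data.List.Membership.Propositional using (_∈_)
import Data.List.Membership.Propositional.Properties as ∈ₚ
open import Data.List.Relation.Binary.Permutation.Propositional as ↭ using (_↭_; prep; swap; ↭-refl; ↭-trans)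
import Data.List.Relation.Binary.Permutation.Propositional.Properties as ↭ₚ
open import Data.List.Relation.Binary.Subset.Propositional using (_⊆_)
import Data.List.Relation.Unary.All as All
import Data.List.Relation.Unary.AllPairs as AllPairs
open import Data.List.Relation.Unary.Any using (here; there)
open import Data.List.Relation.Unary.Unique.Propositional using (Unique)
import Data.List.Relation.Unary.Unique.Propositional.Properties as Uniqueₚ
import Data.Maybe as Maybe
open import Data.Nat as ℕ using (ℕ; zero; suc; _⊔_)
import Data.Nat.Coprimality as Coprimality
import Data.Nat.Properties as ℕₚ
open import Data.Product using (∃; ∃-syntax; _×_; _,_; proj₁; proj₂)
open import Data.Rational as ℚ using (ℚ; 0ℚ; 1ℚ; ½)
import Data.Rational.Properties as ℚₚ
open import Data.Sum using (_⊎_; inj₁; inj₂)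
open import Relation.Binary.PropositionalEquality
  using (_≡_; _≢_; refl; sym; trans; cong; cong₂; subst; subst₂; module ≡-Reasoning)
import Relation.Binary.Reasoning.Setoid as SetoidReasoning
open import Relation.Nullary using (¬_; Dec; yes; no)
open import Relation.Nullary.Decidable using (dec⇒maybe)
open import Tactic.RingSolver using (solve-∀)
open import Tactic.RingSolver.Core.AlmostCommutativeRing using (AlmostCommutativeRing; fromCommutativeRing)

-- Finite sums

-- The approximants of a complex number are not invariant under `_≃ᶜ_`. Estimates therefore use the
-- asymptotic bound `_≼_` by a rational, and every dominating series is rational. The ℓ¹ norm behind
-- that bound is only submultiplicative: e^p can have ℓ¹ norm above 1 although its modulus is below
-- 1. The decay of the theta terms is therefore taken from the squared modulus, which is
-- multiplicative on every approximant: |e^p|² = e^(2 Re p), then e^x ≥ 1 + x for x = -2 Re p, then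
-- Bernoulli's inequality for the powers. Since e^p occurs to the power s², one M for which e^(pM)
-- e^(±2iz) has norm at most ½ bounds every term by C ½^|s|. The shift by π/2 rests on e^(iπ) = -1,
-- while π is known only as the least positive zero of the sine. Minimality gives sin(π/2) ≠ 0, the
-- double angle formula then forces cos(π/2) = 0, and cos² + sin² = 1 fixes the value.

private variable
  I I′ : Set

-- Each element of `S` is cut out of `T` where it occurs; uniqueness of `S` keeps its remaining
-- elements away from the occurrence removed. It makes the difference of two nested finite sums a
-- finite sum again.
complement : {S T : List I} → Unique S → S ⊆ T → ∃[ R ] T ↭ S ++ R
complement {S = []}    {T} _ _ = T , ↭-refl
complement {S = x ∷ S} {T} u S⊆T with ∈ₚ.∈-∃++ (S⊆T (here refl))
... | ys , zs , refl =
  let R , p = complement {S = S} {ys ++ zs} (AllPairs.tail u) sub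
  in R , ↭-trans (↭ₚ.shift x ys zs) (prep x p)
  where
  sub : S ⊆ ys ++ zs
  sub {y} y∈S with ∈ₚ.∈-++⁻ ys (S⊆T (there y∈S))
  ... | inj₁ y∈ys          = ∈ₚ.∈-++⁺ˡ y∈ys
  ... | inj₂ (here refl)   = ⊥-elim (Uniqueₚ.Unique[x∷xs]⇒x∉xs u y∈S)
  ... | inj₂ (there y∈zs)  = ∈ₚ.∈-++⁺ʳ ys y∈zs

module Sum {c ℓ : Level} (R : CommutativeRing c ℓ) where
  open CommutativeRing R renaming (refl to ≈-refl; sym to ≈-sym; trans to ≈-trans)
  open SetoidReasoning setoid

  -- Generic because weights are summed in ℚ and terms in ℂ; over ℂ it is definitionally `sumOver`.
  ∑[_]_ : List I → (I → Carrier) → Carrier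
  ∑[ S ] f = foldr (λ i z → f i + z) 0# S

  ∑-cong : {f g : I → Carrier} (S : List I) → (∀ i → f i ≈ g i) → ∑[ S ] f ≈ ∑[ S ] g
  ∑-cong []      f≈g = ≈-refl
  ∑-cong (i ∷ S) f≈g = +-cong (f≈g i) (∑-cong S f≈g)

  ∑-++ : (S T : List I) (f : I → Carrier) → ∑[ S ++ T ] f ≈ ∑[ S ] f + ∑[ T ] f
  ∑-++ []      T f = ≈-sym (+-identityˡ _)
  ∑-++ (i ∷ S) T f = ≈-trans (+-congˡ (∑-++ S T f)) (≈-sym (+-assoc _ _ _))

  ∑-map : (h : I → I′) (S : List I) (f : I′ → Carrier) → ∑[ map h S ] f ≈ ∑[ S ] (λ i → f (h i))
  ∑-map h []      f = ≈-refl
  ∑-map h (i ∷ S) f = +-congˡ (∑-map h S f)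

  ∑-↭ : {S T : List I} (f : I → Carrier) → S ↭ T → ∑[ S ] f ≈ ∑[ T ] f
  ∑-↭ f ↭.refl        = ≈-refl
  ∑-↭ f (prep i p)    = +-congˡ (∑-↭ f p)
  ∑-↭ f (swap {S} {T} i j p) = begin
    f i + (f j + ∑[ S ] f)  ≈⟨ +-assoc _ _ _ ⟨
    f i + f j + ∑[ S ] f    ≈⟨ +-cong (+-comm _ _) (∑-↭ f p) ⟩
    f j + f i + ∑[ T ] f    ≈⟨ +-assoc _ _ _ ⟩
    f j + (f i + ∑[ T ] f)  ∎
  ∑-↭ f (↭.trans p q) = ≈-trans (∑-↭ f p) (∑-↭ f q)

  ∑-*ˡ : (c : Carrier) (S : List I) (f : I → Carrier) → ∑[ S ] (λ i → c * f i) ≈ c * ∑[ S ] f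
  ∑-*ˡ c []      f = ≈-sym (zeroʳ c)
  ∑-*ˡ c (i ∷ S) f = ≈-trans (+-congˡ (∑-*ˡ c S f)) (≈-sym (distribˡ _ _ _))

  ∑-+ : (S : List I) (f g : I → Carrier) → ∑[ S ] (λ i → f i + g i) ≈ ∑[ S ] f + ∑[ S ] g
  ∑-+ []      f g = ≈-sym (+-identityˡ 0#)
  ∑-+ (i ∷ S) f g = ≈-trans (+-congˡ (∑-+ S f g)) (interchange _ _ _ _)
    where open import Algebra.Properties.CommutativeSemigroup +-commutativeSemigroup using (interchange)

  ∑-neg : (S : List I) (f : I → Carrier) → ∑[ S ] (λ i → - f i) ≈ - ∑[ S ] f
  ∑-neg []      f = ≈-sym (-0#≈0#)
    where open import Algebra.Properties.Ring ring using (-0#≈0#)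
  ∑-neg (i ∷ S) f = ≈-trans (+-congˡ (∑-neg S f)) (-‿+-comm (f i) (∑[ S ] f))
    where open import Algebra.Properties.Ring ring using (-‿+-comm)

  ∑-product : (S : List I) (T : List I′) (f : I → Carrier) (g : I′ → Carrier) →
    ∑[ cartesianProduct S T ] (λ (i , j) → f i * g j) ≈ ∑[ S ] f * ∑[ T ] g
  ∑-product []      T f g = ≈-sym (zeroˡ _)
  ∑-product (i ∷ S) T f g = begin
    ∑[ map (i ,_) T ++ cartesianProduct S T ] h
      ≈⟨ ∑-++ (map (i ,_) T) (cartesianProduct S T) h ⟩
    ∑[ map (i ,_) T ] h + ∑[ cartesianProduct S T ] h
      ≈⟨ +-cong (≈-trans (∑-map (i ,_) T h) (∑-*ˡ (f i) T g)) (∑-product S T f g) ⟩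
    f i * ∑[ T ] g + ∑[ S ] f * ∑[ T ] g
      ≈⟨ distribʳ _ _ _ ⟨
    (f i + ∑[ S ] f) * ∑[ T ] g ∎
    where
    h : _ → Carrier
    h (i , j) = f i * g j

module Analysis where
  open import Data.Rational using (_/_; _+_; _*_; _-_; -_; _<_; _≤_; ∣_∣)

  ℚ-ring : AlmostCommutativeRing 0ℓ 0ℓ
  ℚ-ring = fromCommutativeRing ℚₚ.+-*-commutativeRing (λ x → dec⇒maybe (0ℚ ℚₚ.≟ x))

  -- Eventual properties and equality of Cauchy reals

  Eventually : (ℕ → Set) → Set
  Eventually P = ∃[ N ] ∀ n → N ℕ.≤ n → P n

  module _ {P Q : ℕ → Set} where

    eventually-map : (∀ n → P n → Q n) → Eventually P → Eventually Q
    eventually-map f (N , h) = N , λ n N≤n → f n (h n N≤n)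

    infixr 4 _∧ᵉ_
    _∧ᵉ_ : Eventually P → Eventually Q → Eventually (λ n → P n × Q n)
    (M , g) ∧ᵉ (N , h) = M ⊔ N , λ n p →
      g n (ℕₚ.m⊔n≤o⇒m≤o M N p) , h n (ℕₚ.m⊔n≤o⇒n≤o M N p)

  eventually-witness : {P : ℕ → Set} → Eventually P → ∃ P
  eventually-witness (N , h) = N , h N ℕₚ.≤-refl

  abstract

    -- Ring laws need no ε: they hold at every approximation index and so reduce to identities in ℚ.
    pointwise : ∀ {x y} → (∀ n → seq x n ≡ seq y n) → x ≃ᴿ y
    pointwise {x} {y} eq = mk≃ λ ε 0<ε → 0 , λ n _ →
      subst (λ t → ∣ t ∣ < ε) (sym (trans (cong (_- seq y n) (eq n)) (ℚₚ.+-inverseʳ (seq y n)))) 0<ε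

    ≃ᴿ-sym : ∀ {x y} → x ≃ᴿ y → y ≃ᴿ x
    ≃ᴿ-sym {x} {y} x≃y = mk≃ λ ε 0<ε →
      eventually-map (λ n → subst (_< ε) (∣-∣-comm (seq x n) (seq y n))) (close x≃y ε 0<ε)

    ≃ᴿ-trans : ∀ {x y z} → x ≃ᴿ y → y ≃ᴿ z → x ≃ᴿ z
    ≃ᴿ-trans {x} {y} {z} x≃y y≃z = mk≃ λ ε 0<ε →
      eventually-map (λ n (p , q) → halves _ _ _ ε (triangle (seq x n) (seq y n) (seq z n)) p q)
        (close x≃y (½ * ε) (half-pos ε 0<ε) ∧ᵉ close y≃z (½ * ε) (half-pos ε 0<ε))

    +ᴿ-cong : ∀ {x x′ y y′} → x ≃ᴿ x′ → y ≃ᴿ y′ → x +ᴿ y ≃ᴿ x′ +ᴿ y′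
    +ᴿ-cong {x} {x′} {y} {y′} p q = mk≃ λ ε 0<ε →
      eventually-map (λ n (h , k) → halves _ _ _ ε
        (subst (λ t → ∣ t ∣ ≤ ∣ seq x n - seq x′ n ∣ + ∣ seq y n - seq y′ n ∣)
          (sub+sub (seq x n) (seq x′ n) (seq y n) (seq y′ n))
          (ℚₚ.∣p+q∣≤∣p∣+∣q∣ (seq x n - seq x′ n) (seq y n - seq y′ n)))
        h k)
        (close p (½ * ε) (half-pos ε 0<ε) ∧ᵉ close q (½ * ε) (half-pos ε 0<ε))

    -ᴿ-cong : ∀ {x x′} → x ≃ᴿ x′ → -ᴿ x ≃ᴿ -ᴿ x′
    -ᴿ-cong {x} {x′} p = mk≃ λ ε 0<ε →
      eventually-map (λ n → subst (_< ε)
        (trans (sym (ℚₚ.∣-p∣≡∣p∣ (seq x n - seq x′ n))) (cong ∣_∣ (neg-sub (seq x n) (seq x′ n)))))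
        (close p ε 0<ε)

    *ᴿ-cong : ∀ {x x′ y y′} → x ≃ᴿ x′ → y ≃ᴿ y′ → x *ᴿ y ≃ᴿ x′ *ᴿ y′
    *ᴿ-cong {x} {x′} {y} {y′} p q = mk≃ λ ε 0<ε →
      let (A , M , 0≤A , x≤A)  = cauchy-bound (cauchy x)
          (B , N , 0≤B , y′≤B) = cauchy-bound (cauchy y′)
          (δ , 0<δ , δ<ε)      = shrink (A + B) ε (ℚₚ.+-mono-≤ 0≤A 0≤B) 0<ε
      in eventually-map (λ n (x≤ , y′≤ , h , k) →
           ℚₚ.≤-<-trans (product-close (seq x n) (seq x′ n) (seq y n) (seq y′ n) A B δ
             0≤A (ℚₚ.<⇒≤ 0<δ) x≤ (ℚₚ.<⇒≤ k) (ℚₚ.<⇒≤ h) y′≤) δ<ε)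
         ((M , x≤A) ∧ᵉ (N , y′≤B) ∧ᵉ close p δ 0<δ ∧ᵉ close q δ 0<δ)

  ≃ᴿ-refl : ∀ {x} → x ≃ᴿ x
  ≃ᴿ-refl = pointwise λ _ → refl

  ≃ᶜ-refl : ∀ {z} → z ≃ᶜ z
  ≃ᶜ-refl = mk≃ᶜ ≃ᴿ-refl ≃ᴿ-refl

  ≃ᶜ-sym : ∀ {z w} → z ≃ᶜ w → w ≃ᶜ z
  ≃ᶜ-sym (mk≃ᶜ p q) = mk≃ᶜ (≃ᴿ-sym p) (≃ᴿ-sym q)

  ≃ᶜ-trans : ∀ {z w u} → z ≃ᶜ w → w ≃ᶜ u → z ≃ᶜ u
  ≃ᶜ-trans (mk≃ᶜ p q) (mk≃ᶜ p′ q′) = mk≃ᶜ (≃ᴿ-trans p p′) (≃ᴿ-trans q q′)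

  pointwiseᶜ : ∀ {z w} → (∀ n → seq (re z) n ≡ seq (re w) n) → (∀ n → seq (im z) n ≡ seq (im w) n) → z ≃ᶜ w
  pointwiseᶜ p q = mk≃ᶜ (pointwise p) (pointwise q)

  -- The complex numbers as a commutative ring

  -ᶜ_ : ℂ → ℂ
  -ᶜ z = (-ᴿ re z) +i (-ᴿ im z)

  infix 8 -ᶜ_

  +ᶜ-cong : ∀ {z z′ w w′} → z ≃ᶜ z′ → w ≃ᶜ w′ → z +ᶜ w ≃ᶜ z′ +ᶜ w′
  +ᶜ-cong (mk≃ᶜ p q) (mk≃ᶜ p′ q′) = mk≃ᶜ (+ᴿ-cong p p′) (+ᴿ-cong q q′)

  -ᶜ-cong : ∀ {z w} → z ≃ᶜ w → -ᶜ z ≃ᶜ -ᶜ w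
  -ᶜ-cong (mk≃ᶜ p q) = mk≃ᶜ (-ᴿ-cong p) (-ᴿ-cong q)

  *ᶜ-cong : ∀ {z z′ w w′} → z ≃ᶜ z′ → w ≃ᶜ w′ → z *ᶜ w ≃ᶜ z′ *ᶜ w′
  *ᶜ-cong (mk≃ᶜ p q) (mk≃ᶜ p′ q′) = mk≃ᶜ
    (+ᴿ-cong (*ᴿ-cong p p′) (-ᴿ-cong (*ᴿ-cong q q′)))
    (+ᴿ-cong (*ᴿ-cong p q′) (*ᴿ-cong q p′))

  ℂ-commutativeRing : CommutativeRing 0ℓ 0ℓ
  ℂ-commutativeRing = record
    { Carrier = ℂ ; _≈_ = _≃ᶜ_ ; _+_ = _+ᶜ_ ; _*_ = _*ᶜ_ ; -_ = -ᶜ_ ; 0# = 0ᶜ ; 1# = 1ᶜ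
    ; isCommutativeRing = record
      { isRing = record
        { +-isAbelianGroup = record
          { isGroup = record
            { isMonoid = record
              { isSemigroup = record
                { isMagma = record
                  { isEquivalence = record { refl = ≃ᶜ-refl ; sym = ≃ᶜ-sym ; trans = ≃ᶜ-trans }
                  ; ∙-cong = +ᶜ-cong }
                ; assoc = λ (a +i b) (c +i d) (e +i f) → pointwiseᶜ
                    (λ n → ℚₚ.+-assoc (seq a n) (seq c n) (seq e n)) (λ n → ℚₚ.+-assoc (seq b n) (seq d n) (seq f n)) }
              ; identity = (λ (a +i b) → pointwiseᶜ (λ n → ℚₚ.+-identityˡ (seq a n)) (λ n → ℚₚ.+-identityˡ (seq b n)))
                         , (λ (a +i b) → pointwiseᶜ (λ n → ℚₚ.+-identityʳ (seq a n)) (λ n → ℚₚ.+-identityʳ (seq b n))) }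
            ; inverse = (λ (a +i b) → pointwiseᶜ (λ n → ℚₚ.+-inverseˡ (seq a n)) (λ n → ℚₚ.+-inverseˡ (seq b n)))
                      , (λ (a +i b) → pointwiseᶜ (λ n → ℚₚ.+-inverseʳ (seq a n)) (λ n → ℚₚ.+-inverseʳ (seq b n)))
            ; ⁻¹-cong = -ᶜ-cong }
          ; comm = λ (a +i b) (c +i d) → pointwiseᶜ
              (λ n → ℚₚ.+-comm (seq a n) (seq c n)) (λ n → ℚₚ.+-comm (seq b n) (seq d n)) }
        ; *-cong = *ᶜ-cong
        ; *-assoc = λ (a +i b) (c +i d) (e +i f) → pointwiseᶜ
            (λ n → *-assoc-re (seq a n) (seq b n) (seq c n) (seq d n) (seq e n) (seq f n))
            (λ n → *-assoc-im (seq a n) (seq b n) (seq c n) (seq d n) (seq e n) (seq f n))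
        ; *-identity = (λ (a +i b) → pointwiseᶜ (λ n → *-identityˡ-re (seq a n) (seq b n))
                                                (λ n → *-identityˡ-im (seq a n) (seq b n)))
                     , (λ (a +i b) → pointwiseᶜ (λ n → *-identityʳ-re (seq a n) (seq b n))
                                                (λ n → *-identityʳ-im (seq a n) (seq b n)))
        ; distrib = (λ (a +i b) (c +i d) (e +i f) → pointwiseᶜ
                      (λ n → distribˡ-re (seq a n) (seq b n) (seq c n) (seq d n) (seq e n) (seq f n))
                      (λ n → distribˡ-im (seq a n) (seq b n) (seq c n) (seq d n) (seq e n) (seq f n)))
                  , (λ (a +i b) (c +i d) (e +i f) → pointwiseᶜ
                      (λ n → distribʳ-re (seq a n) (seq b n) (seq c n) (seq d n) (seq e n) (seq f n))
                      (λ n → distribʳ-im (seq a n) (seq b n) (seq c n) (seq d n) (seq e n) (seq f n))) }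
      ; *-comm = λ (a +i b) (c +i d) → pointwiseᶜ
          (λ n → *-comm-re (seq a n) (seq b n) (seq c n) (seq d n))
          (λ n → *-comm-im (seq a n) (seq b n) (seq c n) (seq d n)) } }
    where
    *-assoc-re : ∀ a b c d e f →
      (a * c - b * d) * e - (a * d + b * c) * f ≡ a * (c * e - d * f) - b * (c * f + d * e)
    *-assoc-re = solve-∀ ℚ-ring
    *-assoc-im : ∀ a b c d e f →
      (a * c - b * d) * f + (a * d + b * c) * e ≡ a * (c * f + d * e) + b * (c * e - d * f)
    *-assoc-im = solve-∀ ℚ-ring
    *-identityˡ-re : ∀ a b → 1ℚ * a - 0ℚ * b ≡ a
    *-identityˡ-re = solve-∀ ℚ-ring
    *-identityˡ-im : ∀ a b → 1ℚ * b + 0ℚ * a ≡ b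
    *-identityˡ-im = solve-∀ ℚ-ring
    *-identityʳ-re : ∀ a b → a * 1ℚ - b * 0ℚ ≡ a
    *-identityʳ-re = solve-∀ ℚ-ring
    *-identityʳ-im : ∀ a b → a * 0ℚ + b * 1ℚ ≡ b
    *-identityʳ-im = solve-∀ ℚ-ring
    distribˡ-re : ∀ a b c d e f → a * (c + e) - b * (d + f) ≡ (a * c - b * d) + (a * e - b * f)
    distribˡ-re = solve-∀ ℚ-ring
    distribˡ-im : ∀ a b c d e f → a * (d + f) + b * (c + e) ≡ (a * d + b * c) + (a * f + b * e)
    distribˡ-im = solve-∀ ℚ-ring
    distribʳ-re : ∀ a b c d e f → (c + e) * a - (d + f) * b ≡ (c * a - d * b) + (e * a - f * b)
    distribʳ-re = solve-∀ ℚ-ring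
    distribʳ-im : ∀ a b c d e f → (c + e) * b + (d + f) * a ≡ (c * b + d * a) + (e * b + f * a)
    distribʳ-im = solve-∀ ℚ-ring
    *-comm-re : ∀ a b c d → a * c - b * d ≡ c * a - d * b
    *-comm-re = solve-∀ ℚ-ring
    *-comm-im : ∀ a b c d → a * d + b * c ≡ c * b + d * a
    *-comm-im = solve-∀ ℚ-ring

  module ℂᵣ = CommutativeRing ℂ-commutativeRing

  fromℚ : ℚ → ℂ
  fromℚ r = ofℝ (ofℚ r)

  private
    *-homo-re : ∀ r s → r * s ≡ r * s - 0ℚ * 0ℚ
    *-homo-re = solve-∀ ℚ-ring
    *-homo-im : ∀ r s → 0ℚ ≡ r * 0ℚ + 0ℚ * s
    *-homo-im = solve-∀ ℚ-ring

  ℂ-almostCommutativeRing : ACR.AlmostCommutativeRing 0ℓ 0ℓ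
  ℂ-almostCommutativeRing = ACR.fromCommutativeRing ℂ-commutativeRing

  -- The ring solver has to compare coefficients. They are taken rational, where equality is
  -- decidable.
  fromℚ-morphism : ℚₚ.+-*-rawRing ACR.-Raw-AlmostCommutative⟶ ℂ-almostCommutativeRing
  fromℚ-morphism = record
    { ⟦_⟧ = fromℚ
    ; +-homo = λ r s → pointwiseᶜ (λ _ → refl) (λ _ → refl)
    ; *-homo = λ r s → pointwiseᶜ (λ _ → *-homo-re r s) (λ _ → *-homo-im r s)
    ; -‿homo = λ r → pointwiseᶜ (λ _ → refl) (λ _ → refl)
    ; 0-homo = ≃ᶜ-refl
    ; 1-homo = ≃ᶜ-refl }

  ≡⇒≃ᶜ : ∀ {z w} → z ≡ w → z ≃ᶜ w
  ≡⇒≃ᶜ refl = ≃ᶜ-refl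

  fromℚ-≟ : ∀ r s → Maybe.Maybe (fromℚ r ≃ᶜ fromℚ s)
  fromℚ-≟ r s = Maybe.map (λ r≡s → ≡⇒≃ᶜ (cong fromℚ r≡s)) (dec⇒maybe (r ℚₚ.≟ s))

  module ℂ-Solver = Algebra.Solver.Ring ℚₚ.+-*-rawRing ℂ-almostCommutativeRing fromℚ-morphism fromℚ-≟

  -- Asymptotic bounds and limits

  abstract

    +-halves : ∀ B ε → B + ½ * ε + ½ * ε ≡ B + ε
    +-halves B ε = trans (ℚₚ.+-assoc B (½ * ε) (½ * ε)) (cong (B ℚ.+_) (½+½ ε))

    three-parts : ∀ {a b c d} ε → d ≤ a + b + c → a < ½ * (½ * ε) → b < ½ * ε → c < ½ * (½ * ε) → d < ε
    three-parts {a} {b} {c} {d} ε d≤ p q r = ℚₚ.≤-<-trans d≤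
      (subst (a + b + c <_) (lem ε) (ℚₚ.+-mono-< (ℚₚ.+-mono-< p q) r))
      where
      lem : ∀ ε → ½ * (½ * ε) + ½ * ε + ½ * (½ * ε) ≡ ε
      lem = solve-∀ ℚ-ring

    ≤-from-ε : ∀ {a b} → (∀ ε → 0ℚ < ε → a < b + ε) → a ≤ b
    ≤-from-ε {a} {b} h = ℚₚ.≮⇒≥ λ b<a →
      ℚₚ.<-irrefl refl (subst (a <_) (lem a b) (h (a - b) (ℚₚ.<-respˡ-≡ (ℚₚ.+-inverseʳ b) (ℚₚ.+-monoˡ-< (- b) b<a))))
      where
      lem : ∀ a b → b + (a - b) ≡ a
      lem = solve-∀ ℚ-ring

    p<p+q : ∀ p {q} → 0ℚ < q → p < p + q
    p<p+q p {q} 0<q = subst (_< p + q) (ℚₚ.+-identityʳ p) (ℚₚ.+-monoʳ-< p 0<q)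

    p≤∣p∣ : ∀ p → p ≤ ∣ p ∣
    p≤∣p∣ p = from (ℚₚ.∣p∣≡p∨∣p∣≡-p p)
      where
      neg-involutive : ∀ p → - - p ≡ p
      neg-involutive = solve-∀ ℚ-ring
      from : ∣ p ∣ ≡ p ⊎ ∣ p ∣ ≡ - p → p ≤ ∣ p ∣
      from (inj₁ e) = ℚₚ.≤-reflexive (sym e)
      from (inj₂ e) = ℚₚ.≤-trans
        (subst (_≤ 0ℚ) (neg-involutive p) (ℚₚ.neg-antimono-≤ (subst (0ℚ ≤_) e (ℚₚ.0≤∣p∣ p))))
        (ℚₚ.0≤∣p∣ p)

    ⊓-pos : ∀ {p q} → 0ℚ < p → 0ℚ < q → 0ℚ < p ℚ.⊓ q
    ⊓-pos {p} {q} 0<p 0<q with ℚₚ.⊓-sel p q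
    ... | inj₁ e = subst (0ℚ <_) (sym e) 0<p
    ... | inj₂ e = subst (0ℚ <_) (sym e) 0<q

    -- The cap by 1 lets one factor of an error such as (B + δ) * δ be replaced by a constant.
    shrink₁ : ∀ B ε → 0ℚ ≤ B → 0ℚ < ε → ∃[ δ ] 0ℚ < δ × δ ≤ 1ℚ × B * δ ≤ ε
    shrink₁ B ε 0≤B 0<ε with shrink B ε 0≤B 0<ε
    ... | δ , 0<δ , Bδ<ε = δ ℚ.⊓ 1ℚ , ⊓-pos 0<δ 0<1 , ℚₚ.p⊓q≤q δ 1ℚ ,
      ℚₚ.≤-trans (ℚₚ.*-monoˡ-≤-nonNeg B {{ℚ.nonNegative 0≤B}} (ℚₚ.p⊓q≤p δ 1ℚ)) (ℚₚ.<⇒≤ Bδ<ε)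

    ½^-antitone : ∀ {m n} → m ℕ.≤ n → ½^ n ≤ ½^ m
    ½^-antitone {m} m≤n = subst (λ k → ½^ k ≤ ½^ m) (ℕₚ.m∸n+n≡m m≤n) (go (_ ℕ.∸ m))
      where
      step : ∀ k → ½^ (suc k) ≤ ½^ k
      step k = subst (½^ (suc k) ≤_) (½+½ (½^ k)) (p≤p+q (½ * ½^ k) (½ * ½^ k) (½^-nonNeg (suc k)))
      go : ∀ k → ½^ (k ℕ.+ m) ≤ ½^ m
      go zero    = ℚₚ.≤-refl
      go (suc k) = ℚₚ.≤-trans (step (k ℕ.+ m)) (go k)

    ½^-null : ∀ C ε → 0ℚ ≤ C → 0ℚ < ε → Eventually (λ n → C * ½^ n < ε)
    ½^-null C ε 0≤C 0<ε with ½^-small C ε 0≤C 0<ε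
    ... | i , Ci<ε = i , λ n i≤n →
      ℚₚ.≤-<-trans (ℚₚ.*-monoˡ-≤-nonNeg C {{ℚ.nonNegative 0≤C}} (½^-antitone i≤n)) Ci<ε

    ½^-pos : ∀ n → 0ℚ < ½^ n
    ½^-pos zero    = 0<1
    ½^-pos (suc n) = half-pos (½^ n) (½^-pos n)

  infix 4 _≼_ _⟶_

  -- A bound on the ℓ¹ norm of the approximants that is only asymptotic, and therefore respects _≃ᶜ_.
  record _≼_ (z : ℂ) (B : ℚ) : Set where
    constructor mk≼
    field
      bound : ∀ ε → 0ℚ < ε → Eventually (λ n → ‖ z ‖ n < B + ε)
  open _≼_ public

  abstract

    ‖‖-≤-dist : ∀ z w n → ‖ w ‖ n ≤ ‖ z ‖ n + dist z w n
    ‖‖-≤-dist z w n = subst (‖ w ‖ n ≤_)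
      (interchange (∣ seq (re z) n ∣) (∣ seq (re z) n - seq (re w) n ∣) (∣ seq (im z) n ∣) (∣ seq (im z) n - seq (im w) n ∣))
      (ℚₚ.+-mono-≤ (tri (seq (re z) n) (seq (re w) n)) (tri (seq (im z) n) (seq (im w) n)))
      where
      interchange : ∀ a b c d → (a + b) + (c + d) ≡ (a + c) + (b + d)
      interchange = solve-∀ ℚ-ring
      eq : ∀ a b → a - (a - b) ≡ b
      eq = solve-∀ ℚ-ring
      tri : ∀ a b → ∣ b ∣ ≤ ∣ a ∣ + ∣ a - b ∣
      tri a b = subst (λ t → ∣ t ∣ ≤ ∣ a ∣ + ∣ a - b ∣) (eq a b) (ℚₚ.∣p-q∣≤∣p∣+∣q∣ a (a - b))

    ‖+‖ : ∀ z w n → ‖ z +ᶜ w ‖ n ≤ ‖ z ‖ n + ‖ w ‖ n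
    ‖+‖ z w n = subst (‖ z +ᶜ w ‖ n ≤_)
      (interchange (∣ seq (re z) n ∣) (∣ seq (re w) n ∣) (∣ seq (im z) n ∣) (∣ seq (im w) n ∣))
      (ℚₚ.+-mono-≤ (ℚₚ.∣p+q∣≤∣p∣+∣q∣ (seq (re z) n) (seq (re w) n)) (ℚₚ.∣p+q∣≤∣p∣+∣q∣ (seq (im z) n) (seq (im w) n)))
      where
      interchange : ∀ a b c d → (a + b) + (c + d) ≡ (a + c) + (b + d)
      interchange = solve-∀ ℚ-ring

    dist-null : ∀ {z w} → z ≃ᶜ w → ∀ ε → 0ℚ < ε → Eventually (λ n → dist z w n < ε)
    dist-null (mk≃ᶜ p q) ε 0<ε = eventually-map (λ n (h , k) → halves _ _ _ ε ℚₚ.≤-refl h k)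
      (close p (½ * ε) (half-pos ε 0<ε) ∧ᵉ close q (½ * ε) (half-pos ε 0<ε))

    ≼-nonNeg : ∀ {z B} → z ≼ B → 0ℚ ≤ B
    ≼-nonNeg {z} z≼B = ≤-from-ε λ ε 0<ε →
      let (n , h) = eventually-witness (bound z≼B ε 0<ε) in ℚₚ.≤-<-trans (‖‖-nonNeg z n) h

    eventually⇒≼ : ∀ {z B} → Eventually (λ n → ‖ z ‖ n ≤ B) → z ≼ B
    eventually⇒≼ {z} {B} h = mk≼ λ ε 0<ε → eventually-map (λ n z≤B → ℚₚ.≤-<-trans z≤B (p<p+q B 0<ε)) h

    ≼-mono : ∀ {z B C} → B ≤ C → z ≼ B → z ≼ C
    ≼-mono B≤C z≼B = mk≼ λ ε 0<ε →
      eventually-map (λ n h → ℚₚ.<-≤-trans h (ℚₚ.+-monoˡ-≤ ε B≤C)) (bound z≼B ε 0<ε)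

    ≼-cong : ∀ {z w B} → z ≃ᶜ w → z ≼ B → w ≼ B
    ≼-cong {z} {w} {B} z≃w z≼B = mk≼ λ ε 0<ε →
      eventually-map (λ n (h , k) → ℚₚ.≤-<-trans (‖‖-≤-dist z w n)
          (subst (‖ z ‖ n + dist z w n <_) (+-halves B ε) (ℚₚ.+-mono-< h k)))
        (bound z≼B (½ * ε) (half-pos ε 0<ε) ∧ᵉ dist-null z≃w (½ * ε) (half-pos ε 0<ε))

    ≼-+ : ∀ {z w B C} → z ≼ B → w ≼ C → z +ᶜ w ≼ B + C
    ≼-+ {z} {w} {B} {C} z≼B w≼C = mk≼ λ ε 0<ε →
      eventually-map (λ n (h , k) → ℚₚ.≤-<-trans (‖+‖ z w n)
          (subst (‖ z ‖ n + ‖ w ‖ n <_) (eq B C ε) (ℚₚ.+-mono-< h k)))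
        (bound z≼B (½ * ε) (half-pos ε 0<ε) ∧ᵉ bound w≼C (½ * ε) (half-pos ε 0<ε))
      where
      eq : ∀ B C ε → (B + ½ * ε) + (C + ½ * ε) ≡ (B + C) + ε
      eq = solve-∀ ℚ-ring

    ≼-neg : ∀ {z B} → z ≼ B → -ᶜ z ≼ B
    ≼-neg {z} {B} z≼B = mk≼ λ ε 0<ε →
      eventually-map (λ n → subst (_< B + ε)
          (sym (cong₂ _+_ (ℚₚ.∣-p∣≡∣p∣ (seq (re z) n)) (ℚₚ.∣-p∣≡∣p∣ (seq (im z) n)))))
        (bound z≼B ε 0<ε)

    -- The ℓ¹ norm is submultiplicative, and (B + δ) * (C + δ) exceeds B * C by at most (B + C + 1)
    -- * δ.
    ≼-* : ∀ {z w B C} → z ≼ B → w ≼ C → z *ᶜ w ≼ B * C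
    ≼-* {z} {w} {B} {C} z≼B w≼C = mk≼ go
      where
      0≤B : 0ℚ ≤ B
      0≤B = ≼-nonNeg z≼B
      0≤C : 0ℚ ≤ C
      0≤C = ≼-nonNeg w≼C
      expand′ : ∀ B C δ → (B + δ) * (C + δ) ≡ B * C + (B + C + δ) * δ
      expand′ = solve-∀ ℚ-ring
      open ℚₚ.≤-Reasoning
      from-δ : ∀ ε → 0ℚ < ε → ∃[ δ ] 0ℚ < δ × δ ≤ 1ℚ × (B + C + 1ℚ) * δ ≤ ½ * ε →
        Eventually (λ n → ‖ z *ᶜ w ‖ n < B * C + ε)
      from-δ ε 0<ε (δ , 0<δ , δ≤1 , small) = eventually-map (λ n (h , k) → begin-strict
          ‖ z *ᶜ w ‖ n                    ≤⟨ ‖*‖ z w n ⟩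
          ‖ z ‖ n * ‖ w ‖ n               ≤⟨ *-mono (‖ z ‖ n) (B + δ) (‖ w ‖ n) (C + δ)
                                               (ℚₚ.+-mono-≤ 0≤B (ℚₚ.<⇒≤ 0<δ)) (‖‖-nonNeg w n) (ℚₚ.<⇒≤ h) (ℚₚ.<⇒≤ k) ⟩
          (B + δ) * (C + δ)               ≡⟨ expand′ B C δ ⟩
          B * C + (B + C + δ) * δ         ≤⟨ ℚₚ.+-monoʳ-≤ (B * C) (ℚₚ.*-monoʳ-≤-nonNeg δ {{ℚ.nonNegative (ℚₚ.<⇒≤ 0<δ)}}
                                               (ℚₚ.+-monoʳ-≤ (B + C) δ≤1)) ⟩
          B * C + (B + C + 1ℚ) * δ        ≤⟨ ℚₚ.+-monoʳ-≤ (B * C) small ⟩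
          B * C + ½ * ε                   <⟨ p<p+q (B * C + ½ * ε) (half-pos ε 0<ε) ⟩
          B * C + ½ * ε + ½ * ε           ≡⟨ +-halves (B * C) ε ⟩
          B * C + ε                       ∎)
        (bound z≼B δ 0<δ ∧ᵉ bound w≼C δ 0<δ)
      go : ∀ ε → 0ℚ < ε → Eventually (λ n → ‖ z *ᶜ w ‖ n < B * C + ε)
      go ε 0<ε = from-δ ε 0<ε
        (shrink₁ (B + C + 1ℚ) (½ * ε) (ℚₚ.+-mono-≤ (ℚₚ.+-mono-≤ 0≤B 0≤C) (ℚₚ.<⇒≤ 0<1)) (half-pos ε 0<ε))

    ≼-bounded : ∀ z → ∃[ B ] z ≼ B
    ≼-bounded z = let (B , _ , J , h) = ‖‖-bound z in B , eventually⇒≼ (J , h)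

    0ᶜ≼0 : 0ᶜ ≼ 0ℚ
    0ᶜ≼0 = eventually⇒≼ (0 , λ _ _ → ℚₚ.≤-refl)

    ≃0⇒≼0 : ∀ {z} → z ≃ᶜ 0ᶜ → z ≼ 0ℚ
    ≃0⇒≼0 z≃0 = ≼-cong (≃ᶜ-sym z≃0) 0ᶜ≼0

    ≼⇒≃ : ∀ {z w} → (∀ ε → 0ℚ < ε → z -ᶜ w ≼ ε) → z ≃ᶜ w
    ≼⇒≃ {z} {w} h = mk≃ᶜ
      (mk≃ λ ε 0<ε → eventually-map (λ n → ℚₚ.≤-<-trans (re≤dist z w n)) (dist< ε 0<ε))
      (mk≃ λ ε 0<ε → eventually-map (λ n → ℚₚ.≤-<-trans (im≤dist z w n)) (dist< ε 0<ε))
      where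
      dist< : ∀ ε → 0ℚ < ε → Eventually (λ n → dist z w n < ε)
      dist< ε 0<ε = eventually-map (λ n → subst (dist z w n <_) (½+½ ε))
        (bound (h (½ * ε) (half-pos ε 0<ε)) (½ * ε) (half-pos ε 0<ε))

    -- A quarter of ε from the bound and a quarter from its slack leave an ℓ¹ distance below ½ * ε;
    -- `square-bound` then supplies the gap below ε * ε that the strict order on reals demands.
    ≼⇒Within : ∀ {z w} ε → 0ℚ < ε → z -ᶜ w ≼ ½ * (½ * ε) → Within ε z w
    ≼⇒Within {z} {w} ε 0<ε h = mk< ((½ * ε) * (½ * ε)) (*-pos (½ * ε) (½ * ε) 0<½ε 0<½ε)
      (eventually-map (λ n k → square-bound (seq (re z) n - seq (re w) n) (seq (im z) n - seq (im w) n) ε 0<ε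
          (subst (dist z w n <_) (½+½ (½ * ε)) k))
        (bound h (½ * (½ * ε)) (half-pos (½ * ε) 0<½ε)))
      where
      0<½ε : 0ℚ < ½ * ε
      0<½ε = half-pos ε 0<ε

  -- The quantifiers are nested: the index from which the approximants of `z n` are close to those
  -- of `s` may depend on n.
  record _⟶_ (z : ℕ → ℂ) (s : ℂ) : Set where
    constructor mk⟶
    field
      near : ∀ ε → 0ℚ < ε → Eventually (λ n → z n -ᶜ s ≼ ε)
  open _⟶_ public

  abstract

    sub-via : ∀ {z u B C} w → z -ᶜ w ≼ B → u -ᶜ w ≼ C → z -ᶜ u ≼ B + C
    sub-via {z} {u} w p q = ≼-cong (eq z u w) (≼-+ p (≼-neg q))
      where
      open ℂ-Solver
      eq : ∀ z u w → (z -ᶜ w) +ᶜ -ᶜ (u -ᶜ w) ≃ᶜ z -ᶜ u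
      eq = solve 3 (λ z u w → (z :- w) :+ (:- (u :- w)) := z :- u) ≃ᶜ-refl

    sub-swap≼ : ∀ {z w B} → z -ᶜ w ≼ B → w -ᶜ z ≼ B
    sub-swap≼ {z} {w} p = ≼-cong (eq z w) (≼-neg p)
      where
      open ℂ-Solver
      eq : ∀ z w → -ᶜ (z -ᶜ w) ≃ᶜ w -ᶜ z
      eq = solve 2 (λ z w → :- (z :- w) := w :- z) ≃ᶜ-refl

    ⟶-unique : ∀ {z s t} → z ⟶ s → z ⟶ t → s ≃ᶜ t
    ⟶-unique {z} {s} {t} p q = ≼⇒≃ λ ε 0<ε →
      let (n , h , k) = eventually-witness (near p (½ * ε) (half-pos ε 0<ε) ∧ᵉ near q (½ * ε) (half-pos ε 0<ε))
      in ≼-mono (ℚₚ.≤-reflexive (½+½ ε)) (sub-via (z n) (sub-swap≼ h) (sub-swap≼ k))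

    -ᶜ-cong₂ : ∀ {z z′ w w′} → z ≃ᶜ z′ → w ≃ᶜ w′ → z -ᶜ w ≃ᶜ z′ -ᶜ w′
    -ᶜ-cong₂ p q = +ᶜ-cong p (-ᶜ-cong q)

    ⟶-cong : ∀ {z w s t} → (∀ n → z n ≃ᶜ w n) → s ≃ᶜ t → z ⟶ s → w ⟶ t
    ⟶-cong z≃w s≃t p = mk⟶ λ ε 0<ε →
      eventually-map (λ n → ≼-cong (-ᶜ-cong₂ (z≃w n) s≃t)) (near p ε 0<ε)

    ⟶-+ : ∀ {z w s t} → z ⟶ s → w ⟶ t → (λ n → z n +ᶜ w n) ⟶ s +ᶜ t
    ⟶-+ {z} {w} {s} {t} p q = mk⟶ λ ε 0<ε →
      eventually-map (λ n (h , k) → ≼-mono (ℚₚ.≤-reflexive (½+½ ε)) (≼-cong (eq (z n) (w n) s t) (≼-+ h k)))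
        (near p (½ * ε) (half-pos ε 0<ε) ∧ᵉ near q (½ * ε) (half-pos ε 0<ε))
      where
      open ℂ-Solver
      eq : ∀ z w s t → (z -ᶜ s) +ᶜ (w -ᶜ t) ≃ᶜ (z +ᶜ w) -ᶜ (s +ᶜ t)
      eq = solve 4 (λ z w s t → (z :- s) :+ (w :- t) := (z :+ w) :- (s :+ t)) ≃ᶜ-refl

    ⟶-neg : ∀ {z s} → z ⟶ s → (λ n → -ᶜ z n) ⟶ -ᶜ s
    ⟶-neg {z} {s} p = mk⟶ λ ε 0<ε → eventually-map (λ n h → ≼-cong (eq (z n) s) (≼-neg h)) (near p ε 0<ε)
      where
      open ℂ-Solver
      eq : ∀ z s → -ᶜ (z -ᶜ s) ≃ᶜ -ᶜ z -ᶜ -ᶜ s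
      eq = solve 2 (λ z s → :- (z :- s) := :- z :- :- s) ≃ᶜ-refl

    -- z w - s t = z (w - t) + (z - s) t, where `z n` is eventually bounded by 1 + A because it lies
    -- within δ ≤ 1 of `s`.
    ⟶-* : ∀ {z w s t} → z ⟶ s → w ⟶ t → (λ n → z n *ᶜ w n) ⟶ s *ᶜ t
    ⟶-* {z} {w} {s} {t} p q = mk⟶ λ ε 0<ε → go ε 0<ε (≼-bounded s) (≼-bounded t)
      where
      eq : ∀ z w s t → z *ᶜ (w -ᶜ t) +ᶜ (z -ᶜ s) *ᶜ t ≃ᶜ z *ᶜ w -ᶜ s *ᶜ t
      eq = solve 4 (λ z w s t → z :* (w :- t) :+ (z :- s) :* t := z :* w :- s :* t) ≃ᶜ-refl
        where open ℂ-Solver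
      eq′ : ∀ z s → (z -ᶜ s) +ᶜ s ≃ᶜ z
      eq′ = solve 2 (λ z s → (z :- s) :+ s := z) ≃ᶜ-refl
        where open ℂ-Solver
      factor : ∀ A B δ → (1ℚ + A) * δ + δ * B ≡ (1ℚ + A + B) * δ
      factor = solve-∀ ℚ-ring
      from-δ : ∀ ε {A B} → s ≼ A → t ≼ B → ∃[ δ ] 0ℚ < δ × δ ≤ 1ℚ × (1ℚ + A + B) * δ ≤ ε →
        Eventually (λ n → z n *ᶜ w n -ᶜ s *ᶜ t ≼ ε)
      from-δ ε {A} {B} s≼A t≼B (δ , 0<δ , δ≤1 , small) = eventually-map (λ n (h , k) →
          ≼-mono (ℚₚ.≤-trans (ℚₚ.≤-reflexive (factor A B δ)) small)
            (≼-cong (eq (z n) (w n) s t)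
              (≼-+ (≼-* (≼-mono (ℚₚ.+-monoˡ-≤ A δ≤1) (≼-cong (eq′ (z n) s) (≼-+ h s≼A))) k) (≼-* h t≼B))))
        (near p δ 0<δ ∧ᵉ near q δ 0<δ)
      go : ∀ ε → 0ℚ < ε → ∃[ A ] s ≼ A → ∃[ B ] t ≼ B → Eventually (λ n → z n *ᶜ w n -ᶜ s *ᶜ t ≼ ε)
      go ε 0<ε (A , s≼A) (B , t≼B) = from-δ ε s≼A t≼B
        (shrink₁ (1ℚ + A + B) ε (ℚₚ.+-mono-≤ (ℚₚ.+-mono-≤ (ℚₚ.<⇒≤ 0<1) (≼-nonNeg s≼A)) (≼-nonNeg t≼B)) 0<ε)

  -- Completeness

  module Complete (x : ℕ → ℝ)
    (x-cauchy : ∀ ε → 0ℚ < ε → ∃[ N ] ∀ m n → N ℕ.≤ m → N ℕ.≤ n →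
      Eventually (λ j → ∣ seq (x m) j - seq (x n) j ∣ < ε)) where

    private
      modulus-at : ∀ n → ∃[ K ] ∀ i j → K ℕ.≤ i → K ℕ.≤ j → ∣ seq (x n) i - seq (x n) j ∣ < ½^ n
      modulus-at n = modulus (cauchy (x n)) (½^ n) (½^-pos n)

      -- The diagonal entry of `x n` at index n might be too early, as the members share no modulus.
      -- Each member's own modulus supplies an entry precise to ½^n instead.
      approx : ℕ → ℚ
      approx n = seq (x n) (proj₁ (modulus-at n))

      approx-close : ∀ n → Eventually (λ i → ∣ seq (x n) i - approx n ∣ < ½^ n)
      approx-close n = proj₁ (modulus-at n) , λ i K≤i → proj₂ (modulus-at n) i _ K≤i ℕₚ.≤-refl

      triangle₃ : ∀ a b c d → ∣ a - d ∣ ≤ ∣ b - a ∣ + ∣ b - c ∣ + ∣ c - d ∣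
      triangle₃ a b c d = ℚₚ.≤-trans (triangle a c d) (ℚₚ.+-monoˡ-≤ ∣ c - d ∣
        (subst (λ t → ∣ a - c ∣ ≤ t + ∣ b - c ∣) (∣-∣-comm a b) (triangle a b c)))

      ½^-below : ∀ ε → 0ℚ < ε → Eventually (λ n → ½^ n < ε)
      ½^-below ε 0<ε = eventually-map (λ n → subst (_< ε) (ℚₚ.*-identityˡ (½^ n)))
        (½^-null 1ℚ ε (ℚₚ.<⇒≤ 0<1) 0<ε)

    abstract
      approx-cauchy : IsCauchy approx
      approx-cauchy = mkCauchy λ ε 0<ε →
        let 0<½ε  = half-pos ε 0<ε
            (N , h) = x-cauchy (½ * ε) 0<½ε
            (M , k) = ½^-below (½ * (½ * ε)) (half-pos (½ * ε) 0<½ε)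
        in N ⊔ M , λ m n p q →
          -- The two approximations are compared through a common index i, late enough for both to
          -- be precise and for the two members to be close.
          let (i , am , mn , an) = eventually-witness
                (approx-close m ∧ᵉ h m n (ℕₚ.m⊔n≤o⇒m≤o N M p) (ℕₚ.m⊔n≤o⇒m≤o N M q) ∧ᵉ approx-close n)
          in three-parts ε (triangle₃ (approx m) (seq (x m) i) (seq (x n) i) (approx n))
               (ℚₚ.<-trans am (k m (ℕₚ.m⊔n≤o⇒n≤o N M p))) mn
               (ℚₚ.<-trans an (k n (ℕₚ.m⊔n≤o⇒n≤o N M q)))

    limit : ℝ
    limit = mkℝ approx approx-cauchy

    abstract
      limit-close : ∀ ε → 0ℚ < ε → Eventually (λ n → Eventually (λ j → ∣ seq (x n) j - seq limit j ∣ < ε))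
      limit-close ε 0<ε =
        let 0<½ε  = half-pos ε 0<ε
            0<¼ε  = half-pos (½ * ε) 0<½ε
            (N , h) = x-cauchy (½ * ε) 0<½ε
            (M , k) = ½^-below (½ * (½ * ε)) 0<¼ε
        in N , λ n N≤n →
          let (P , g) = modulus (cauchy (x n)) (½ * (½ * ε)) 0<¼ε
          in P ⊔ (N ⊔ M) , λ j p →
            let P≤j  = ℕₚ.m⊔n≤o⇒m≤o P (N ⊔ M) p
                NM≤j = ℕₚ.m⊔n≤o⇒n≤o P (N ⊔ M) p
                -- The limit at index j is `approx j`, so j is both an index of approximation and
                -- the number of a member of the sequence.
                (i , nj , aj , xn) = eventually-witness
                  (h n j N≤n (ℕₚ.m⊔n≤o⇒m≤o N M NM≤j) ∧ᵉ approx-close j ∧ᵉ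
                   (P , λ i P≤i → g i j P≤i P≤j))
            in three-parts ε (triangle₃ (seq (x n) j) (seq (x n) i) (seq (x j) i) (approx j))
                 xn nj (ℚₚ.<-trans aj (k j (ℕₚ.m⊔n≤o⇒n≤o N M NM≤j)))

  Cauchyᶜ : (ℕ → ℂ) → Set
  Cauchyᶜ z = ∀ ε → 0ℚ < ε → ∃[ N ] ∀ m n → N ℕ.≤ m → N ℕ.≤ n → z m -ᶜ z n ≼ ε

  complete : ∀ z → Cauchyᶜ z → ∃[ s ] z ⟶ s
  complete z z-cauchy = (Re.limit +i Im.limit) , mk⟶ λ ε 0<ε →
    eventually-map (λ n (h , k) → eventually⇒≼ (eventually-map (λ j (p , q) → ℚₚ.<⇒≤ (halves _ _ _ ε ℚₚ.≤-refl p q)) (h ∧ᵉ k)))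
      (Re.limit-close (½ * ε) (half-pos ε 0<ε) ∧ᵉ Im.limit-close (½ * ε) (half-pos ε 0<ε))
    where
    dist-cauchy : ∀ ε → 0ℚ < ε → ∃[ N ] ∀ m n → N ℕ.≤ m → N ℕ.≤ n →
      Eventually (λ j → dist (z m) (z n) j < ε)
    dist-cauchy ε 0<ε = let (N , h) = z-cauchy (½ * ε) (half-pos ε 0<ε) in N , λ m n p q →
      eventually-map (λ j → subst (dist (z m) (z n) j <_) (½+½ ε)) (bound (h m n p q) (½ * ε) (half-pos ε 0<ε))
    re-cauchy : ∀ ε → 0ℚ < ε → ∃[ N ] ∀ m n → N ℕ.≤ m → N ℕ.≤ n →
      Eventually (λ j → ∣ seq (re (z m)) j - seq (re (z n)) j ∣ < ε)
    re-cauchy ε 0<ε = let (N , h) = dist-cauchy ε 0<ε in N , λ m n p q →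
      eventually-map (λ j → ℚₚ.≤-<-trans (re≤dist (z m) (z n) j)) (h m n p q)
    im-cauchy : ∀ ε → 0ℚ < ε → ∃[ N ] ∀ m n → N ℕ.≤ m → N ℕ.≤ n →
      Eventually (λ j → ∣ seq (im (z m)) j - seq (im (z n)) j ∣ < ε)
    im-cauchy ε 0<ε = let (N , h) = dist-cauchy ε 0<ε in N , λ m n p q →
      eventually-map (λ j → ℚₚ.≤-<-trans (im≤dist (z m) (z n) j)) (h m n p q)
    module Re = Complete (λ n → re (z n)) re-cauchy
    module Im = Complete (λ n → im (z n)) im-cauchy

  -- Unordered sums by exhaustion

  module ∑ℚ = Sum ℚₚ.+-*-commutativeRing
  module ∑ᶜ = Sum ℂ-commutativeRing

  abstract
    ∑-≼ : ∀ {I : Set} {f : I → ℂ} {a : I → ℚ} → (∀ i → f i ≼ a i) → ∀ S → ∑ᶜ.∑[ S ] f ≼ ∑ℚ.∑[ S ] a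
    ∑-≼ f≼a []      = 0ᶜ≼0
    ∑-≼ f≼a (i ∷ S) = ≼-+ (f≼a i) (∑-≼ f≼a S)

  -- Finite sets are duplicate-free lists, as in `HasSum`.
  record Exhaustion (I : Set) : Set where
    field
      part       : ℕ → List I
      unique     : ∀ n → Unique (part n)
      increasing : ∀ n → part n ⊆ part (suc n)
      covers     : ∀ i → ∃[ n ] i ∈ part n

    part-mono : ∀ {m n} → m ℕ.≤ n → part m ⊆ part n
    part-mono {m} m≤n = subst (λ k → part m ⊆ part k) (ℕₚ.m∸n+n≡m m≤n) (go (_ ℕ.∸ m))
      where
      go : ∀ k → part m ⊆ part (k ℕ.+ m)
      go zero    i∈ = i∈
      go (suc k) i∈ = increasing (k ℕ.+ m) (go k i∈)

    covers-list : ∀ S → ∃[ n ] S ⊆ part n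
    covers-list []      = 0 , λ ()
    covers-list (i ∷ S) with covers i | covers-list S
    ... | m , i∈ | n , S⊆ = m ⊔ n , λ
      { (here refl) → part-mono (ℕₚ.m≤m⊔n m n) i∈
      ; (there j∈)  → part-mono (ℕₚ.m≤n⊔m m n) (S⊆ j∈) }

  module Dominated {I : Set} (X : Exhaustion I) (f : I → ℂ) (a : I → ℚ) (f≼a : ∀ i → f i ≼ a i)
                   (a-cauchy : IsCauchy (λ n → ∑ℚ.∑[ Exhaustion.part X n ] a)) where
    open Exhaustion X

    F : List I → ℂ
    F S = ∑ᶜ.∑[ S ] f

    A : List I → ℚ
    A S = ∑ℚ.∑[ S ] a

    abstract
      difference : ∀ {S T} → Unique S → S ⊆ T → F T -ᶜ F S ≼ A T - A S
      difference {S} {T} u S⊆T = from-complement (complement u S⊆T)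
        where
        cancelᶜ : ∀ s r → r ≃ᶜ (s +ᶜ r) -ᶜ s
        cancelᶜ = solve 2 (λ s r → r := (s :+ r) :- s) ≃ᶜ-refl
          where open ℂ-Solver
        cancel : ∀ s r → r ≡ (s + r) - s
        cancel = solve-∀ ℚ-ring
        from-complement : (∃[ R ] T ↭ S ++ R) → F T -ᶜ F S ≼ A T - A S
        from-complement (R , p) = subst (F T -ᶜ F S ≼_)
          (trans (cancel (A S) (A R)) (cong (_- A S) (sym (trans (∑ℚ.∑-↭ a p) (∑ℚ.∑-++ S R a)))))
          (≼-cong (≃ᶜ-trans (cancelᶜ (F S) (F R))
                    (-ᶜ-cong₂ (≃ᶜ-sym (≃ᶜ-trans (∑ᶜ.∑-↭ f p) (∑ᶜ.∑-++ S R f))) ≃ᶜ-refl))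
            (∑-≼ f≼a R))

      -- The weight of the complement bounds a norm, hence is nonnegative.
      A-mono : ∀ {S T} → Unique S → S ⊆ T → A S ≤ A T
      A-mono {S} {T} u S⊆T = subst₂ _≤_ (ℚₚ.+-identityˡ (A S)) (minus-plus (A T) (A S))
        (ℚₚ.+-monoˡ-≤ (A S) (≼-nonNeg (difference u S⊆T)))

      -- Any finite `S` lies in some later part, so what `S` has outside `part N` weighs at most the
      -- increase of the weight sums beyond N.
      tail-≼ : ∀ ε → 0ℚ < ε → ∃[ N ] ∀ S → Unique S → part N ⊆ S → F S -ᶜ F (part N) ≼ ε
      tail-≼ ε 0<ε = from-modulus (modulus a-cauchy ε 0<ε)
        where
        from-modulus : (∃[ N ] ∀ m n → N ℕ.≤ m → N ℕ.≤ n → ∣ A (part m) - A (part n) ∣ < ε) →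
          ∃[ N ] ∀ S → Unique S → part N ⊆ S → F S -ᶜ F (part N) ≼ ε
        from-modulus (N , h) = N , λ S uS N⊆S →
          let (L , S⊆L) = covers-list S
              S⊆L⊔N = λ {i} i∈S → part-mono (ℕₚ.m≤m⊔n L N) (S⊆L {i} i∈S)
          in ≼-mono (ℚₚ.≤-trans (ℚₚ.+-monoˡ-≤ (- A (part N)) (A-mono uS S⊆L⊔N))
                      (ℚₚ.≤-trans (p≤∣p∣ _) (ℚₚ.<⇒≤ (h (L ⊔ N) N (ℕₚ.m≤n⊔m L N) ℕₚ.≤-refl))))
               (difference (unique N) N⊆S)

      partial-cauchy : Cauchyᶜ (λ n → F (part n))
      partial-cauchy ε 0<ε = let (N , h) = tail-≼ (½ * ε) (half-pos ε 0<ε) in N , λ m n p q →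
        subst (F (part m) -ᶜ F (part n) ≼_) (½+½ ε)
          (sub-via (F (part N)) (h (part m) (unique m) (part-mono p)) (h (part n) (unique n) (part-mono q)))

      -- The sum over `S` is compared with that over `part N`, then with that over a later `part n`
      -- already near `s`. The conclusion covers every finite set containing `part N`, so the limit
      -- can be read along another sequence of sets.
      ⟶⇒unordered : ∀ {s} → (λ n → F (part n)) ⟶ s →
        ∀ ε → 0ℚ < ε → ∃[ N ] ∀ S → Unique S → part N ⊆ S → F S -ᶜ s ≼ ε
      ⟶⇒unordered {s} p ε 0<ε =
        let (N , h) = tail-≼ (½ * (½ * ε)) (half-pos (½ * ε) (half-pos ε 0<ε))
            (n , k , N≤n) = eventually-witness (near p (½ * ε) (half-pos ε 0<ε) ∧ᵉ (N , λ _ N≤n → N≤n))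
        in N , λ S uS N⊆S → subst (F S -ᶜ s ≼_) (lem ε)
          (sub-via (F (part n))
            (sub-via (F (part N)) (h S uS N⊆S) (h (part n) (unique n) (part-mono N≤n)))
            (sub-swap≼ k))
        where
        lem : ∀ ε → ½ * (½ * ε) + ½ * (½ * ε) + ½ * ε ≡ ε
        lem = solve-∀ ℚ-ring

    ⟶⇒HasSum : ∀ {s} → (λ n → F (part n)) ⟶ s → HasSum f s
    ⟶⇒HasSum p ε 0<ε =
      let (N , h) = ⟶⇒unordered p (½ * (½ * ε)) (half-pos (½ * ε) (half-pos ε 0<ε))
      in part N , λ S uS N⊆S → ≼⇒Within ε 0<ε (h S uS N⊆S)

  cauchy-resp : ∀ {s t} → (∀ n → s n ≡ t n) → IsCauchy s → IsCauchy t
  cauchy-resp s≡t c = mkCauchy λ ε 0<ε → let (N , h) = modulus c ε 0<ε in N , λ m n p q →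
    subst₂ (λ x y → ∣ x - y ∣ < ε) (s≡t m) (s≡t n) (h m n p q)

  -- Products of parts are used because a double sum over them factors, by `∑-product`.
  _⊗_ : ∀ {I I′ : Set} → Exhaustion I → Exhaustion I′ → Exhaustion (I × I′)
  X ⊗ Y = record
    { part       = λ n → cartesianProduct (X.part n) (Y.part n)
    ; unique     = λ n → Uniqueₚ.cartesianProduct⁺ (X.unique n) (Y.unique n)
    ; increasing = λ n {ij} ij∈ → let (i∈ , j∈) = ∈ₚ.∈-cartesianProduct⁻ (X.part n) (Y.part n) ij∈ in
        ∈ₚ.∈-cartesianProduct⁺ (X.increasing n i∈) (Y.increasing n j∈)
    ; covers     = λ (i , j) → let (m , i∈) = X.covers i ; (n , j∈) = Y.covers j in
        m ⊔ n , ∈ₚ.∈-cartesianProduct⁺ (X.part-mono (ℕₚ.m≤m⊔n m n) i∈) (Y.part-mono (ℕₚ.m≤n⊔m m n) j∈) }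
    where
    module X = Exhaustion X
    module Y = Exhaustion Y

  <ℕ : Exhaustion ℕ
  <ℕ = record { part = downFrom ; unique = Uniqueₚ.downFrom⁺ ; increasing = λ n → there ; covers = λ i → suc i , here refl }

  sucˡ : ℕ × ℕ → ℕ × ℕ
  sucˡ (i , j) = suc i , j

  diagonal : ℕ → List (ℕ × ℕ)
  diagonal zero    = (0 , 0) ∷ []
  diagonal (suc n) = (0 , suc n) ∷ map sucˡ (diagonal n)

  -- The index sets of the Cauchy product: summed over them, the terms of e^z e^w give the partial
  -- sums of e^(z + w).
  triangular : ℕ → List (ℕ × ℕ)
  triangular zero    = []
  triangular (suc n) = diagonal n ++ triangular n

  abstract

    diagonal-sum : ∀ n {i j} → (i , j) ∈ diagonal n → i ℕ.+ j ≡ n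
    diagonal-sum zero    (here refl) = refl
    diagonal-sum (suc n) (here refl) = refl
    diagonal-sum (suc n) (there p) with ∈ₚ.∈-map⁻ sucˡ p
    ... | _ , q , refl = cong suc (diagonal-sum n q)

    ∈-diagonal : ∀ i j → (i , j) ∈ diagonal (i ℕ.+ j)
    ∈-diagonal zero    zero    = here refl
    ∈-diagonal zero    (suc j) = here refl
    ∈-diagonal (suc i) j       = there (∈ₚ.∈-map⁺ sucˡ (∈-diagonal i j))

    diagonal-unique : ∀ n → Unique (diagonal n)
    diagonal-unique zero    = All.[] AllPairs.∷ AllPairs.[]
    diagonal-unique (suc n) = All.tabulate head∉ AllPairs.∷ Uniqueₚ.map⁺ {f = sucˡ} (λ { refl → refl }) (diagonal-unique n)
      where
      head∉ : ∀ {ij : ℕ × ℕ} → ij ∈ map sucˡ (diagonal n) → (0 , suc n) ≢ ij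
      head∉ p refl with ∈ₚ.∈-map⁻ sucˡ p
      ... | _ , _ , ()

    triangular-< : ∀ n {i j} → (i , j) ∈ triangular n → i ℕ.+ j ℕ.< n
    triangular-< (suc n) p with ∈ₚ.∈-++⁻ (diagonal n) p
    ... | inj₁ q = ℕ.s≤s (ℕₚ.≤-reflexive (diagonal-sum n q))
    ... | inj₂ q = ℕₚ.m≤n⇒m≤1+n (triangular-< n q)

    ∈-triangular : ∀ {n i j} → i ℕ.+ j ℕ.< n → (i , j) ∈ triangular n
    ∈-triangular {suc n} {i} {j} (ℕ.s≤s i+j≤n) with ℕₚ.m≤n⇒m<n∨m≡n i+j≤n
    ... | inj₁ i+j<n = ∈ₚ.∈-++⁺ʳ (diagonal n) (∈-triangular i+j<n)
    ... | inj₂ refl  = ∈ₚ.∈-++⁺ˡ (∈-diagonal i j)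

    triangular-unique : ∀ n → Unique (triangular n)
    triangular-unique zero    = AllPairs.[]
    triangular-unique (suc n) = Uniqueₚ.++⁺ (diagonal-unique n) (triangular-unique n)
      λ (p , q) → ℕₚ.<-irrefl (diagonal-sum n p) (triangular-< n q)

    ∈-downFrom : ∀ n {i} → i ∈ downFrom n → i ℕ.< n
    ∈-downFrom (suc n) (here refl) = ℕₚ.≤-refl
    ∈-downFrom (suc n) (there p)   = ℕₚ.m≤n⇒m≤1+n (∈-downFrom n p)

    square⊆triangular : ∀ {N n} → N ℕ.+ N ℕ.≤ n → Exhaustion.part (<ℕ ⊗ <ℕ) N ⊆ triangular n
    square⊆triangular {N} 2N≤n p = let (i∈ , j∈) = ∈ₚ.∈-cartesianProduct⁻ (downFrom N) (downFrom N) p in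
      ∈-triangular (ℕₚ.<-≤-trans (ℕₚ.+-mono-< (∈-downFrom N i∈) (∈-downFrom N j∈)) 2N≤n)

    -- `k / 1` normalises by a gcd, which is stuck on a variable. The explicit reduced fraction lets
    -- integer arithmetic pass to ℚ.
    /1≡ : ∀ k → k / 1 ≡ ℚ.mkℚ k 0 (Coprimality.sym (Coprimality.1-coprimeTo ℤ.∣ k ∣))
    /1≡ k = ℚₚ.↥p/↧p≡p (ℚ.mkℚ k 0 (Coprimality.sym (Coprimality.1-coprimeTo ℤ.∣ k ∣)))

    /1-+ : ∀ k l → (k ℤ.+ l) / 1 ≡ k / 1 + l / 1
    /1-+ k l = sym (trans (cong₂ _+_ (/1≡ k) (/1≡ l))
      (cong (_/ 1) (cong₂ ℤ._+_ (ℤₚ.*-identityʳ k) (ℤₚ.*-identityʳ l))))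

    /1-* : ∀ k l → (k ℤ.* l) / 1 ≡ (k / 1) * (l / 1)
    /1-* k l = sym (cong₂ _*_ (/1≡ k) (/1≡ l))

    /1-neg : ∀ k → (ℤ.- k) / 1 ≡ - (k / 1)
    /1-neg k = begin
      ℤ.- k / 1                              ≡⟨ lem (ℤ.- k / 1) (k / 1) ⟩
      (ℤ.- k / 1 + k / 1) - k / 1            ≡⟨ cong (_- k / 1) (sym (/1-+ (ℤ.- k) k)) ⟩
      (ℤ.- k ℤ.+ k) / 1 - k / 1              ≡⟨ cong (λ t → t / 1 - k / 1) (ℤₚ.+-inverseˡ k) ⟩
      0ℚ - k / 1                             ≡⟨ ℚₚ.+-identityˡ (- (k / 1)) ⟩
      - (k / 1)                              ∎
      where
      open ≡-Reasoning
      lem : ∀ a b → a ≡ (a + b) - b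
      lem = solve-∀ ℚ-ring

    -- The list exposes the pair (0 , n + 1) at its head. Lowering the second index, as in
    -- `binomial`, needs the opposite end split off.
    ∑-diagonal-last : ∀ n (g : ℕ × ℕ → ℂ) →
      ∑ᶜ.∑[ diagonal (suc n) ] g ≃ᶜ ∑ᶜ.∑[ diagonal n ] (λ (i , j) → g (i , suc j)) +ᶜ g (suc n , 0)
    ∑-diagonal-last zero    g = eq (g (0 , 1)) (g (1 , 0))
      where
      open ℂ-Solver
      eq : ∀ z w → z +ᶜ (w +ᶜ 0ᶜ) ≃ᶜ (z +ᶜ 0ᶜ) +ᶜ w
      eq = solve 2 (λ z w → z :+ (w :+ con 0ℚ) := (z :+ con 0ℚ) :+ w) ≃ᶜ-refl
    ∑-diagonal-last (suc n) g = begin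
      g (0 , suc (suc n)) +ᶜ ∑ᶜ.∑[ map sucˡ (diagonal (suc n)) ] g
        ≈⟨ ℂᵣ.+-congˡ (≃ᶜ-trans (∑ᶜ.∑-map sucˡ (diagonal (suc n)) g) (∑-diagonal-last n (λ p → g (sucˡ p)))) ⟩
      g (0 , suc (suc n)) +ᶜ (∑ᶜ.∑[ diagonal n ] (λ (i , j) → g (suc i , suc j)) +ᶜ g (suc (suc n) , 0))
        ≈⟨ ℂᵣ.+-assoc _ _ _ ⟨
      g (0 , suc (suc n)) +ᶜ ∑ᶜ.∑[ diagonal n ] (λ (i , j) → g (suc i , suc j)) +ᶜ g (suc (suc n) , 0)
        ≈⟨ ℂᵣ.+-congʳ (ℂᵣ.+-congˡ (∑ᶜ.∑-map sucˡ (diagonal n) (λ (i , j) → g (i , suc j)))) ⟨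
      g (0 , suc (suc n)) +ᶜ ∑ᶜ.∑[ map sucˡ (diagonal n) ] (λ (i , j) → g (i , suc j)) +ᶜ g (suc (suc n) , 0) ∎
      where
      open SetoidReasoning ℂᵣ.setoid

  -- The exponential function

  abstract

    ·≃* : ∀ r z → r · z ≃ᶜ fromℚ r *ᶜ z
    ·≃* r z = pointwiseᶜ (λ n → eq₁ r (seq (re z) n) (seq (im z) n)) (λ n → eq₂ r (seq (re z) n) (seq (im z) n))
      where
      eq₁ : ∀ r a b → r * a ≡ r * a - 0ℚ * b
      eq₁ = solve-∀ ℚ-ring
      eq₂ : ∀ r a b → r * b ≡ r * b + 0ℚ * a
      eq₂ = solve-∀ ℚ-ring

    fromℚ-+ : ∀ r s → fromℚ (r + s) ≃ᶜ fromℚ r +ᶜ fromℚ s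
    fromℚ-+ r s = pointwiseᶜ (λ _ → refl) (λ _ → refl)

    fromℚ-* : ∀ r s → fromℚ (r * s) ≃ᶜ fromℚ r *ᶜ fromℚ s
    fromℚ-* r s = pointwiseᶜ (λ _ → eq₁ r s) (λ _ → eq₂ r s)
      where
      eq₁ : ∀ r s → r * s ≡ r * s - 0ℚ * 0ℚ
      eq₁ = solve-∀ ℚ-ring
      eq₂ : ∀ r s → 0ℚ ≡ r * 0ℚ + 0ℚ * s
      eq₂ = solve-∀ ℚ-ring

    expTerm-suc : ∀ z k → fromℚ (ι (suc k)) *ᶜ expTerm z (suc k) ≃ᶜ z *ᶜ expTerm z k
    expTerm-suc z k = begin
      fromℚ (ι (suc k)) *ᶜ ((+ 1 / suc k) · t)          ≈⟨ ℂᵣ.*-congˡ (·≃* (+ 1 / suc k) t) ⟩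
      fromℚ (ι (suc k)) *ᶜ (fromℚ (+ 1 / suc k) *ᶜ t)   ≈⟨ ℂᵣ.*-assoc _ _ _ ⟨
      fromℚ (ι (suc k)) *ᶜ fromℚ (+ 1 / suc k) *ᶜ t     ≈⟨ ℂᵣ.*-congʳ (fromℚ-* (ι (suc k)) (+ 1 / suc k)) ⟨
      fromℚ (ι (suc k) * (+ 1 / suc k)) *ᶜ t            ≈⟨ ℂᵣ.*-congʳ (≡⇒≃ᶜ (cong fromℚ (trans (ℚₚ.*-comm (ι (suc k)) _) (recip k)))) ⟩
      1ᶜ *ᶜ t                                           ≈⟨ ℂᵣ.*-identityˡ t ⟩
      t                                                 ∎
      where
      open SetoidReasoning ℂᵣ.setoid
      t : ℂ
      t = z *ᶜ expTerm z k

    -- The recursion for zᵏ / k! cleared of its denominator: 1 / (k + 1) is invertible, so the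
    -- multiplied equation determines the next term.
    expTerm-unique : ∀ z t k → fromℚ (ι (suc k)) *ᶜ t ≃ᶜ z *ᶜ expTerm z k → t ≃ᶜ expTerm z (suc k)
    expTerm-unique z t k h = begin
      t                                                  ≈⟨ ℂᵣ.*-identityˡ t ⟨
      1ᶜ *ᶜ t                                            ≈⟨ ℂᵣ.*-congʳ (≡⇒≃ᶜ (cong fromℚ (recip k))) ⟨
      fromℚ ((+ 1 / suc k) * ι (suc k)) *ᶜ t             ≈⟨ ℂᵣ.*-congʳ (fromℚ-* (+ 1 / suc k) (ι (suc k))) ⟩
      fromℚ (+ 1 / suc k) *ᶜ fromℚ (ι (suc k)) *ᶜ t      ≈⟨ ℂᵣ.*-assoc _ _ _ ⟩
      fromℚ (+ 1 / suc k) *ᶜ (fromℚ (ι (suc k)) *ᶜ t)    ≈⟨ ℂᵣ.*-congˡ h ⟩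
      fromℚ (+ 1 / suc k) *ᶜ (z *ᶜ expTerm z k)          ≈⟨ ·≃* (+ 1 / suc k) _ ⟨
      expTerm z (suc k)                                  ∎
      where open SetoidReasoning ℂᵣ.setoid

    -- Every pair on the diagonal has i + j = n. The weight is kept as a sum so that its two
    -- summands can act on the two factors separately.
    ∑-diagonal-weight : ∀ n (g : ℕ × ℕ → ℂ) →
      ∑ᶜ.∑[ diagonal n ] (λ (i , j) → (fromℚ (ι i) +ᶜ fromℚ (ι j)) *ᶜ g (i , j)) ≃ᶜ fromℚ (ι n) *ᶜ ∑ᶜ.∑[ diagonal n ] g
    ∑-diagonal-weight zero    g = eq (g (0 , 0))
      where
      open ℂ-Solver
      eq : ∀ z → (fromℚ 0ℚ +ᶜ fromℚ 0ℚ) *ᶜ z +ᶜ 0ᶜ ≃ᶜ fromℚ 0ℚ *ᶜ (z +ᶜ 0ᶜ)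
      eq = solve 1 (λ z → (con 0ℚ :+ con 0ℚ) :* z :+ con 0ℚ := con 0ℚ :* (z :+ con 0ℚ)) ≃ᶜ-refl
    ∑-diagonal-weight (suc n) g = begin
      (fromℚ 0ℚ +ᶜ c) *ᶜ g₀ +ᶜ ∑ᶜ.∑[ map sucˡ (diagonal n) ] (λ (i , j) → (fromℚ (ι i) +ᶜ fromℚ (ι j)) *ᶜ g (i , j))
        ≈⟨ ℂᵣ.+-congˡ (∑ᶜ.∑-map sucˡ (diagonal n) _) ⟩
      (fromℚ 0ℚ +ᶜ c) *ᶜ g₀ +ᶜ ∑ᶜ.∑[ diagonal n ] (λ (i , j) → (fromℚ (ι (suc i)) +ᶜ fromℚ (ι j)) *ᶜ g (suc i , j))
        ≈⟨ ℂᵣ.+-congˡ (∑ᶜ.∑-cong (diagonal n) λ (i , j) →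
             ≃ᶜ-trans (ℂᵣ.*-congʳ (ℂᵣ.+-congʳ (fromℚ-ι-suc i))) (eq₁ (fromℚ (ι i)) (fromℚ (ι j)) (g (suc i , j)))) ⟩
      (fromℚ 0ℚ +ᶜ c) *ᶜ g₀ +ᶜ ∑ᶜ.∑[ diagonal n ] (λ (i , j) → (fromℚ (ι i) +ᶜ fromℚ (ι j)) *ᶜ g (suc i , j) +ᶜ g (suc i , j))
        ≈⟨ ℂᵣ.+-congˡ (∑ᶜ.∑-+ (diagonal n) _ _) ⟩
      (fromℚ 0ℚ +ᶜ c) *ᶜ g₀ +ᶜ (∑ᶜ.∑[ diagonal n ] (λ (i , j) → (fromℚ (ι i) +ᶜ fromℚ (ι j)) *ᶜ g (suc i , j)) +ᶜ T)
        ≈⟨ ℂᵣ.+-congˡ (ℂᵣ.+-congʳ (∑-diagonal-weight n (λ p → g (sucˡ p)))) ⟩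
      (fromℚ 0ℚ +ᶜ c) *ᶜ g₀ +ᶜ (fromℚ (ι n) *ᶜ T +ᶜ T)
        ≈⟨ ℂᵣ.+-congˡ (≃ᶜ-trans (eq₂ (fromℚ (ι n)) T) (ℂᵣ.*-congʳ (≃ᶜ-sym (fromℚ-ι-suc n)))) ⟩
      (fromℚ 0ℚ +ᶜ c) *ᶜ g₀ +ᶜ c *ᶜ T
        ≈⟨ eq₃ c g₀ T ⟩
      c *ᶜ (g₀ +ᶜ T)
        ≈⟨ ℂᵣ.*-congˡ (ℂᵣ.+-congˡ (∑ᶜ.∑-map sucˡ (diagonal n) g)) ⟨
      c *ᶜ (g₀ +ᶜ ∑ᶜ.∑[ map sucˡ (diagonal n) ] g) ∎
      where
      open SetoidReasoning ℂᵣ.setoid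
      c g₀ T : ℂ
      c  = fromℚ (ι (suc n))
      g₀ = g (0 , suc n)
      T  = ∑ᶜ.∑[ diagonal n ] (λ p → g (sucˡ p))
      fromℚ-ι-suc : ∀ k → fromℚ (ι (suc k)) ≃ᶜ fromℚ 1ℚ +ᶜ fromℚ (ι k)
      fromℚ-ι-suc k = ≃ᶜ-trans (≡⇒≃ᶜ (cong fromℚ (/1-+ (+ 1) (+ k)))) (fromℚ-+ 1ℚ (ι k))
      eq₁ : ∀ x y z → (fromℚ 1ℚ +ᶜ x +ᶜ y) *ᶜ z ≃ᶜ (x +ᶜ y) *ᶜ z +ᶜ z
      eq₁ = solve 3 (λ x y z → (con 1ℚ :+ x :+ y) :* z := (x :+ y) :* z :+ z) ≃ᶜ-refl
        where open ℂ-Solver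
      eq₂ : ∀ x z → x *ᶜ z +ᶜ z ≃ᶜ (fromℚ 1ℚ +ᶜ x) *ᶜ z
      eq₂ = solve 2 (λ x z → x :* z :+ z := (con 1ℚ :+ x) :* z) ≃ᶜ-refl
        where open ℂ-Solver
      eq₃ : ∀ c x y → (fromℚ 0ℚ +ᶜ c) *ᶜ x +ᶜ c *ᶜ y ≃ᶜ c *ᶜ (x +ᶜ y)
      eq₃ = solve 3 (λ c x y → (con 0ℚ :+ c) :* x :+ c :* y := c :* (x :+ y)) ≃ᶜ-refl
        where open ℂ-Solver

    -- Multiply by n + 1 = i + j: the factor i lowers the exponent of z and yields a factor z, the
    -- factor j does the same for w, and what remains on either side is the sum over the previous
    -- diagonal.
    binomial : ∀ z w n → ∑ᶜ.∑[ diagonal n ] (λ (i , j) → expTerm z i *ᶜ expTerm w j) ≃ᶜ expTerm (z +ᶜ w) n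
    binomial z w zero    = eq
      where
      open ℂ-Solver
      eq : fromℚ 1ℚ *ᶜ fromℚ 1ℚ +ᶜ fromℚ 0ℚ ≃ᶜ fromℚ 1ℚ
      eq = solve 0 (con 1ℚ :* con 1ℚ :+ con 0ℚ := con 1ℚ) ≃ᶜ-refl
    binomial z w (suc n) = expTerm-unique (z +ᶜ w) _ n (begin
      fromℚ (ι (suc n)) *ᶜ ∑ᶜ.∑[ diagonal (suc n) ] (λ (i , j) → a i *ᶜ b j)
        ≈⟨ ∑-diagonal-weight (suc n) _ ⟨
      ∑ᶜ.∑[ diagonal (suc n) ] (λ (i , j) → (c i +ᶜ c j) *ᶜ (a i *ᶜ b j))
        ≈⟨ ∑ᶜ.∑-cong (diagonal (suc n)) (λ (i , j) → eq₁ (c i) (c j) (a i) (b j)) ⟩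
      ∑ᶜ.∑[ diagonal (suc n) ] (λ (i , j) → c i *ᶜ a i *ᶜ b j +ᶜ a i *ᶜ (c j *ᶜ b j))
        ≈⟨ ∑ᶜ.∑-+ (diagonal (suc n)) _ _ ⟩
      ∑ᶜ.∑[ diagonal (suc n) ] (λ (i , j) → c i *ᶜ a i *ᶜ b j) +ᶜ ∑ᶜ.∑[ diagonal (suc n) ] (λ (i , j) → a i *ᶜ (c j *ᶜ b j))
        ≈⟨ ℂᵣ.+-cong left right ⟩
      z *ᶜ S +ᶜ w *ᶜ S
        ≈⟨ ℂᵣ.distribʳ S z w ⟨
      (z +ᶜ w) *ᶜ S
        ≈⟨ ℂᵣ.*-congˡ (binomial z w n) ⟩
      (z +ᶜ w) *ᶜ expTerm (z +ᶜ w) n ∎)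
      where
      open SetoidReasoning ℂᵣ.setoid
      a b c : ℕ → ℂ
      a = expTerm z
      b = expTerm w
      c i = fromℚ (ι i)
      S : ℂ
      S = ∑ᶜ.∑[ diagonal n ] (λ (i , j) → a i *ᶜ b j)
      eq₁ : ∀ c d a b → (c +ᶜ d) *ᶜ (a *ᶜ b) ≃ᶜ c *ᶜ a *ᶜ b +ᶜ a *ᶜ (d *ᶜ b)
      eq₁ = solve 4 (λ c d a b → (c :+ d) :* (a :* b) := c :* a :* b :+ a :* (d :* b)) ≃ᶜ-refl
        where open ℂ-Solver
      eq₂ : ∀ x y s → fromℚ 0ℚ *ᶜ x *ᶜ y +ᶜ s ≃ᶜ s
      eq₂ = solve 3 (λ x y s → con 0ℚ :* x :* y :+ s := s) ≃ᶜ-refl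
        where open ℂ-Solver
      eq₃ : ∀ x y s → s +ᶜ x *ᶜ (fromℚ 0ℚ *ᶜ y) ≃ᶜ s
      eq₃ = solve 3 (λ x y s → s :+ x :* (con 0ℚ :* y) := s) ≃ᶜ-refl
        where open ℂ-Solver
      eq₄ : ∀ x y t → x *ᶜ (t *ᶜ y) ≃ᶜ t *ᶜ (x *ᶜ y)
      eq₄ = solve 3 (λ x y t → x :* (t :* y) := t :* (x :* y)) ≃ᶜ-refl
        where open ℂ-Solver
      left : ∑ᶜ.∑[ diagonal (suc n) ] (λ (i , j) → c i *ᶜ a i *ᶜ b j) ≃ᶜ z *ᶜ S
      left = begin
        c 0 *ᶜ a 0 *ᶜ b (suc n) +ᶜ ∑ᶜ.∑[ map sucˡ (diagonal n) ] (λ (i , j) → c i *ᶜ a i *ᶜ b j)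
          ≈⟨ eq₂ (a 0) (b (suc n)) _ ⟩
        ∑ᶜ.∑[ map sucˡ (diagonal n) ] (λ (i , j) → c i *ᶜ a i *ᶜ b j)
          ≈⟨ ∑ᶜ.∑-map sucˡ (diagonal n) _ ⟩
        ∑ᶜ.∑[ diagonal n ] (λ (i , j) → c (suc i) *ᶜ a (suc i) *ᶜ b j)
          ≈⟨ ∑ᶜ.∑-cong (diagonal n) (λ (i , j) → ≃ᶜ-trans (ℂᵣ.*-congʳ (expTerm-suc z i)) (ℂᵣ.*-assoc z (a i) (b j))) ⟩
        ∑ᶜ.∑[ diagonal n ] (λ (i , j) → z *ᶜ (a i *ᶜ b j))
          ≈⟨ ∑ᶜ.∑-*ˡ z (diagonal n) _ ⟩
        z *ᶜ S ∎
      right : ∑ᶜ.∑[ diagonal (suc n) ] (λ (i , j) → a i *ᶜ (c j *ᶜ b j)) ≃ᶜ w *ᶜ S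
      right = begin
        ∑ᶜ.∑[ diagonal (suc n) ] (λ (i , j) → a i *ᶜ (c j *ᶜ b j))
          ≈⟨ ∑-diagonal-last n _ ⟩
        ∑ᶜ.∑[ diagonal n ] (λ (i , j) → a i *ᶜ (c (suc j) *ᶜ b (suc j))) +ᶜ a (suc n) *ᶜ (c 0 *ᶜ b 0)
          ≈⟨ eq₃ (a (suc n)) (b 0) _ ⟩
        ∑ᶜ.∑[ diagonal n ] (λ (i , j) → a i *ᶜ (c (suc j) *ᶜ b (suc j)))
          ≈⟨ ∑ᶜ.∑-cong (diagonal n) (λ (i , j) → ≃ᶜ-trans (ℂᵣ.*-congˡ (expTerm-suc w j)) (eq₄ (a i) (b j) w)) ⟩
        ∑ᶜ.∑[ diagonal n ] (λ (i , j) → w *ᶜ (a i *ᶜ b j))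
          ≈⟨ ∑ᶜ.∑-*ˡ w (diagonal n) _ ⟩
        w *ᶜ S ∎

    triangular-expSum : ∀ z w n → ∑ᶜ.∑[ triangular n ] (λ (i , j) → expTerm z i *ᶜ expTerm w j) ≃ᶜ expSum (z +ᶜ w) n
    triangular-expSum z w zero    = ≃ᶜ-refl
    triangular-expSum z w (suc n) = begin
      ∑ᶜ.∑[ diagonal n ++ triangular n ] f                ≈⟨ ∑ᶜ.∑-++ (diagonal n) (triangular n) f ⟩
      ∑ᶜ.∑[ diagonal n ] f +ᶜ ∑ᶜ.∑[ triangular n ] f      ≈⟨ ℂᵣ.+-cong (binomial z w n) (triangular-expSum z w n) ⟩
      expTerm (z +ᶜ w) n +ᶜ expSum (z +ᶜ w) n             ≈⟨ ℂᵣ.+-comm _ _ ⟩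
      expSum (z +ᶜ w) n +ᶜ expTerm (z +ᶜ w) n             ∎
      where
      open SetoidReasoning ℂᵣ.setoid
      f : ℕ × ℕ → ℂ
      f (i , j) = expTerm z i *ᶜ expTerm w j

  conj : ℂ → ℂ
  conj z = re z +i (-ᴿ im z)

  abstract

    -- The approximant of `exp z` at index j is that of the partial sum of length j, so both sides
    -- are compared with the partial sum of length M.
    expSum-⟶ : ∀ z → expSum z ⟶ exp z
    expSum-⟶ z = mk⟶ λ ε 0<ε →
      let (M , J , h) = expSum-uniform z (½ * ε) (half-pos ε 0<ε)
      in M , λ n M≤n → eventually⇒≼ (M ⊔ J , λ j p →
        let M≤j = ℕₚ.m⊔n≤o⇒m≤o M J p
            J≤j = ℕₚ.m⊔n≤o⇒n≤o M J p
        in ℚₚ.<⇒≤ (halves _ _ _ ε (dist-via (expSum z M) (expSum z n) (expSum z j) j)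
             (h n j M≤n J≤j) (h j j M≤j J≤j)))

    expSum-∑ : ∀ z n → expSum z n ≃ᶜ ∑ᶜ.∑[ downFrom n ] (expTerm z)
    expSum-∑ z zero    = ≃ᶜ-refl
    expSum-∑ z (suc n) = ≃ᶜ-trans (ℂᵣ.+-congʳ (expSum-∑ z n)) (ℂᵣ.+-comm _ _)

    expTerm-re : ∀ x k j → seq (re (expTerm (ofℝ x) k)) j ≡ term-bound (seq x j) k
    expTerm-im : ∀ x k j → seq (im (expTerm (ofℝ x) k)) j ≡ 0ℚ
    expTerm-re x zero    j = refl
    expTerm-re x (suc k) j = trans
      (cong₂ (λ a b → (+ 1 / suc k) * (seq x j * a - 0ℚ * b)) (expTerm-re x k j) (expTerm-im x k j))
      (eq (+ 1 / suc k) (seq x j) (term-bound (seq x j) k))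
      where
      eq : ∀ r x t → r * (x * t - 0ℚ * 0ℚ) ≡ r * x * t
      eq = solve-∀ ℚ-ring
    expTerm-im x zero    j = refl
    expTerm-im x (suc k) j = trans
      (cong₂ (λ a b → (+ 1 / suc k) * (seq x j * b + 0ℚ * a)) (expTerm-re x k j) (expTerm-im x k j))
      (eq (+ 1 / suc k) (seq x j) (term-bound (seq x j) k))
      where
      eq : ∀ r x t → r * (x * 0ℚ + 0ℚ * t) ≡ 0ℚ
      eq = solve-∀ ℚ-ring

    expSum-re : ∀ x n j → seq (re (expSum (ofℝ x) n)) j ≡ ∑ℚ.∑[ downFrom n ] (term-bound (seq x j))
    expSum-re x zero    j = refl
    expSum-re x (suc n) j = trans (cong₂ _+_ (expSum-re x n j) (expTerm-re x n j)) (ℚₚ.+-comm _ (term-bound (seq x j) n))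

    -- The weight sums are the approximants of the exponential of the rational B, known to be
    -- Cauchy.
    ∑-term-bound-cauchy : ∀ B → IsCauchy (λ n → ∑ℚ.∑[ downFrom n ] (term-bound B))
    ∑-term-bound-cauchy B = cauchy-resp (λ n → expSum-re (ofℚ B) n n) (exp-re-cauchy (fromℚ B))

    expTerm-≼ : ∀ z → ∃[ B ] ∀ k → expTerm z k ≼ term-bound B k
    expTerm-≼ z = let (B , 0≤B , J , h) = ‖‖-bound z in
      B , λ k → eventually⇒≼ (J , λ j J≤j → term-bounded z j B 0≤B (h j J≤j) k)

    exp-+ : ∀ z w → exp (z +ᶜ w) ≃ᶜ exp z *ᶜ exp w
    exp-+ z w = from-bounds (expTerm-≼ z) (expTerm-≼ w)
      where
      f : ℕ × ℕ → ℂ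
      f (i , j) = expTerm z i *ᶜ expTerm w j
      from-bounds : (∃[ A ] ∀ i → expTerm z i ≼ term-bound A i) → (∃[ B ] ∀ j → expTerm w j ≼ term-bound B j) →
        exp (z +ᶜ w) ≃ᶜ exp z *ᶜ exp w
      from-bounds (A , z≼A) (B , w≼B) = ⟶-unique (expSum-⟶ (z +ᶜ w))
        (⟶-cong (triangular-expSum z w) ≃ᶜ-refl triangular-⟶)
        where
        a : ℕ × ℕ → ℚ
        a (i , j) = term-bound A i * term-bound B j
        f≼a : ∀ ij → f ij ≼ a ij
        f≼a (i , j) = ≼-* (z≼A i) (w≼B j)
        a-cauchy : IsCauchy (λ n → ∑ℚ.∑[ cartesianProduct (downFrom n) (downFrom n) ] a)
        a-cauchy = cauchy-resp (λ n → sym (∑ℚ.∑-product (downFrom n) (downFrom n) (term-bound A) (term-bound B)))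
          (cauchy-* (∑-term-bound-cauchy A) (∑-term-bound-cauchy B))
        module D = Dominated (<ℕ ⊗ <ℕ) f a f≼a a-cauchy
        square-⟶ : (λ n → ∑ᶜ.∑[ cartesianProduct (downFrom n) (downFrom n) ] f) ⟶ exp z *ᶜ exp w
        square-⟶ = ⟶-cong
          (λ n → ≃ᶜ-trans (ℂᵣ.*-cong (expSum-∑ z n) (expSum-∑ w n))
                   (≃ᶜ-sym (∑ᶜ.∑-product (downFrom n) (downFrom n) (expTerm z) (expTerm w))))
          ≃ᶜ-refl (⟶-* (expSum-⟶ z) (expSum-⟶ w))
        -- Closeness holds for every finite set containing a certain square, and the triangle of
        -- side 2N contains the square of side N.
        triangular-⟶ : (λ n → ∑ᶜ.∑[ triangular n ] f) ⟶ exp z *ᶜ exp w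
        triangular-⟶ = mk⟶ λ ε 0<ε →
          let (N , h) = D.⟶⇒unordered square-⟶ ε 0<ε
          in N ℕ.+ N , λ n 2N≤n → h (triangular n) (triangular-unique n) (square⊆triangular {N} 2N≤n)

    ·-cong : ∀ r {z w} → z ≃ᶜ w → r · z ≃ᶜ r · w
    ·-cong r z≃w = ≃ᶜ-trans (·≃* r _) (≃ᶜ-trans (ℂᵣ.*-congˡ z≃w) (≃ᶜ-sym (·≃* r _)))

    expTerm-cong : ∀ {z w} → z ≃ᶜ w → ∀ k → expTerm z k ≃ᶜ expTerm w k
    expTerm-cong z≃w zero    = ≃ᶜ-refl
    expTerm-cong z≃w (suc k) = ·-cong (+ 1 / suc k) (ℂᵣ.*-cong z≃w (expTerm-cong z≃w k))

    -- `exp` reads approximants, so invariance is not immediate; equal partial sums have equal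
    -- limits.
    exp-cong : ∀ {z w} → z ≃ᶜ w → exp z ≃ᶜ exp w
    exp-cong {z} {w} z≃w = ⟶-unique (⟶-cong sums ≃ᶜ-refl (expSum-⟶ z)) (expSum-⟶ w)
      where
      sums : ∀ n → expSum z n ≃ᶜ expSum w n
      sums zero    = ≃ᶜ-refl
      sums (suc n) = ℂᵣ.+-cong (sums n) (expTerm-cong z≃w n)

    exp-0 : ∀ {z} → z ≃ᶜ 0ᶜ → exp z ≃ᶜ 1ᶜ
    exp-0 z≃0 = ≃ᶜ-trans (exp-cong z≃0) (⟶-unique (expSum-⟶ 0ᶜ) const-⟶)
      where
      terms : ∀ k → expTerm 0ᶜ (suc k) ≃ᶜ 0ᶜ
      terms k = ≃ᶜ-trans (·≃* (+ 1 / suc k) _) (≃ᶜ-trans (ℂᵣ.*-congˡ (ℂᵣ.zeroˡ _)) (ℂᵣ.zeroʳ _))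
      sums : ∀ n → expSum 0ᶜ (suc n) ≃ᶜ 1ᶜ
      sums zero    = ℂᵣ.+-identityˡ 1ᶜ
      sums (suc n) = ≃ᶜ-trans (ℂᵣ.+-cong (sums n) (terms n)) (ℂᵣ.+-identityʳ 1ᶜ)
      const-⟶ : expSum 0ᶜ ⟶ 1ᶜ
      const-⟶ = mk⟶ λ ε 0<ε → 1 , λ { (suc n) _ → ≼-mono (ℚₚ.<⇒≤ 0<ε)
        (≃0⇒≼0 (≃ᶜ-trans (-ᶜ-cong₂ (sums n) ≃ᶜ-refl) (ℂᵣ.-‿inverseʳ 1ᶜ))) }

    expTerm-conj-re : ∀ z k j → seq (re (expTerm (conj z) k)) j ≡ seq (re (expTerm z k)) j
    expTerm-conj-im : ∀ z k j → seq (im (expTerm (conj z) k)) j ≡ - seq (im (expTerm z k)) j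
    expTerm-conj-re z zero    j = refl
    expTerm-conj-re z (suc k) j = cong ((+ 1 / suc k) *_) (trans
      (cong₂ (λ a b → seq (re z) j * a - (- seq (im z) j) * b) (expTerm-conj-re z k j) (expTerm-conj-im z k j))
      (eq (seq (re z) j) (seq (im z) j) (seq (re (expTerm z k)) j) (seq (im (expTerm z k)) j)))
      where
      eq : ∀ x y a b → x * a - (- y) * (- b) ≡ x * a - y * b
      eq = solve-∀ ℚ-ring
    expTerm-conj-im z zero    j = refl
    expTerm-conj-im z (suc k) j = trans
      (cong₂ (λ a b → (+ 1 / suc k) * (seq (re z) j * b + (- seq (im z) j) * a)) (expTerm-conj-re z k j) (expTerm-conj-im z k j))
      (eq (+ 1 / suc k) (seq (re z) j) (seq (im z) j) (seq (re (expTerm z k)) j) (seq (im (expTerm z k)) j))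
      where
      eq : ∀ r x y a b → r * (x * (- b) + (- y) * a) ≡ - (r * (x * b + y * a))
      eq = solve-∀ ℚ-ring

    exp-conj : ∀ z → exp (conj z) ≃ᶜ conj (exp z)
    exp-conj z = pointwiseᶜ (λ n → re-sums n n) (λ n → im-sums n n)
      where
      re-sums : ∀ n j → seq (re (expSum (conj z) n)) j ≡ seq (re (expSum z n)) j
      re-sums zero    j = refl
      re-sums (suc n) j = cong₂ _+_ (re-sums n j) (expTerm-conj-re z n j)
      im-sums : ∀ n j → seq (im (expSum (conj z) n)) j ≡ - seq (im (expSum z n)) j
      im-sums zero    j = refl
      im-sums (suc n) j = trans (cong₂ _+_ (im-sums n j) (expTerm-conj-im z n j))
        (sym (ℚₚ.neg-distrib-+ (seq (im (expSum z n)) j) (seq (im (expTerm z n)) j)))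

    -- |e^z|² is e^z times its conjugate, and conjugation passes through every term of the series.
    exp-∣∣² : ∀ z → ofℝ (∣ exp z ∣²) ≃ᶜ exp (ofℝ (re z +ᴿ re z))
    exp-∣∣² z = begin
      ofℝ (∣ exp z ∣²)            ≈⟨ pointwiseᶜ (λ n → eq₁ (seq (re (exp z)) n) (seq (im (exp z)) n))
                                                (λ n → eq₂ (seq (re (exp z)) n) (seq (im (exp z)) n)) ⟩
      exp z *ᶜ conj (exp z)       ≈⟨ ℂᵣ.*-congˡ (exp-conj z) ⟨
      exp z *ᶜ exp (conj z)       ≈⟨ exp-+ z (conj z) ⟨
      exp (z +ᶜ conj z)           ≈⟨ exp-cong (pointwiseᶜ (λ _ → refl) (λ n → ℚₚ.+-inverseʳ (seq (im z) n))) ⟩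
      exp (ofℝ (re z +ᴿ re z))    ∎
      where
      open SetoidReasoning ℂᵣ.setoid
      eq₁ : ∀ a b → a * a + b * b ≡ a * a - b * (- b)
      eq₁ = solve-∀ ℚ-ring
      eq₂ : ∀ a b → 0ℚ ≡ a * (- b) + b * a
      eq₂ = solve-∀ ℚ-ring

    -- For nonnegative x all terms are nonnegative, and the first two are 1 and x. The approximant
    -- at index n sums n terms, whence the demand n ≥ 2.
    exp-real-≥ : ∀ x δ → 0ℚ ≤ δ → Eventually (λ n → δ ≤ seq x n) → Eventually (λ n → 1ℚ + δ ≤ seq (re (exp (ofℝ x))) n)
    exp-real-≥ x δ 0≤δ h = eventually-map (λ n (δ≤x , 2≤n) → ℚₚ.≤-trans (ℚₚ.+-monoʳ-≤ 1ℚ δ≤x) (go n 2≤n (ℚₚ.≤-trans 0≤δ δ≤x)))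
      (h ∧ᵉ (2 , λ _ p → p))
      where
      eq : ∀ x → 1ℚ * x * 1ℚ + (1ℚ + 0ℚ) ≡ 1ℚ + x
      eq = solve-∀ ℚ-ring
      partial : ∀ y → 0ℚ ≤ y → ∀ n → 1ℚ + y ≤ ∑ℚ.∑[ downFrom (suc (suc n)) ] (term-bound y)
      partial y 0≤y zero    = ℚₚ.≤-reflexive (sym (eq y))
      partial y 0≤y (suc n) = ℚₚ.≤-trans (partial y 0≤y n)
        (subst (_≤ term-bound y (suc (suc n)) + ∑ℚ.∑[ downFrom (suc (suc n)) ] (term-bound y)) (ℚₚ.+-identityˡ _)
          (ℚₚ.+-monoˡ-≤ (∑ℚ.∑[ downFrom (suc (suc n)) ] (term-bound y)) (term-bound-nonNeg y 0≤y (suc (suc n)))))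
      go : ∀ n → 2 ℕ.≤ n → 0ℚ ≤ seq x n → 1ℚ + seq x n ≤ seq (re (exp (ofℝ x))) n
      go (suc (suc n)) (ℕ.s≤s (ℕ.s≤s _)) 0≤x = subst (1ℚ + seq x (suc (suc n)) ≤_)
        (sym (expSum-re x (suc (suc n)) (suc (suc n)))) (partial (seq x (suc (suc n))) 0≤x n)

    exp-inverse : ∀ z → exp z *ᶜ exp (-ᶜ z) ≃ᶜ 1ᶜ
    exp-inverse z = ≃ᶜ-trans (≃ᶜ-sym (exp-+ z (-ᶜ z))) (exp-0 (ℂᵣ.-‿inverseʳ z))

    ofℤ-+ : ∀ k l → ofℤ (k ℤ.+ l) ≃ᶜ ofℤ k +ᶜ ofℤ l
    ofℤ-+ k l = ≃ᶜ-trans (≡⇒≃ᶜ (cong fromℚ (/1-+ k l))) (fromℚ-+ _ _)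

    ofℤ-* : ∀ k l → ofℤ (k ℤ.* l) ≃ᶜ ofℤ k *ᶜ ofℤ l
    ofℤ-* k l = ≃ᶜ-trans (≡⇒≃ᶜ (cong fromℚ (/1-* k l))) (fromℚ-* _ _)

  infixr 9 _^ᶜ_
  _^ᶜ_ : ℂ → ℕ → ℂ
  z ^ᶜ zero  = 1ᶜ
  z ^ᶜ suc n = z *ᶜ z ^ᶜ n

  abstract

    ^ᶜ-one : ∀ {z} → z ≃ᶜ 1ᶜ → ∀ n → z ^ᶜ n ≃ᶜ 1ᶜ
    ^ᶜ-one z≃1 zero    = ≃ᶜ-refl
    ^ᶜ-one z≃1 (suc n) = ≃ᶜ-trans (ℂᵣ.*-cong z≃1 (^ᶜ-one z≃1 n)) (ℂᵣ.*-identityˡ 1ᶜ)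

    ^ᶜ-+ : ∀ z m n → z ^ᶜ (m ℕ.+ n) ≃ᶜ z ^ᶜ m *ᶜ z ^ᶜ n
    ^ᶜ-+ z zero    n = ≃ᶜ-sym (ℂᵣ.*-identityˡ _)
    ^ᶜ-+ z (suc m) n = ≃ᶜ-trans (ℂᵣ.*-congˡ (^ᶜ-+ z m n)) (≃ᶜ-sym (ℂᵣ.*-assoc _ _ _))

    ^ᶜ-distrib : ∀ z w n → (z *ᶜ w) ^ᶜ n ≃ᶜ z ^ᶜ n *ᶜ w ^ᶜ n
    ^ᶜ-distrib z w zero    = ≃ᶜ-sym (ℂᵣ.*-identityˡ _)
    ^ᶜ-distrib z w (suc n) = ≃ᶜ-trans (ℂᵣ.*-congˡ (^ᶜ-distrib z w n)) (eq z w (z ^ᶜ n) (w ^ᶜ n))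
      where
      open ℂ-Solver
      eq : ∀ z w x y → (z *ᶜ w) *ᶜ (x *ᶜ y) ≃ᶜ (z *ᶜ x) *ᶜ (w *ᶜ y)
      eq = solve 4 (λ z w x y → (z :* w) :* (x :* y) := (z :* x) :* (w :* y)) ≃ᶜ-refl

    ^ᶜ-* : ∀ z m n → z ^ᶜ (m ℕ.* n) ≃ᶜ (z ^ᶜ n) ^ᶜ m
    ^ᶜ-* z zero    n = ≃ᶜ-refl
    ^ᶜ-* z (suc m) n = ≃ᶜ-trans (^ᶜ-+ z n (m ℕ.* n)) (ℂᵣ.*-congˡ (^ᶜ-* z m n))

    exp-*ℕ : ∀ z n → exp (z *ᶜ ofℤ (+ n)) ≃ᶜ exp z ^ᶜ n
    exp-*ℕ z zero    = exp-0 (ℂᵣ.zeroʳ z)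
    exp-*ℕ z (suc n) = begin
      exp (z *ᶜ ofℤ (+ suc n))             ≈⟨ exp-cong (ℂᵣ.*-congˡ (ofℤ-+ (+ 1) (+ n))) ⟩
      exp (z *ᶜ (fromℚ 1ℚ +ᶜ ofℤ (+ n)))   ≈⟨ exp-cong (eq z (ofℤ (+ n))) ⟩
      exp (z +ᶜ z *ᶜ ofℤ (+ n))            ≈⟨ exp-+ z _ ⟩
      exp z *ᶜ exp (z *ᶜ ofℤ (+ n))        ≈⟨ ℂᵣ.*-congˡ (exp-*ℕ z n) ⟩
      exp z *ᶜ exp z ^ᶜ n                  ∎
      where
      open SetoidReasoning ℂᵣ.setoid
      eq : ∀ z w → z *ᶜ (fromℚ 1ℚ +ᶜ w) ≃ᶜ z +ᶜ z *ᶜ w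
      eq = solve 2 (λ z w → z :* (con 1ℚ :+ w) := z :+ z :* w) ≃ᶜ-refl
        where open ℂ-Solver

    exp-*-neg : ∀ z k → exp (z *ᶜ ofℤ (ℤ.- k)) ≃ᶜ exp (-ᶜ z *ᶜ ofℤ k)
    exp-*-neg z k = exp-cong (≃ᶜ-trans (ℂᵣ.*-congˡ (≃ᶜ-trans (≡⇒≃ᶜ (cong fromℚ (/1-neg k))) (pointwiseᶜ (λ _ → refl) (λ _ → refl))))
      (eq z (ofℤ k)))
      where
      eq : ∀ z w → z *ᶜ (-ᶜ w) ≃ᶜ -ᶜ z *ᶜ w
      eq = solve 2 (λ z w → z :* (:- w) := :- z :* w) ≃ᶜ-refl
        where open ℂ-Solver

  -- Cancellation in the reals and e^(iπ) = -1

  abstract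

    close-0 : ∀ {x} → x ≃ᴿ 0ᴿ → ∀ ε → 0ℚ < ε → Eventually (λ n → ∣ seq x n ∣ < ε)
    close-0 {x} x≃0 ε 0<ε = eventually-map (λ n → subst (λ t → ∣ t ∣ < ε) (ℚₚ.+-identityʳ (seq x n))) (close x≃0 ε 0<ε)

    from-close-0 : ∀ {x} → (∀ ε → 0ℚ < ε → Eventually (λ n → ∣ seq x n ∣ < ε)) → x ≃ᴿ 0ᴿ
    from-close-0 {x} h = mk≃ λ ε 0<ε →
      eventually-map (λ n → subst (λ t → ∣ t ∣ < ε) (sym (ℚₚ.+-identityʳ (seq x n)))) (h ε 0<ε)

    -- Constructively valid: to a given precision x is either small or bounded away from 0.
    *-cancelʳ-≄0 : ∀ {x y} → x *ᴿ y ≃ᴿ 0ᴿ → ¬ (y ≃ᴿ 0ᴿ) → x ≃ᴿ 0ᴿ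
    *-cancelʳ-≄0 {x} {y} xy≃0 y≄0 = from-close-0 small
      where
      ∣∣-via : ∀ a b → ∣ a ∣ ≤ ∣ a - b ∣ + ∣ b ∣
      ∣∣-via a b = subst (λ t → ∣ t ∣ ≤ ∣ a - b ∣ + ∣ b ∣) (minus-plus a b) (ℚₚ.∣p+q∣≤∣p∣+∣q∣ (a - b) b)
      module _ (ε : ℚ) (0<ε : 0ℚ < ε) where
        δ : ℚ
        δ = ½ * (½ * ε)
        0<δ : 0ℚ < δ
        0<δ = half-pos (½ * ε) (half-pos ε 0<ε)
        δ<½ε : δ < ½ * ε
        δ<½ε = subst (δ <_) (½+½ (½ * ε)) (p<p+q δ 0<δ)
        module _ (N : ℕ) (near-N : ∀ m n → N ℕ.≤ m → N ℕ.≤ n → ∣ seq x m - seq x n ∣ < δ) where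
          from-dec : Dec (∣ seq x N ∣ < ½ * ε) → Eventually (λ n → ∣ seq x n ∣ < ε)
          from-dec (yes x<½ε) = N , λ n N≤n → halves _ _ _ ε (∣∣-via (seq x n) (seq x N))
            (ℚₚ.<-trans (near-N n N N≤n ℕₚ.≤-refl) δ<½ε) x<½ε
          -- Here x stays at least δ away from 0 beyond N, so x y → 0 forces y → 0, against the
          -- hypothesis on y.
          from-dec (no x≮½ε) = ⊥-elim (y≄0 (from-close-0 λ η 0<η →
            eventually-map (λ n (xy<δη , N≤n) → y-small n N≤n η xy<δη)
              (close-0 xy≃0 (δ * η) (*-pos δ η 0<δ 0<η) ∧ᵉ (N , λ _ p → p))))
            where
            δ≤x : ∀ n → N ℕ.≤ n → δ ≤ ∣ seq x n ∣
            δ≤x n N≤n = subst₂ _≤_ (cancel₁ δ) (cancel₂ δ (∣ seq x n ∣)) (ℚₚ.+-monoˡ-≤ (- δ)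
              (ℚₚ.≤-trans (ℚₚ.≤-reflexive (½+½ (½ * ε)))
                (ℚₚ.≤-trans (ℚₚ.≮⇒≥ x≮½ε) (ℚₚ.≤-trans (∣∣-via (seq x N) (seq x n))
                  (ℚₚ.+-monoˡ-≤ (∣ seq x n ∣) (ℚₚ.<⇒≤ (near-N N n ℕₚ.≤-refl N≤n)))))))
              where
              cancel₁ : ∀ d → d + d - d ≡ d
              cancel₁ = solve-∀ ℚ-ring
              cancel₂ : ∀ d a → d + a - d ≡ a
              cancel₂ = solve-∀ ℚ-ring
            y-small : ∀ n → N ℕ.≤ n → ∀ η → ∣ seq x n * seq y n ∣ < δ * η → ∣ seq y n ∣ < η
            y-small n N≤n η h = ℚₚ.*-cancelˡ-<-nonNeg δ {{ℚ.nonNegative (ℚₚ.<⇒≤ 0<δ)}}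
              (ℚₚ.≤-<-trans
                (ℚₚ.≤-trans (ℚₚ.*-monoʳ-≤-nonNeg (∣ seq y n ∣) {{ℚ.nonNegative (ℚₚ.0≤∣p∣ (seq y n))}} (δ≤x n N≤n))
                  (ℚₚ.≤-reflexive (sym (ℚₚ.∣p*q∣≡∣p∣*∣q∣ (seq x n) (seq y n)))))
                h)
      small : ∀ ε → 0ℚ < ε → Eventually (λ n → ∣ seq x n ∣ < ε)
      small ε 0<ε = let (N , h) = modulus (cauchy x) (½ * (½ * ε)) (half-pos (½ * ε) (half-pos ε 0<ε))
        in from-dec ε 0<ε N h (∣ seq x N ∣ ℚₚ.<? ½ * ε)

  module _ (π : ℝ) (isPi : IsPi π) where
    open IsPi isPi

    private
      ½π : ℝ
      ½π = ofℚ ½ *ᴿ π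

      c s : ℝ
      c = re (exp (𝕚 *ᶜ ofℝ ½π))
      s = im (exp (𝕚 *ᶜ ofℝ ½π))

    abstract

      private
        0<½π : 0ᴿ <ᴿ ½π
        0<½π = let mk< g 0<g h = 0<π in mk< (½ * g) (half-pos g 0<g) (eventually-map
          (λ n p → subst (_< ½ * seq π n) (eq g) (ℚₚ.*-monoʳ-<-pos ½ p)) h)
          where
          eq : ∀ g → ½ * (0ℚ + g) ≡ 0ℚ + ½ * g
          eq = solve-∀ ℚ-ring

        ½π<π : ½π <ᴿ π
        ½π<π = let mk< g 0<g h = 0<π in mk< (½ * g) (half-pos g 0<g) (eventually-map
          (λ n p → subst (½ * seq π n + ½ * g <_) (½+½ (seq π n)) (ℚₚ.+-monoʳ-< (½ * seq π n)
            (subst (λ t → ½ * t < ½ * seq π n) (ℚₚ.+-identityˡ g) (ℚₚ.*-monoʳ-<-pos ½ p)))) h)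

        s≄0 : ¬ (s ≃ᴿ 0ᴿ)
        s≄0 = least ½π 0<½π ½π<π

        square-half : exp (𝕚 *ᶜ ofℝ π) ≃ᶜ (c +i s) *ᶜ (c +i s)
        square-half = ≃ᶜ-trans (exp-cong (pointwiseᶜ (λ n → eq₁ (seq π n)) (λ n → eq₂ (seq π n)))) (exp-+ _ _)
          where
          eq₁ : ∀ p → 0ℚ * p - 1ℚ * 0ℚ ≡ (0ℚ * (½ * p) - 1ℚ * 0ℚ) + (0ℚ * (½ * p) - 1ℚ * 0ℚ)
          eq₁ = solve-∀ ℚ-ring
          eq₂ : ∀ p → 0ℚ * 0ℚ + 1ℚ * p ≡ (0ℚ * 0ℚ + 1ℚ * (½ * p)) + (0ℚ * 0ℚ + 1ℚ * (½ * p))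
          eq₂ = solve-∀ ℚ-ring

        -- The imaginary part of (c + i s)² is 2 c s, and this square is e^(iπ), whose imaginary
        -- part is sin π.
        c*s≃0 : c *ᴿ s ≃ᴿ 0ᴿ
        c*s≃0 = ≃ᴿ-trans (pointwise (λ n → eq (seq c n) (seq s n)))
          (≃ᴿ-trans (*ᴿ-cong (≃ᴿ-refl {ofℚ ½}) (≃ᴿ-trans (≃ᴿ-sym (im≃ square-half)) sinπ)) (pointwise λ _ → ℚₚ.*-zeroʳ ½))
          where
          eq : ∀ c s → c * s ≡ ½ * (c * s + s * c)
          eq = solve-∀ ℚ-ring

        c≃0 : c ≃ᴿ 0ᴿ
        c≃0 = *-cancelʳ-≄0 c*s≃0 s≄0

        c²+s²≃1 : c *ᴿ c +ᴿ s *ᴿ s ≃ᴿ 1ᴿ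
        c²+s²≃1 = re≃ (≃ᶜ-trans (exp-∣∣² (𝕚 *ᶜ ofℝ ½π)) (exp-0 (pointwiseᶜ (λ n → eq (seq π n)) (λ _ → refl))))
          where
          eq : ∀ p → (0ℚ * (½ * p) - 1ℚ * 0ℚ) + (0ℚ * (½ * p) - 1ℚ * 0ℚ) ≡ 0ℚ
          eq = solve-∀ ℚ-ring

      -- The real part is c² - s² = 2 c² - (c² + s²), with c = 0 and c² + s² = 1.
      exp-iπ : exp (𝕚 *ᶜ ofℝ π) ≃ᶜ -ᶜ 1ᶜ
      exp-iπ = mk≃ᶜ re-part (≃ᴿ-trans sinπ (pointwise λ _ → refl))
        where
        eq : ∀ c s → c * c - s * s ≡ (c * c + c * c) - (c * c + s * s)
        eq = solve-∀ ℚ-ring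
        c²≃0 : c *ᴿ c ≃ᴿ 0ᴿ
        c²≃0 = ≃ᴿ-trans (*ᴿ-cong c≃0 (≃ᴿ-refl {c})) (pointwise λ n → ℚₚ.*-zeroˡ (seq c n))
        re-part : re (exp (𝕚 *ᶜ ofℝ π)) ≃ᴿ -ᴿ 1ᴿ
        re-part = ≃ᴿ-trans (re≃ square-half) (≃ᴿ-trans (pointwise λ n → eq (seq c n) (seq s n))
          (≃ᴿ-trans (+ᴿ-cong (+ᴿ-cong c²≃0 c²≃0) (-ᴿ-cong c²+s²≃1)) (pointwise λ _ → refl)))

  -- Theta series

  -- The parameter p stands for π i r τ; the terms of A, C and ϑ₄ all reduce to this one for
  -- suitable p.
  theta-term : ℂ → ℂ → ℤ → ℂ
  theta-term p z s = exp (p *ᶜ ofℤ (s ℤ.* s)) *ᶜ exp (ofℤ (+ 2) *ᶜ 𝕚 *ᶜ z *ᶜ ofℤ s)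

  -- For either sign of s the factor e^(2izs) is a power with exponent |s|, of e^(2iz) or of
  -- e^(-2iz).
  frequencies : ℂ → List ℂ
  frequencies z = (ofℤ (+ 2) *ᶜ 𝕚 *ᶜ z) ∷ (-ᶜ (ofℤ (+ 2) *ᶜ 𝕚 *ᶜ z)) ∷ []

  record NegativeRe (p : ℂ) : Set where
    constructor mkNegativeRe
    field
      margin     : ℚ
      0<margin   : 0ℚ < margin
      eventually : Eventually (λ n → seq (re p) n ≤ - margin)

  -- Gaussian decay of the theta terms

  infixr 9 _^ℚ_
  _^ℚ_ : ℚ → ℕ → ℚ
  r ^ℚ zero  = 1ℚ
  r ^ℚ suc n = r * r ^ℚ n

  abstract

    ^ℚ-nonNeg : ∀ {r} → 0ℚ ≤ r → ∀ n → 0ℚ ≤ r ^ℚ n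
    ^ℚ-nonNeg 0≤r zero    = ℚₚ.<⇒≤ 0<1
    ^ℚ-nonNeg 0≤r (suc n) = *-nonNeg _ _ 0≤r (^ℚ-nonNeg 0≤r n)

    ^ℚ-mono : ∀ {r} → 1ℚ ≤ r → ∀ {m n} → m ℕ.≤ n → r ^ℚ m ≤ r ^ℚ n
    ^ℚ-mono {r} 1≤r {zero}  {zero}  _ = ℚₚ.≤-refl
    ^ℚ-mono {r} 1≤r {zero}  {suc n} _ = subst (_≤ r * r ^ℚ n) (ℚₚ.*-identityˡ 1ℚ)
      (*-mono 1ℚ r 1ℚ (r ^ℚ n) (ℚₚ.≤-trans (ℚₚ.<⇒≤ 0<1) 1≤r) (ℚₚ.<⇒≤ 0<1) 1≤r (^ℚ-mono 1≤r {zero} {n} ℕ.z≤n))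
    ^ℚ-mono {r} 1≤r {suc m} {suc n} (ℕ.s≤s m≤n) =
      ℚₚ.*-monoˡ-≤-nonNeg r {{ℚ.nonNegative (ℚₚ.≤-trans (ℚₚ.<⇒≤ 0<1) 1≤r)}} (^ℚ-mono 1≤r m≤n)

    double-^ℚ : ∀ r n → r ^ℚ n ≡ (r + r) ^ℚ n * ½^ n
    double-^ℚ r zero    = refl
    double-^ℚ r (suc n) = trans (cong (r *_) (double-^ℚ r n)) (eq r ((r + r) ^ℚ n) (½^ n))
      where
      eq : ∀ r x y → r * (x * y) ≡ (r + r) * x * (½ * y)
      eq = solve-∀ ℚ-ring

    -- The form without division of: r ≤ 1 / (1 + δ) implies rⁿ ≤ 1 / (1 + n δ).
    bernoulli : ∀ r δ → 0ℚ ≤ r → 0ℚ ≤ δ → r * (1ℚ + δ) ≤ 1ℚ → ∀ n → r ^ℚ n * (1ℚ + ι n * δ) ≤ 1ℚ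
    bernoulli r δ 0≤r 0≤δ h zero    = ℚₚ.≤-reflexive (eq δ)
      where
      eq : ∀ δ → 1ℚ * (1ℚ + 0ℚ * δ) ≡ 1ℚ
      eq = solve-∀ ℚ-ring
    bernoulli r δ 0≤r 0≤δ h (suc n) = begin
      r * r ^ℚ n * (1ℚ + ι (suc n) * δ)                  ≡⟨ cong (λ t → r * r ^ℚ n * (1ℚ + t * δ)) (/1-+ (+ 1) (+ n)) ⟩
      -- The added term n δ² completes the product (1 + n δ) (1 + δ).
      r * r ^ℚ n * (1ℚ + (1ℚ + ι n) * δ)                 ≤⟨ ℚₚ.*-monoˡ-≤-nonNeg (r * r ^ℚ n) {{ℚ.nonNegative (^ℚ-nonNeg 0≤r (suc n))}}
                                                             (p≤p+q _ (ι n * δ * δ) (*-nonNeg _ δ (*-nonNeg (ι n) δ 0≤ι 0≤δ) 0≤δ)) ⟩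
      r * r ^ℚ n * (1ℚ + (1ℚ + ι n) * δ + ι n * δ * δ)   ≡⟨ eq r (r ^ℚ n) δ (ι n) ⟩
      (r ^ℚ n * (1ℚ + ι n * δ)) * (r * (1ℚ + δ))         ≤⟨ *-mono _ 1ℚ _ 1ℚ (ℚₚ.<⇒≤ 0<1)
                                                             (*-nonNeg r _ 0≤r (ℚₚ.+-mono-≤ (ℚₚ.<⇒≤ 0<1) 0≤δ))
                                                             (bernoulli r δ 0≤r 0≤δ h n) h ⟩
      1ℚ * 1ℚ                                            ≡⟨ ℚₚ.*-identityˡ 1ℚ ⟩
      1ℚ                                                 ∎
      where
      open ℚₚ.≤-Reasoning
      0≤ι : 0ℚ ≤ ι n
      0≤ι = ι-mono {0} {n} ℕ.z≤n
      eq : ∀ r x δ i → r * x * (1ℚ + (1ℚ + i) * δ + i * δ * δ) ≡ (x * (1ℚ + i * δ)) * (r * (1ℚ + δ))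
      eq = solve-∀ ℚ-ring

    square-nonNeg : ∀ a → 0ℚ ≤ a * a
    square-nonNeg a = subst (0ℚ ≤_) (sym (square-abs a)) (*-nonNeg _ _ (ℚₚ.0≤∣p∣ a) (ℚₚ.0≤∣p∣ a))

    abs-≤-root : ∀ a e → 0ℚ ≤ e → a * a ≤ e * e → ∣ a ∣ ≤ e
    abs-≤-root a e 0≤e h = ℚₚ.≮⇒≥ λ e<a → ℚₚ.<-irrefl refl (ℚₚ.<-≤-trans
      (ℚₚ.≤-<-trans (ℚₚ.*-monoˡ-≤-nonNeg e {{ℚ.nonNegative 0≤e}} (ℚₚ.<⇒≤ e<a))
        (ℚₚ.*-monoˡ-<-pos (∣ a ∣) {{ℚ.positive (ℚₚ.≤-<-trans 0≤e e<a)}} e<a))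
      (subst (_≤ e * e) (square-abs a) h))

    -- The passage from the modulus back to the ℓ¹ norm costs a factor 2; this is the origin of the
    -- bounds `1ℚ + 1ℚ` and `η + η` below.
    ‖‖-≤-root : ∀ z j e → 0ℚ ≤ e → seq (∣ z ∣²) j ≤ e * e → ‖ z ‖ j ≤ e + e
    ‖‖-≤-root z j e 0≤e h = ℚₚ.+-mono-≤
      (abs-≤-root a e 0≤e (ℚₚ.≤-trans (p≤p+q (a * a) (b * b) (square-nonNeg b)) h))
      (abs-≤-root b e 0≤e (ℚₚ.≤-trans (p≤p+q (b * b) (a * a) (square-nonNeg a))
        (ℚₚ.≤-trans (ℚₚ.≤-reflexive (ℚₚ.+-comm (b * b) (a * a))) h)))
      where
      a b : ℚ
      a = seq (re z) j
      b = seq (im z) j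

    ∣∣²-^ᶜ : ∀ z n j → seq (∣ z ^ᶜ n ∣²) j ≡ seq (∣ z ∣²) j ^ℚ n
    ∣∣²-^ᶜ z zero    j = refl
    ∣∣²-^ᶜ z (suc n) j = trans
      (eq (seq (re z) j) (seq (im z) j) (seq (re (z ^ᶜ n)) j) (seq (im (z ^ᶜ n)) j))
      (cong (seq (∣ z ∣²) j *_) (∣∣²-^ᶜ z n j))
      where
      eq : ∀ a b c d → (a * c - b * d) * (a * c - b * d) + (a * d + b * c) * (a * d + b * c) ≡ (a * a + b * b) * (c * c + d * d)
      eq = solve-∀ ℚ-ring

    ∣∣²-nonNeg : ∀ z j → 0ℚ ≤ seq (∣ z ∣²) j
    ∣∣²-nonNeg z j = ℚₚ.+-mono-≤ (square-nonNeg (seq (re z) j)) (square-nonNeg (seq (im z) j))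

    -- With x = -2 Re p ≥ 2 δ, the product of |e^p|² and e^x ≥ 1 + 2 δ is 1, on approximants only up
    -- to some η. Half of the margin pays for it: η is chosen with (1 + η) (1 + δ) ≤ 1 + 2 δ.
    ∣exp∣²-contracts : ∀ {p} → NegativeRe p → ∃[ δ ] 0ℚ < δ × Eventually (λ n → seq (∣ exp p ∣²) n * (1ℚ + δ) ≤ 1ℚ)
    ∣exp∣²-contracts {p} (mkNegativeRe δ 0<δ p≤-δ) = δ , 0<δ , from-η (shrink (1ℚ + δ) δ 0≤1+δ 0<δ)
      where
      x : ℝ
      x = -ᴿ (re p +ᴿ re p)
      0≤δ : 0ℚ ≤ δ
      0≤δ = ℚₚ.<⇒≤ 0<δ
      0≤1+δ : 0ℚ ≤ 1ℚ + δ
      0≤1+δ = ℚₚ.+-mono-≤ (ℚₚ.<⇒≤ 0<1) 0≤δ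
      x≥2δ : Eventually (λ n → δ + δ ≤ seq x n)
      x≥2δ = eventually-map (λ n h → subst (_≤ seq x n) (eq δ) (ℚₚ.neg-antimono-≤ (ℚₚ.+-mono-≤ h h))) p≤-δ
        where
        eq : ∀ δ → - (- δ + - δ) ≡ δ + δ
        eq = solve-∀ ℚ-ring
      inverse-∣exp∣² : ofℝ (∣ exp p ∣²) *ᶜ exp (ofℝ x) ≃ᶜ 1ᶜ
      inverse-∣exp∣² = ≃ᶜ-trans (ℂᵣ.*-cong (exp-∣∣² p) (exp-cong (pointwiseᶜ (λ _ → refl) (λ _ → refl))))
        (exp-inverse (ofℝ (re p +ᴿ re p)))
      product<1+η : ∀ η → 0ℚ < η → Eventually (λ n → seq (∣ exp p ∣²) n * seq (re (exp (ofℝ x))) n < 1ℚ + η)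
      product<1+η η 0<η = eventually-map (λ n h → subst (_< 1ℚ + η) (eq (seq (∣ exp p ∣²) n) (seq (re (exp (ofℝ x))) n) (seq (im (exp (ofℝ x))) n))
          (ℚₚ.+-monoʳ-< 1ℚ (ℚₚ.≤-<-trans (p≤∣p∣ _) h)))
        (close (re≃ inverse-∣exp∣²) η 0<η)
        where
        eq : ∀ a b c → 1ℚ + ((a * b - 0ℚ * c) - 1ℚ) ≡ a * b
        eq = solve-∀ ℚ-ring
      cancel-factor : ∀ t y η → 0ℚ ≤ t → 1ℚ + (δ + δ) ≤ y → t * y < 1ℚ + η → (1ℚ + δ) * η ≤ δ → t * (1ℚ + δ) ≤ 1ℚ
      cancel-factor t y η 0≤t 2δ≤y ty<1+η η-small = ℚₚ.*-cancelʳ-≤-pos (1ℚ + (δ + δ)) {{ℚ.positive (ℚₚ.+-mono-<-≤ 0<1 (ℚₚ.+-mono-≤ 0≤δ 0≤δ))}} (begin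
        t * (1ℚ + δ) * (1ℚ + (δ + δ))      ≡⟨ swap′ t (1ℚ + δ) (1ℚ + (δ + δ)) ⟩
        t * (1ℚ + (δ + δ)) * (1ℚ + δ)      ≤⟨ ℚₚ.*-monoʳ-≤-nonNeg (1ℚ + δ) {{ℚ.nonNegative 0≤1+δ}}
                                                (ℚₚ.≤-trans (ℚₚ.*-monoˡ-≤-nonNeg t {{ℚ.nonNegative 0≤t}} 2δ≤y) (ℚₚ.<⇒≤ ty<1+η)) ⟩
        (1ℚ + η) * (1ℚ + δ)                ≡⟨ eq₁ η δ ⟩
        1ℚ + δ + (1ℚ + δ) * η              ≤⟨ ℚₚ.+-monoʳ-≤ (1ℚ + δ) η-small ⟩
        1ℚ + δ + δ                         ≡⟨ eq₂ δ ⟩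
        1ℚ * (1ℚ + (δ + δ))                ∎)
        where
        open ℚₚ.≤-Reasoning
        swap′ : ∀ a b c → a * b * c ≡ a * c * b
        swap′ = solve-∀ ℚ-ring
        eq₁ : ∀ η δ → (1ℚ + η) * (1ℚ + δ) ≡ 1ℚ + δ + (1ℚ + δ) * η
        eq₁ = solve-∀ ℚ-ring
        eq₂ : ∀ δ → 1ℚ + δ + δ ≡ 1ℚ * (1ℚ + (δ + δ))
        eq₂ = solve-∀ ℚ-ring
      from-η : (∃[ η ] 0ℚ < η × (1ℚ + δ) * η < δ) → Eventually (λ n → seq (∣ exp p ∣²) n * (1ℚ + δ) ≤ 1ℚ)
      from-η (η , 0<η , small) = eventually-map
        (λ n (h , k) → cancel-factor (seq (∣ exp p ∣²) n) (seq (re (exp (ofℝ x))) n) η (∣∣²-nonNeg (exp p) n) h k (ℚₚ.<⇒≤ small))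
        (exp-real-≥ x (δ + δ) (ℚₚ.+-mono-≤ 0≤δ 0≤δ) x≥2δ ∧ᵉ product<1+η η 0<η)

    ^ᶜ-≼ : ∀ {z B} → z ≼ B → ∀ n → z ^ᶜ n ≼ B ^ℚ n
    ^ᶜ-≼ z≼B zero    = eventually⇒≼ (0 , λ _ _ → ℚₚ.≤-refl)
    ^ᶜ-≼ z≼B (suc n) = ≼-* z≼B (^ᶜ-≼ z≼B n)

    ½^ℚ : ∀ n → ½ ^ℚ n ≡ ½^ n
    ½^ℚ zero    = refl
    ½^ℚ (suc n) = cong (½ *_) (½^ℚ n)

    module _ {Q : ℂ} {δ : ℚ} (0<δ : 0ℚ < δ) (contracts : Eventually (λ n → seq (∣ Q ∣²) n * (1ℚ + δ) ≤ 1ℚ)) where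

      private
        decays : ∀ n → Eventually (λ j → seq (∣ Q ^ᶜ n ∣²) j * (1ℚ + ι n * δ) ≤ 1ℚ)
        decays n = eventually-map (λ j h → subst (λ t → t * (1ℚ + ι n * δ) ≤ 1ℚ) (sym (∣∣²-^ᶜ Q n j))
          (bernoulli (seq (∣ Q ∣²) j) δ (∣∣²-nonNeg Q j) (ℚₚ.<⇒≤ 0<δ) h n)) contracts

        0≤ιδ : ∀ n → 0ℚ ≤ ι n * δ
        0≤ιδ n = *-nonNeg (ι n) δ (ι-mono {0} {n} ℕ.z≤n) (ℚₚ.<⇒≤ 0<δ)

      power-≼2 : ∀ n → Q ^ᶜ n ≼ 1ℚ + 1ℚ
      power-≼2 n = eventually⇒≼ (eventually-map (λ j h → ‖‖-≤-root (Q ^ᶜ n) j 1ℚ (ℚₚ.<⇒≤ 0<1)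
        (ℚₚ.≤-trans (subst (_≤ seq (∣ Q ^ᶜ n ∣²) j * (1ℚ + ι n * δ)) (ℚₚ.*-identityʳ _)
          (ℚₚ.*-monoˡ-≤-nonNeg (seq (∣ Q ^ᶜ n ∣²) j) {{ℚ.nonNegative (∣∣²-nonNeg (Q ^ᶜ n) j)}} (p≤p+q 1ℚ (ι n * δ) (0≤ιδ n)))) h))
        (decays n))

      -- For M ≥ 1 / (δ η²) the squared modulus of the M-th power, at most 1 / (1 + M δ), is below
      -- η².
      power-small : ∀ η → 0ℚ < η → ∃[ M ] Q ^ᶜ M ≼ η + η
      power-small η 0<η = from-inverse (inverse (δ * (η * η)) (*-pos δ (η * η) 0<δ 0<η²))
        where
        0<η² : 0ℚ < η * η
        0<η² = *-pos η η 0<η 0<η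
        from-arch : ∀ e → e * (δ * (η * η)) ≡ 1ℚ → (∃[ M ] e ≤ ι M) → ∃[ M ] Q ^ᶜ M ≼ η + η
        from-arch e e-inv (M , e≤M) = M , eventually⇒≼ (eventually-map
          (λ j h → ‖‖-≤-root (Q ^ᶜ M) j η (ℚₚ.<⇒≤ 0<η) (ℚₚ.*-cancelʳ-≤-pos (1ℚ + ι M * δ)
            {{ℚ.positive (ℚₚ.+-mono-<-≤ 0<1 (0≤ιδ M))}} (ℚₚ.≤-trans h 1≤)))
          (decays M))
          where
          open ℚₚ.≤-Reasoning
          eq : ∀ i d x → i * (d * x) ≡ x * (i * d)
          eq = solve-∀ ℚ-ring
          1≤ : 1ℚ ≤ η * η * (1ℚ + ι M * δ)
          1≤ = begin
            1ℚ                           ≡⟨ e-inv ⟨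
            e * (δ * (η * η))            ≤⟨ ℚₚ.*-monoʳ-≤-nonNeg (δ * (η * η)) {{ℚ.nonNegative (ℚₚ.<⇒≤ (*-pos δ (η * η) 0<δ 0<η²))}} e≤M ⟩
            ι M * (δ * (η * η))          ≡⟨ eq (ι M) δ (η * η) ⟩
            η * η * (ι M * δ)            ≤⟨ ℚₚ.*-monoˡ-≤-nonNeg (η * η) {{ℚ.nonNegative (ℚₚ.<⇒≤ 0<η²)}}
                                              (ℚₚ.≤-trans (ℚₚ.≤-reflexive (sym (ℚₚ.+-identityˡ (ι M * δ)))) (ℚₚ.+-monoˡ-≤ (ι M * δ) (ℚₚ.<⇒≤ 0<1))) ⟩
            η * η * (1ℚ + ι M * δ)       ∎
        from-inverse : (∃[ e ] e * (δ * (η * η)) ≡ 1ℚ) → ∃[ M ] Q ^ᶜ M ≼ η + η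
        from-inverse (e , e-inv) = from-arch e e-inv (archimedean e)

    -- For n ≥ M split n² = n (n - M) + n M; the finitely many smaller n are absorbed by the constant.
    quadratic-decay : ∀ {Q W K M} → (∀ n → Q ^ᶜ n ≼ 1ℚ + 1ℚ) → 1ℚ ≤ K → W ≼ K → Q ^ᶜ M *ᶜ W ≼ ½ →
      ∀ n → Q ^ᶜ (n ℕ.* n) *ᶜ W ^ᶜ n ≼ (1ℚ + 1ℚ) * (K + K) ^ℚ M * ½^ n
    quadratic-decay {Q} {W} {K} {M} Q≼2 1≤K W≼K QW≼½ n = from-order (ℕₚ.≤-total M n)
      where
      0≤2 : 0ℚ ≤ 1ℚ + 1ℚ
      0≤2 = ℚₚ.+-mono-≤ (ℚₚ.<⇒≤ 0<1) (ℚₚ.<⇒≤ 0<1)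
      0≤K : 0ℚ ≤ K
      0≤K = ℚₚ.≤-trans (ℚₚ.<⇒≤ 0<1) 1≤K
      1≤2K : 1ℚ ≤ K + K
      1≤2K = ℚₚ.≤-trans 1≤K (p≤p+q K K 0≤K)
      open ℚₚ.≤-Reasoning
      from-order : M ℕ.≤ n ⊎ n ℕ.≤ M → Q ^ᶜ (n ℕ.* n) *ᶜ W ^ᶜ n ≼ (1ℚ + 1ℚ) * (K + K) ^ℚ M * ½^ n
      from-order (inj₁ M≤n) = ≼-mono (begin
          (1ℚ + 1ℚ) * ½ ^ℚ n                         ≡⟨ cong ((1ℚ + 1ℚ) *_) (trans (½^ℚ n) (sym (ℚₚ.*-identityˡ (½^ n)))) ⟩
          (1ℚ + 1ℚ) * (1ℚ * ½^ n)                    ≤⟨ ℚₚ.*-monoˡ-≤-nonNeg (1ℚ + 1ℚ) {{ℚ.nonNegative 0≤2}}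
                                                         (ℚₚ.*-monoʳ-≤-nonNeg (½^ n) {{ℚ.nonNegative (½^-nonNeg n)}} (^ℚ-mono 1≤2K {0} {M} ℕ.z≤n)) ⟩
          (1ℚ + 1ℚ) * ((K + K) ^ℚ M * ½^ n)          ≡⟨ ℚₚ.*-assoc (1ℚ + 1ℚ) ((K + K) ^ℚ M) (½^ n) ⟨
          (1ℚ + 1ℚ) * (K + K) ^ℚ M * ½^ n            ∎)
        (≼-cong (≃ᶜ-sym split) (≼-* (Q≼2 (n ℕ.* (n ℕ.∸ M))) (^ᶜ-≼ QW≼½ n)))
        where
        exponent : n ℕ.* n ≡ n ℕ.* (n ℕ.∸ M) ℕ.+ n ℕ.* M
        exponent = trans (cong (n ℕ.*_) (sym (ℕₚ.m∸n+n≡m M≤n))) (ℕₚ.*-distribˡ-+ n (n ℕ.∸ M) M)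
        split : Q ^ᶜ (n ℕ.* n) *ᶜ W ^ᶜ n ≃ᶜ Q ^ᶜ (n ℕ.* (n ℕ.∸ M)) *ᶜ (Q ^ᶜ M *ᶜ W) ^ᶜ n
        split = ≃ᶜ-trans
          (ℂᵣ.*-congʳ (≃ᶜ-trans (≡⇒≃ᶜ (cong (Q ^ᶜ_) exponent))
            (≃ᶜ-trans (^ᶜ-+ Q (n ℕ.* (n ℕ.∸ M)) (n ℕ.* M)) (ℂᵣ.*-congˡ (^ᶜ-* Q n M)))))
          (≃ᶜ-trans (ℂᵣ.*-assoc _ _ _) (ℂᵣ.*-congˡ (≃ᶜ-sym (^ᶜ-distrib (Q ^ᶜ M) W n))))
      -- Kⁿ = (2K)ⁿ ½ⁿ, and (2K)ⁿ ≤ (2K)ᴹ because 2K ≥ 1.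
      from-order (inj₂ n≤M) = ≼-mono (begin
          (1ℚ + 1ℚ) * K ^ℚ n                         ≡⟨ cong ((1ℚ + 1ℚ) *_) (double-^ℚ K n) ⟩
          (1ℚ + 1ℚ) * ((K + K) ^ℚ n * ½^ n)          ≤⟨ ℚₚ.*-monoˡ-≤-nonNeg (1ℚ + 1ℚ) {{ℚ.nonNegative 0≤2}}
                                                         (ℚₚ.*-monoʳ-≤-nonNeg (½^ n) {{ℚ.nonNegative (½^-nonNeg n)}} (^ℚ-mono 1≤2K n≤M)) ⟩
          (1ℚ + 1ℚ) * ((K + K) ^ℚ M * ½^ n)          ≡⟨ ℚₚ.*-assoc (1ℚ + 1ℚ) ((K + K) ^ℚ M) (½^ n) ⟨
          (1ℚ + 1ℚ) * (K + K) ^ℚ M * ½^ n            ∎)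
        (≼-* (Q≼2 (n ℕ.* n)) (^ᶜ-≼ W≼K n))

    square-abs-ℤ : ∀ s → s ℤ.* s ≡ + (ℤ.∣ s ∣ ℕ.* ℤ.∣ s ∣)
    square-abs-ℤ (+ n)    = sym (ℤₚ.pos-* n n)
    square-abs-ℤ -[1+ n ] = refl

    theta-term-power : ∀ p z s → ∃[ w ] w ∈ frequencies z ×
      theta-term p z s ≃ᶜ exp p ^ᶜ (ℤ.∣ s ∣ ℕ.* ℤ.∣ s ∣) *ᶜ exp w ^ᶜ ℤ.∣ s ∣
    theta-term-power p z s = let (w , w∈ , eq) = linear s in w , w∈ ,
      ℂᵣ.*-cong (≃ᶜ-trans (≡⇒≃ᶜ (cong (λ t → exp (p *ᶜ ofℤ t)) (square-abs-ℤ s))) (exp-*ℕ p (ℤ.∣ s ∣ ℕ.* ℤ.∣ s ∣))) eq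
      where
      w₊ : ℂ
      w₊ = ofℤ (+ 2) *ᶜ 𝕚 *ᶜ z
      linear : ∀ s → ∃[ w ] w ∈ frequencies z × exp (w₊ *ᶜ ofℤ s) ≃ᶜ exp w ^ᶜ ℤ.∣ s ∣
      linear (+ n)    = w₊ , here refl , exp-*ℕ w₊ n
      linear -[1+ n ] = -ᶜ w₊ , there (here refl) ,
        ≃ᶜ-trans (exp-*-neg w₊ (+ suc n)) (exp-*ℕ (-ᶜ w₊) (suc n))

    -- One M must serve both signs of s, hence a single K ≥ 1 above the norms of e^(2iz) and
    -- e^(-2iz). The constant C is then 2 (2K)ᴹ.
    theta-term-≼ : ∀ {p} → NegativeRe p → ∀ z → ∃[ C ] 0ℚ ≤ C × (∀ s → theta-term p z s ≼ C * ½^ ℤ.∣ s ∣)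
    theta-term-≼ {p} neg z = from-contraction (∣exp∣²-contracts neg)
      where
      w₊ : ℂ
      w₊ = ofℤ (+ 2) *ᶜ 𝕚 *ᶜ z
      module _ (Q≼2 : ∀ n → exp p ^ᶜ n ≼ 1ℚ + 1ℚ) (Q-small : ∀ η → 0ℚ < η → ∃[ M ] exp p ^ᶜ M ≼ η + η)
               (K : ℚ) (1≤K : 1ℚ ≤ K) (w≼K : ∀ w → w ∈ frequencies z → exp w ≼ K) where
        0≤K : 0ℚ ≤ K
        0≤K = ℚₚ.≤-trans (ℚₚ.<⇒≤ 0<1) 1≤K
        from-M : ∀ η → K * η < ½ * ½ → (∃[ M ] exp p ^ᶜ M ≼ η + η) → ∃[ C ] 0ℚ ≤ C × (∀ s → theta-term p z s ≼ C * ½^ ℤ.∣ s ∣)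
        from-M η small (M , QM≼2η) = (1ℚ + 1ℚ) * (K + K) ^ℚ M ,
          *-nonNeg (1ℚ + 1ℚ) _ (ℚₚ.+-mono-≤ (ℚₚ.<⇒≤ 0<1) (ℚₚ.<⇒≤ 0<1)) (^ℚ-nonNeg (ℚₚ.+-mono-≤ 0≤K 0≤K) M) ,
          λ s → let (w , w∈ , eq) = theta-term-power p z s in
            ≼-cong (≃ᶜ-sym eq) (quadratic-decay {M = M} Q≼2 1≤K (w≼K w w∈) (≼-mono half (≼-* QM≼2η (w≼K w w∈))) ℤ.∣ s ∣)
          where
          eq′ : ∀ η K → (η + η) * K ≡ K * η + K * η
          eq′ = solve-∀ ℚ-ring
          half : (η + η) * K ≤ ½
          half = ℚₚ.≤-trans (ℚₚ.≤-reflexive (eq′ η K)) (ℚₚ.<⇒≤ (ℚₚ.+-mono-< small small))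
        from-η : (∃[ η ] 0ℚ < η × K * η < ½ * ½) → ∃[ C ] 0ℚ ≤ C × (∀ s → theta-term p z s ≼ C * ½^ ℤ.∣ s ∣)
        from-η (η , 0<η , small) = from-M η small (Q-small η 0<η)
        conclude : ∃[ C ] 0ℚ ≤ C × (∀ s → theta-term p z s ≼ C * ½^ ℤ.∣ s ∣)
        -- K * η < ¼ gives (η + η) * K ≤ ½, the ratio that `quadratic-decay` asks for.
        conclude = from-η (shrink K (½ * ½) 0≤K (half-pos ½ 0<½))
      from-contraction : (∃[ δ ] 0ℚ < δ × Eventually (λ n → seq (∣ exp p ∣²) n * (1ℚ + δ) ≤ 1ℚ)) →
        ∃[ C ] 0ℚ ≤ C × (∀ s → theta-term p z s ≼ C * ½^ ℤ.∣ s ∣)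
      from-contraction (δ , 0<δ , contracts) =
        let (K₊ , h₊) = ≼-bounded (exp w₊)
            (K₋ , h₋) = ≼-bounded (exp (-ᶜ w₊))
            0≤K₊ = ≼-nonNeg h₊
            0≤K₋ = ≼-nonNeg h₋
        in conclude (power-≼2 {exp p} {δ} 0<δ contracts) (power-small {exp p} {δ} 0<δ contracts) (1ℚ + (K₊ + K₋))
          (p≤p+q 1ℚ (K₊ + K₋) (ℚₚ.+-mono-≤ 0≤K₊ 0≤K₋))
          λ { _ (here refl) → ≼-mono (subst₂ _≤_ (ℚₚ.+-identityˡ K₊) refl (ℚₚ.+-mono-≤ (ℚₚ.<⇒≤ 0<1) (p≤p+q K₊ K₋ 0≤K₋))) h₊
            ; _ (there (here refl)) → ≼-mono (subst₂ _≤_ (trans (ℚₚ.+-identityˡ _) (ℚₚ.+-identityˡ K₋)) refl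
                (ℚₚ.+-mono-≤ (ℚₚ.<⇒≤ 0<1) (ℚₚ.+-monoˡ-≤ K₋ 0≤K₊))) h₋ }

  -- Summation over the even and the odd integers

  interval : ℕ → List ℤ
  interval zero    = + 0 ∷ []
  interval (suc n) = + suc n ∷ -[1+ n ] ∷ interval n

  even odd : ℤ → ℤ
  even j = + 2 ℤ.* j
  odd  j = + 2 ℤ.* j ℤ.+ + 1

  -- It turns decay in |φ j| into decay in |j|, the quantity that intervals control.
  record Dominating (φ : ℤ → ℤ) : Set where
    constructor mkDominating
    field
      dominates : ∀ j → ℤ.∣ j ∣ ℕ.≤ ℤ.∣ φ j ∣
  open Dominating public

  abstract

    ∈-interval : ∀ n {i} → i ∈ interval n → ℤ.∣ i ∣ ℕ.≤ n
    ∈-interval zero    (here refl)         = ℕ.z≤n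
    ∈-interval (suc n) (here refl)         = ℕₚ.≤-refl
    ∈-interval (suc n) (there (here refl)) = ℕₚ.≤-refl
    ∈-interval (suc n) (there (there p))   = ℕₚ.m≤n⇒m≤1+n (∈-interval n p)

    interval-unique : ∀ n → Unique (interval n)
    interval-unique zero    = All.[] AllPairs.∷ AllPairs.[]
    interval-unique (suc n) =
      ((λ ()) All.∷ All.tabulate λ { p refl → ℕₚ.<-irrefl refl (∈-interval n p) }) AllPairs.∷
      (All.tabulate (λ { p refl → ℕₚ.<-irrefl refl (∈-interval n p) }) AllPairs.∷ interval-unique n)

    interval-covers : ∀ i → i ∈ interval ℤ.∣ i ∣
    interval-covers (+ zero)  = here refl
    interval-covers (+ suc n) = here refl
    interval-covers -[1+ n ]  = there (here refl)

  <ℤ : Exhaustion ℤ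
  <ℤ = record
    { part = interval ; unique = interval-unique ; increasing = λ n i∈ → there (there i∈)
    ; covers = λ i → ℤ.∣ i ∣ , interval-covers i }

  abstract

    ∣even∣ : ∀ j → ℤ.∣ even j ∣ ≡ ℤ.∣ j ∣ ℕ.+ ℤ.∣ j ∣
    ∣even∣ j = trans (ℤₚ.abs-* (+ 2) j) (cong (ℤ.∣ j ∣ ℕ.+_) (ℕₚ.+-identityʳ ℤ.∣ j ∣))

    even-dominating : Dominating even
    even-dominating = mkDominating λ j → subst (ℤ.∣ j ∣ ℕ.≤_) (sym (∣even∣ j)) (ℕₚ.m≤m+n ℤ.∣ j ∣ ℤ.∣ j ∣)

    -- 2 |j| = |(2j + 1) - 1| ≤ |2j + 1| + 1, which leaves |j| ≤ |2j + 1| also for j = -1, where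
    -- equality holds.
    odd-dominating : Dominating odd
    odd-dominating = mkDominating λ j → lemma ℤ.∣ j ∣ (subst (ℕ._≤ ℤ.∣ odd j ∣ ℕ.+ 1)
      (trans (cong ℤ.∣_∣ (eq (+ 2 ℤ.* j))) (∣even∣ j)) (ℤₚ.∣i-j∣≤∣i∣+∣j∣ (odd j) (+ 1)))
      where
      eq : ∀ k → k ℤ.+ + 1 ℤ.- + 1 ≡ k
      eq = ℤ-Solver.solve-∀
      lemma : ∀ n {m} → n ℕ.+ n ℕ.≤ m ℕ.+ 1 → n ℕ.≤ m
      lemma zero    _ = ℕ.z≤n
      lemma (suc n) {m} h = ℕₚ.≤-trans (ℕₚ.m≤n+m (suc n) n)
        (ℕ.s≤s⁻¹ (subst (suc n ℕ.+ suc n ℕ.≤_) (ℕₚ.+-comm m 1) h))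

    even-injective : ∀ {j k} → even j ≡ even k → j ≡ k
    even-injective {j} {k} = ℤₚ.*-cancelˡ-≡ (+ 2) j k

    odd-injective : ∀ {j k} → odd j ≡ odd k → j ≡ k
    odd-injective {j} {k} eq = even-injective (trans (sym (cancel (even j))) (trans (cong (ℤ._- + 1) eq) (cancel (even k))))
      where
      cancel : ∀ k → k ℤ.+ + 1 ℤ.- + 1 ≡ k
      cancel = ℤ-Solver.solve-∀

    even≢odd : ∀ j k → even j ≢ odd k
    even≢odd j k eq = 2n≢1 ℤ.∣ j ℤ.- k ∣ (trans (sym (∣even∣ (j ℤ.- k))) (cong ℤ.∣_∣ (trans (eq₁ j k) (trans (cong (ℤ._- even k) eq) (eq₂ (even k))))))
      where
      eq₁ : ∀ j k → + 2 ℤ.* (j ℤ.- k) ≡ + 2 ℤ.* j ℤ.- + 2 ℤ.* k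
      eq₁ = ℤ-Solver.solve-∀
      eq₂ : ∀ k → k ℤ.+ + 1 ℤ.- k ≡ + 1
      eq₂ = ℤ-Solver.solve-∀
      2n≢1 : ∀ n → n ℕ.+ n ≢ 1
      2n≢1 zero    ()
      2n≢1 (suc n) p with trans (sym (ℕₚ.+-suc n n)) (ℕₚ.suc-injective p)
      ... | ()

    parity : ∀ i → ∃[ k ] (i ≡ even k ⊎ i ≡ odd k)
    parity i = q , from-remainder (i ℤ-DivMod.%ℕ 2) (ℤ-DivMod.n%ℕd<d i 2) (ℤ-DivMod.a≡a%ℕn+[a/ℕn]*n i 2)
      where
      q : ℤ
      q = i ℤ-DivMod./ℕ 2
      eq₀ : ∀ q → + 0 ℤ.+ q ℤ.* + 2 ≡ + 2 ℤ.* q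
      eq₀ = ℤ-Solver.solve-∀
      eq₁ : ∀ q → + 1 ℤ.+ q ℤ.* + 2 ≡ + 2 ℤ.* q ℤ.+ + 1
      eq₁ = ℤ-Solver.solve-∀
      from-remainder : ∀ r → r ℕ.< 2 → i ≡ + r ℤ.+ q ℤ.* + 2 → i ≡ even q ⊎ i ≡ odd q
      from-remainder zero          _ h = inj₁ (trans h (eq₀ q))
      from-remainder (suc zero)    _ h = inj₂ (trans h (eq₁ q))
      from-remainder (suc (suc r)) (ℕ.s≤s (ℕ.s≤s ())) h

    -- While x n increases, x n + 2 C ½ⁿ decreases. All terms beyond N therefore lie in an interval
    -- of length 2 C ½ᴺ starting at x N.
    geometric-cauchy : ∀ C (x : ℕ → ℚ) → 0ℚ ≤ C → (∀ n → x n ≤ x (suc n)) → (∀ n → x (suc n) ≤ x n + C * ½^ n) → IsCauchy x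
    geometric-cauchy C x 0≤C increasing bounded = mkCauchy λ ε 0<ε →
      let (N , h) = ½^-null (C + C) ε (ℚₚ.+-mono-≤ 0≤C 0≤C) 0<ε in N , λ m n N≤m N≤n →
        ℚₚ.≤-<-trans (within (x N) ((C + C) * ½^ N) (x m) (x n) (lower N≤m) (upper N≤m) (lower N≤n) (upper N≤n)) (h N ℕₚ.≤-refl)
      where
      lower : ∀ {N n} → N ℕ.≤ n → x N ≤ x n
      lower {N} {n} N≤n = subst (λ k → x N ≤ x k) (ℕₚ.m∸n+n≡m N≤n) (go (n ℕ.∸ N))
        where
        go : ∀ k → x N ≤ x (k ℕ.+ N)
        go zero    = ℚₚ.≤-refl
        go (suc k) = ℚₚ.≤-trans (go k) (increasing (k ℕ.+ N))
      step : ∀ n → x (suc n) + (C + C) * ½^ (suc n) ≤ x n + (C + C) * ½^ n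
      step n = ℚₚ.≤-trans (ℚₚ.+-monoˡ-≤ ((C + C) * ½^ (suc n)) (bounded n)) (ℚₚ.≤-reflexive (eq (x n) C (½^ n)))
        where
        eq : ∀ x C h → x + C * h + (C + C) * (½ * h) ≡ x + (C + C) * h
        eq = solve-∀ ℚ-ring
      upper : ∀ {N n} → N ℕ.≤ n → x n ≤ x N + (C + C) * ½^ N
      upper {N} {n} N≤n = ℚₚ.≤-trans (p≤p+q (x n) ((C + C) * ½^ n) (*-nonNeg (C + C) (½^ n) (ℚₚ.+-mono-≤ 0≤C 0≤C) (½^-nonNeg n)))
        (subst (λ k → x k + (C + C) * ½^ k ≤ x N + (C + C) * ½^ N) (ℕₚ.m∸n+n≡m N≤n) (go (n ℕ.∸ N)))
        where
        go : ∀ k → x (k ℕ.+ N) + (C + C) * ½^ (k ℕ.+ N) ≤ x N + (C + C) * ½^ N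
        go zero    = ℚₚ.≤-refl
        go (suc k) = ℚₚ.≤-trans (step (k ℕ.+ N)) (go k)
      half-within : ∀ a d p q → a ≤ q → p ≤ a + d → p - q ≤ d
      half-within a d p q a≤q p≤ = subst (p - q ≤_) (eq a d) (ℚₚ.+-mono-≤ p≤ (ℚₚ.neg-antimono-≤ a≤q))
        where
        eq : ∀ a d → a + d - a ≡ d
        eq = solve-∀ ℚ-ring
      within : ∀ a d p q → a ≤ p → p ≤ a + d → a ≤ q → q ≤ a + d → ∣ p - q ∣ ≤ d
      within a d p q a≤p p≤ a≤q q≤ = from (ℚₚ.∣p∣≡p∨∣p∣≡-p (p - q))
        where
        from : ∣ p - q ∣ ≡ p - q ⊎ ∣ p - q ∣ ≡ - (p - q) → ∣ p - q ∣ ≤ d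
        from (inj₁ e) = subst (_≤ d) (sym e) (half-within a d p q a≤q p≤)
        from (inj₂ e) = subst (_≤ d) (trans (sym (sub-swap p q)) (sym e)) (half-within a d q p a≤p q≤)

    weights-cauchy : ∀ C {φ} → 0ℚ ≤ C → Dominating φ → IsCauchy (λ n → ∑ℚ.∑[ interval n ] (λ j → C * ½^ ℤ.∣ φ j ∣))
    weights-cauchy C {φ} 0≤C dom = geometric-cauchy C x 0≤C increasing bounded
      where
      w : ℤ → ℚ
      w j = C * ½^ ℤ.∣ φ j ∣
      x : ℕ → ℚ
      x n = ∑ℚ.∑[ interval n ] w
      w-nonNeg : ∀ j → 0ℚ ≤ w j
      w-nonNeg j = *-nonNeg C (½^ ℤ.∣ φ j ∣) 0≤C (½^-nonNeg ℤ.∣ φ j ∣)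
      w≤ : ∀ j → w j ≤ C * ½^ ℤ.∣ j ∣
      w≤ j = ℚₚ.*-monoˡ-≤-nonNeg C {{ℚ.nonNegative 0≤C}} (½^-antitone (dominates dom j))
      to-back : ∀ a b c → a + (b + c) ≡ c + (a + b)
      to-back = solve-∀ ℚ-ring
      increasing : ∀ n → x n ≤ x (suc n)
      increasing n = subst (x n ≤_) (sym (to-back (w (+ suc n)) (w -[1+ n ]) (x n)))
        (p≤p+q (x n) _ (ℚₚ.+-mono-≤ (w-nonNeg (+ suc n)) (w-nonNeg -[1+ n ])))
      -- Each of the two new terms, at n + 1 and -(n + 1), weighs at most C ½ⁿ⁺¹.
      bounded : ∀ n → x (suc n) ≤ x n + C * ½^ n
      bounded n = subst (_≤ x n + C * ½^ n) (sym (to-back (w (+ suc n)) (w -[1+ n ]) (x n)))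
        (ℚₚ.+-monoʳ-≤ (x n) (ℚₚ.≤-trans (ℚₚ.+-mono-≤ (w≤ (+ suc n)) (w≤ -[1+ n ])) (ℚₚ.≤-reflexive (eq C (½^ n)))))
        where
        eq : ∀ C h → C * (½ * h) + C * (½ * h) ≡ C * h
        eq = solve-∀ ℚ-ring

  module Lattice {p : ℂ} (neg : NegativeRe p) (z : ℂ) where

    C : ℚ
    C = proj₁ (theta-term-≼ neg z)

    0≤C : 0ℚ ≤ C
    0≤C = proj₁ (proj₂ (theta-term-≼ neg z))

    weight : ℤ → ℚ
    weight s = C * ½^ ℤ.∣ s ∣

    term-≼ : ∀ s → theta-term p z s ≼ weight s
    term-≼ = proj₂ (proj₂ (theta-term-≼ neg z))

    module _ {φ : ℤ → ℤ} (dom : Dominating φ) where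

      private
        module D = Dominated <ℤ (λ j → theta-term p z (φ j)) (λ j → weight (φ j)) (λ j → term-≼ (φ j)) (weights-cauchy C 0≤C dom)

      abstract
        ∑-limit : ℂ
        ∑-limit = proj₁ (complete _ D.partial-cauchy)

        ∑-limit-⟶ : (λ n → ∑ᶜ.∑[ interval n ] (λ j → theta-term p z (φ j))) ⟶ ∑-limit
        ∑-limit-⟶ = proj₂ (complete _ D.partial-cauchy)

  open Lattice using (∑-limit; ∑-limit-⟶) public

  evenSum oddSum : {p : ℂ} → NegativeRe p → ℂ → ℂ
  evenSum neg z = ∑-limit neg z even-dominating
  oddSum  neg z = ∑-limit neg z odd-dominating

  -- Applied to ℤ, split into even and odd integers, and to ℤ × ℤ, split by the parity of m - n.
  record Halves {I I′ : Set} (φ ψ : I → I′) : Set where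
    field
      φ-injective : ∀ {i j} → φ i ≡ φ j → i ≡ j
      ψ-injective : ∀ {i j} → ψ i ≡ ψ j → i ≡ j
      disjoint    : ∀ i j → φ i ≢ ψ j
      surjective  : ∀ k → ∃[ i ] (k ≡ φ i ⊎ k ≡ ψ i)

  both-halves : ∀ {I I′ : Set} {φ ψ : I → I′} → Halves φ ψ → Exhaustion I → Exhaustion I′
  both-halves {φ = φ} {ψ} H X = record
    { part       = λ n → map φ (part n) ++ map ψ (part n)
    ; unique     = λ n → Uniqueₚ.++⁺ (Uniqueₚ.map⁺ φ-injective (unique n)) (Uniqueₚ.map⁺ ψ-injective (unique n))
                     λ (p , q) → let (i , _ , k≡φi) = ∈ₚ.∈-map⁻ φ p ; (j , _ , k≡ψj) = ∈ₚ.∈-map⁻ ψ q in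
                       disjoint i j (trans (sym k≡φi) k≡ψj)
    ; increasing = λ n {k} k∈ → grow n k (∈ₚ.∈-++⁻ (map φ (part n)) k∈)
    ; covers     = λ k → cover k (surjective k) }
    where
    open Halves H
    open Exhaustion X
    grow : ∀ n k → k ∈ map φ (part n) ⊎ k ∈ map ψ (part n) → k ∈ map φ (part (suc n)) ++ map ψ (part (suc n))
    grow n k (inj₁ p) = let (i , i∈ , k≡φi) = ∈ₚ.∈-map⁻ φ p in
      subst (_∈ _) (sym k≡φi) (∈ₚ.∈-++⁺ˡ (∈ₚ.∈-map⁺ φ (increasing n i∈)))
    grow n k (inj₂ p) = let (i , i∈ , k≡ψi) = ∈ₚ.∈-map⁻ ψ p in
      subst (_∈ _) (sym k≡ψi) (∈ₚ.∈-++⁺ʳ (map φ (part (suc n))) (∈ₚ.∈-map⁺ ψ (increasing n i∈)))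
    cover : ∀ k → ∃[ i ] (k ≡ φ i ⊎ k ≡ ψ i) → ∃[ n ] k ∈ map φ (part n) ++ map ψ (part n)
    cover _ (i , inj₁ refl) = let (n , i∈) = covers i in n , ∈ₚ.∈-++⁺ˡ (∈ₚ.∈-map⁺ φ i∈)
    cover _ (i , inj₂ refl) = let (n , i∈) = covers i in n , ∈ₚ.∈-++⁺ʳ (map φ (part n)) (∈ₚ.∈-map⁺ ψ i∈)

  module _ {I I′ : Set} {φ ψ : I → I′} (H : Halves φ ψ) (X : Exhaustion I) where
    open Exhaustion X using (part)

    -- The images of the same part under φ and ψ, concatenated, exhaust the whole index set; along
    -- them the sums of the terms and of the weights are the sums over the two halves added.
    halves-HasSum : (f : I′ → ℂ) (a : I′ → ℚ) → (∀ k → f k ≼ a k) →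
      IsCauchy (λ n → ∑ℚ.∑[ part n ] (λ i → a (φ i))) → IsCauchy (λ n → ∑ℚ.∑[ part n ] (λ i → a (ψ i))) →
      ∀ {s t} → (λ n → ∑ᶜ.∑[ part n ] (λ i → f (φ i))) ⟶ s → (λ n → ∑ᶜ.∑[ part n ] (λ i → f (ψ i))) ⟶ t →
      HasSum f (s +ᶜ t)
    halves-HasSum f a f≼a aφ-cauchy aψ-cauchy f⟶s f⟶t = D.⟶⇒HasSum
      (⟶-cong (λ n → ≃ᶜ-sym (≃ᶜ-trans (∑ᶜ.∑-++ (map φ (part n)) (map ψ (part n)) f)
          (ℂᵣ.+-cong (∑ᶜ.∑-map φ (part n) f) (∑ᶜ.∑-map ψ (part n) f))))
        ≃ᶜ-refl (⟶-+ f⟶s f⟶t))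
      where
      a-cauchy : IsCauchy (λ n → ∑ℚ.∑[ map φ (part n) ++ map ψ (part n) ] a)
      a-cauchy = cauchy-resp (λ n → sym (trans (∑ℚ.∑-++ (map φ (part n)) (map ψ (part n)) a)
          (cong₂ _+_ (∑ℚ.∑-map φ (part n) a) (∑ℚ.∑-map ψ (part n) a))))
        (cauchy-+ aφ-cauchy aψ-cauchy)
      module D = Dominated (both-halves H X) f a f≼a a-cauchy

  module _ {p : ℂ} (p-neg : NegativeRe p) (u : ℂ) {q : ℂ} (q-neg : NegativeRe q) (v : ℂ) where

    private
      module U = Lattice p-neg u
      module V = Lattice q-neg v

    product-term : (φ ψ : ℤ → ℤ) → ℤ × ℤ → ℂ
    product-term φ ψ (j , k) = theta-term p u (φ j) *ᶜ theta-term q v (ψ k)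

    product-weight : (φ ψ : ℤ → ℤ) → ℤ × ℤ → ℚ
    product-weight φ ψ (j , k) = U.weight (φ j) * V.weight (ψ k)

    theta-product-⟶ : ∀ {φ ψ} (φ-dom : Dominating φ) (ψ-dom : Dominating ψ) →
      (λ n → ∑ᶜ.∑[ cartesianProduct (interval n) (interval n) ] (product-term φ ψ))
        ⟶ ∑-limit p-neg u φ-dom *ᶜ ∑-limit q-neg v ψ-dom
    theta-product-⟶ {φ} {ψ} φ-dom ψ-dom = ⟶-cong
      (λ n → ≃ᶜ-sym (∑ᶜ.∑-product (interval n) (interval n) (λ j → theta-term p u (φ j)) (λ k → theta-term q v (ψ k))))
      ≃ᶜ-refl (⟶-* (U.∑-limit-⟶ φ-dom) (V.∑-limit-⟶ ψ-dom))

    weight-product-cauchy : ∀ {φ ψ} → Dominating φ → Dominating ψ →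
      IsCauchy (λ n → ∑ℚ.∑[ cartesianProduct (interval n) (interval n) ] (product-weight φ ψ))
    weight-product-cauchy {φ} {ψ} φ-dom ψ-dom = cauchy-resp
      (λ n → sym (∑ℚ.∑-product (interval n) (interval n) (λ j → U.weight (φ j)) (λ k → V.weight (ψ k))))
      (cauchy-* (weights-cauchy U.C U.0≤C φ-dom) (weights-cauchy V.C V.0≤C ψ-dom))

    -- Here χ is the change of variables from (m , n) to (s , t). On each half it becomes a product
    -- map φ × ψ in the parameters (j , k), so the double sum over that half factors into two
    -- one-dimensional ones.
    theta-product-HasSum : (f : ℤ × ℤ → ℂ) (χ : ℤ × ℤ → ℤ × ℤ) →
      (∀ i → f i ≃ᶜ theta-term p u (proj₁ (χ i)) *ᶜ theta-term q v (proj₂ (χ i))) →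
      ∀ {h₁ h₂} → Halves h₁ h₂ → ∀ {φ₁ ψ₁ φ₂ ψ₂}
      (φ₁-dom : Dominating φ₁) (ψ₁-dom : Dominating ψ₁) (φ₂-dom : Dominating φ₂) (ψ₂-dom : Dominating ψ₂) →
      (∀ j k → χ (h₁ (j , k)) ≡ (φ₁ j , ψ₁ k)) → (∀ j k → χ (h₂ (j , k)) ≡ (φ₂ j , ψ₂ k)) →
      HasSum f (∑-limit p-neg u φ₁-dom *ᶜ ∑-limit q-neg v ψ₁-dom +ᶜ ∑-limit p-neg u φ₂-dom *ᶜ ∑-limit q-neg v ψ₂-dom)
    theta-product-HasSum f χ f≃ {h₁} {h₂} H {φ₁} {ψ₁} {φ₂} {ψ₂} φ₁-dom ψ₁-dom φ₂-dom ψ₂-dom χh₁ χh₂ =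
      halves-HasSum H (<ℤ ⊗ <ℤ) f a f≼a
        (cauchy-piece {h₁} φ₁-dom ψ₁-dom χh₁) (cauchy-piece {h₂} φ₂-dom ψ₂-dom χh₂)
        {∑-limit p-neg u φ₁-dom *ᶜ ∑-limit q-neg v ψ₁-dom} {∑-limit p-neg u φ₂-dom *ᶜ ∑-limit q-neg v ψ₂-dom}
        (limit-piece {h₁} φ₁-dom ψ₁-dom χh₁) (limit-piece {h₂} φ₂-dom ψ₂-dom χh₂)
      where
      a : ℤ × ℤ → ℚ
      a i = U.weight (proj₁ (χ i)) * V.weight (proj₂ (χ i))
      f≼a : ∀ i → f i ≼ a i
      f≼a i = ≼-cong (≃ᶜ-sym (f≃ i)) (≼-* (U.term-≼ (proj₁ (χ i))) (V.term-≼ (proj₂ (χ i))))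
      square : ℕ → List (ℤ × ℤ)
      square n = cartesianProduct (interval n) (interval n)
      cauchy-piece : ∀ {h φ ψ} → Dominating φ → Dominating ψ → (∀ j k → χ (h (j , k)) ≡ (φ j , ψ k)) →
        IsCauchy (λ n → ∑ℚ.∑[ square n ] (λ i → a (h i)))
      cauchy-piece {h} {φ} {ψ} φ-dom ψ-dom χh = cauchy-resp
        (λ n → ∑ℚ.∑-cong {f = product-weight φ ψ} {g = λ i → a (h i)} (square n) same) (weight-product-cauchy φ-dom ψ-dom)
        where
        same : ∀ jk → product-weight φ ψ jk ≡ a (h jk)
        same (j , k) = cong (λ (s , t) → U.weight s * V.weight t) (sym (χh j k))
      limit-piece : ∀ {h φ ψ} (φ-dom : Dominating φ) (ψ-dom : Dominating ψ) → (∀ j k → χ (h (j , k)) ≡ (φ j , ψ k)) →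
        (λ n → ∑ᶜ.∑[ square n ] (λ i → f (h i))) ⟶ ∑-limit p-neg u φ-dom *ᶜ ∑-limit q-neg v ψ-dom
      limit-piece {h} {φ} {ψ} φ-dom ψ-dom χh = ⟶-cong
        (λ n → ∑ᶜ.∑-cong {f = product-term φ ψ} {g = λ i → f (h i)} (square n) same) ≃ᶜ-refl (theta-product-⟶ φ-dom ψ-dom)
        where
        same : ∀ jk → product-term φ ψ jk ≃ᶜ f (h jk)
        same (j , k) = ≃ᶜ-trans (≡⇒≃ᶜ (cong (λ (s , t) → theta-term p u s *ᶜ theta-term q v t) (sym (χh j k)))) (≃ᶜ-sym (f≃ (h (j , k))))

  -- The functions A, C and ϑ₄

  ¼ : ℚ
  ¼ = ½ * ½

  -- With s = m + n and t = m - n, the form dm² + bmn + dn² is ρ⁺ s² + ρ⁻ t².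
  ρ⁺ ρ⁻ : (d b : ℤ) → ℚ
  ρ⁺ d b = ((+ 2 ℤ.* d ℤ.+ b) / 1) * ¼
  ρ⁻ d b = ((+ 2 ℤ.* d ℤ.- b) / 1) * ¼

  abstract

    /2≡ : ∀ k → k / 2 ≡ (k / 1) * ½
    /2≡ k = sym (trans (cong (_* ½) (/1≡ k)) (cong (_/ 2) (ℤₚ.*-identityʳ k)))

    /4≡ : ∀ k → k / 4 ≡ (k / 1) * ¼
    /4≡ k = sym (trans (cong (_* ¼) (/1≡ k)) (cong (_/ 4) (ℤₚ.*-identityʳ k)))

    /1-sub : ∀ k l → (k ℤ.- l) / 1 ≡ k / 1 - l / 1
    /1-sub k l = trans (/1-+ k (ℤ.- l)) (cong ((k / 1) ℚ.+_) (/1-neg l))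

    /1-pos : ∀ {k} → ℤ.0ℤ ℤ.< k → 0ℚ < k / 1
    /1-pos {+ suc n} (ℤ.+<+ _) = ℚₚ.<-≤-trans 0<1 (ι-mono {1} {suc n} (ℕ.s≤s ℕ.z≤n))

    /1-square : ∀ k → (k ℤ.* k) / 1 ≡ (k / 1) * (k / 1)
    /1-square k = /1-* k k

    ρ-form : ∀ d b (s t : ℚ) →
      ρ⁺ d b * (s * s) + ρ⁻ d b * (t * t) ≡
        ((1ℚ + 1ℚ) * (d / 1) + b / 1) * ¼ * (s * s) + ((1ℚ + 1ℚ) * (d / 1) - b / 1) * ¼ * (t * t)
    ρ-form d b s t = cong₂ (λ x y → x * ¼ * (s * s) + y * ¼ * (t * t))
      (trans (/1-+ (+ 2 ℤ.* d) b) (cong (_+ (b / 1)) (/1-* (+ 2) d)))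
      (trans (/1-sub (+ 2 ℤ.* d) b) (cong (_- (b / 1)) (/1-* (+ 2) d)))

    A-polynomial : ∀ d b m n → (d ℤ.* m ℤ.* m ℤ.+ b ℤ.* m ℤ.* n ℤ.+ d ℤ.* n ℤ.* n) / 1
      ≡ (d / 1) * (m / 1) * (m / 1) + (b / 1) * (m / 1) * (n / 1) + (d / 1) * (n / 1) * (n / 1)
    A-polynomial d b m n = trans (/1-+ (d ℤ.* m ℤ.* m ℤ.+ b ℤ.* m ℤ.* n) (d ℤ.* n ℤ.* n))
      (cong₂ _+_ (trans (/1-+ (d ℤ.* m ℤ.* m) (b ℤ.* m ℤ.* n)) (cong₂ _+_ (cubic d m m) (cubic b m n))) (cubic d n n))
      where
      cubic : ∀ k l m → (k ℤ.* l ℤ.* m) / 1 ≡ (k / 1) * (l / 1) * (m / 1)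
      cubic k l m = trans (/1-* (k ℤ.* l) m) (cong (_* (m / 1)) (/1-* k l))

    A-exponent : ∀ d b m n → (d ℤ.* m ℤ.* m ℤ.+ b ℤ.* m ℤ.* n ℤ.+ d ℤ.* n ℤ.* n) / 1
      ≡ ρ⁺ d b * (((m ℤ.+ n) ℤ.* (m ℤ.+ n)) / 1) + ρ⁻ d b * (((m ℤ.- n) ℤ.* (m ℤ.- n)) / 1)
    A-exponent d b m n = trans (A-polynomial d b m n) (sym (trans
      (cong₂ (λ x y → ρ⁺ d b * x + ρ⁻ d b * y)
        (trans (/1-square (m ℤ.+ n)) (cong (λ x → x * x) (/1-+ m n)))
        (trans (/1-square (m ℤ.- n)) (cong (λ x → x * x) (/1-sub m n))))
      (trans (ρ-form d b (m / 1 + n / 1) (m / 1 - n / 1)) (eq (d / 1) (b / 1) (m / 1) (n / 1)))))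
      where
      eq : ∀ d b m n → ((1ℚ + 1ℚ) * d + b) * ¼ * ((m + n) * (m + n)) + ((1ℚ + 1ℚ) * d - b) * ¼ * ((m - n) * (m - n))
        ≡ d * m * m + b * m * n + d * n * n
      eq = solve-∀ ℚ-ring

    -- The linear and constant terms complete the square: (2d + b)/4 · (m + n + 1)² contributes (d +
    -- b/2) (m + n) and d/2 + b/4.
    C-exponent : ∀ d b m n → (d ℤ.* m ℤ.* m ℤ.+ b ℤ.* m ℤ.* n ℤ.+ d ℤ.* n ℤ.* n) / 1
        + (d / 1 + b / 2) * (m / 1) + (d / 1 + b / 2) * (n / 1) + d / 2 + b / 4
      ≡ ρ⁺ d b * (((m ℤ.+ n ℤ.+ + 1) ℤ.* (m ℤ.+ n ℤ.+ + 1)) / 1) + ρ⁻ d b * (((m ℤ.- n) ℤ.* (m ℤ.- n)) / 1)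
    C-exponent d b m n = trans
      (trans (cong₂ (λ x y → x + (d / 1 + y) * (m / 1) + (d / 1 + y) * (n / 1) + d / 2 + b / 4) (A-polynomial d b m n) (/2≡ b))
        (cong₂ (λ x y → (d / 1) * (m / 1) * (m / 1) + (b / 1) * (m / 1) * (n / 1) + (d / 1) * (n / 1) * (n / 1)
          + (d / 1 + (b / 1) * ½) * (m / 1) + (d / 1 + (b / 1) * ½) * (n / 1) + x + y) (/2≡ d) (/4≡ b)))
      (sym (trans
        (cong₂ (λ x y → ρ⁺ d b * x + ρ⁻ d b * y)
          (trans (/1-square (m ℤ.+ n ℤ.+ + 1)) (cong (λ x → x * x) (trans (/1-+ (m ℤ.+ n) (+ 1)) (cong (_+ 1ℚ) (/1-+ m n)))))
          (trans (/1-square (m ℤ.- n)) (cong (λ x → x * x) (/1-sub m n))))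
        (trans (ρ-form d b (m / 1 + n / 1 + 1ℚ) (m / 1 - n / 1)) (eq (d / 1) (b / 1) (m / 1) (n / 1)))))
      where
      eq : ∀ d b m n → ((1ℚ + 1ℚ) * d + b) * ¼ * ((m + n + 1ℚ) * (m + n + 1ℚ)) + ((1ℚ + 1ℚ) * d - b) * ¼ * ((m - n) * (m - n))
        ≡ d * m * m + b * m * n + d * n * n + (d + b * ½) * m + (d + b * ½) * n + d * ½ + b * ¼
      eq = solve-∀ ℚ-ring

  module _ (π : ℝ) where
    open Theta π

    exponent : ℍ → ℚ → ℂ
    exponent τ r = ofℝ π *ᶜ 𝕚 *ᶜ ofℝ (ofℚ r) *ᶜ point τ

    abstract

      exponent-* : ∀ τ r k → exponent τ (r * (k / 1)) ≃ᶜ exponent τ r *ᶜ ofℤ k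
      exponent-* τ r k = ≃ᶜ-trans (ℂᵣ.*-congʳ (ℂᵣ.*-congˡ (fromℚ-* r (k / 1)))) (eq (ofℝ π *ᶜ 𝕚) (fromℚ r) (ofℤ k) (point τ))
        where
        open ℂ-Solver
        eq : ∀ a r k t → a *ᶜ (r *ᶜ k) *ᶜ t ≃ᶜ a *ᶜ r *ᶜ t *ᶜ k
        eq = solve 4 (λ a r k t → a :* (r :* k) :* t := a :* r :* t :* k) ≃ᶜ-refl

      exponent-+ : ∀ τ r s → exponent τ (r + s) ≃ᶜ exponent τ r +ᶜ exponent τ s
      exponent-+ τ r s = ≃ᶜ-trans (ℂᵣ.*-congʳ (ℂᵣ.*-congˡ (fromℚ-+ r s))) (eq (ofℝ π *ᶜ 𝕚) (fromℚ r) (fromℚ s) (point τ))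
        where
        open ℂ-Solver
        eq : ∀ a r s t → a *ᶜ (r +ᶜ s) *ᶜ t ≃ᶜ a *ᶜ r *ᶜ t +ᶜ a *ᶜ s *ᶜ t
        eq = solve 4 (λ a r s t → a :* (r :+ s) :* t := a :* r :* t :+ a :* s :* t) ≃ᶜ-refl

      exponent-scale : ∀ k 0<k τ r → exponent (scale k 0<k τ) r ≃ᶜ exponent τ (r * (k / 1))
      exponent-scale k 0<k τ r = ≃ᶜ-trans (ℂᵣ.*-congˡ (·≃* (k / 1) (point τ)))
        (≃ᶜ-trans (eq (ofℝ π *ᶜ 𝕚) (fromℚ r) (ofℤ k) (point τ)) (≃ᶜ-sym (exponent-* τ r k)))
        where
        open ℂ-Solver
        eq : ∀ a r k t → a *ᶜ r *ᶜ (k *ᶜ t) ≃ᶜ a *ᶜ r *ᶜ t *ᶜ k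
        eq = solve 4 (λ a r k t → a :* r :* (k :* t) := a :* r :* t :* k) ≃ᶜ-refl

      -- Re (π i r τ) = -π r Im τ; the margin is the product of r with rational lower bounds of π
      -- and Im τ.
      exponent-negative : 0ᴿ <ᴿ π → ∀ τ r → 0ℚ < r → NegativeRe (exponent τ r)
      exponent-negative (mk< g 0<g π>g) (mkℍ t (mk< h 0<h t>h)) r 0<r = mkNegativeRe (g * r * h)
        (*-pos (g * r) h (*-pos g r 0<g 0<r) 0<h)
        (eventually-map (λ n (p , q) → subst (_≤ - (g * r * h)) (sym (eq (seq π n) r (seq (re t) n) (seq (im t) n)))
            (ℚₚ.neg-antimono-≤ (bounded (seq π n) (seq (im t) n) (drop-0 p) (drop-0 q))))
          (π>g ∧ᵉ t>h))
        where
        drop-0 : ∀ {a b} → 0ℚ + a < b → a ≤ b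
        drop-0 {a} {b} p = ℚₚ.<⇒≤ (subst (_< b) (ℚₚ.+-identityˡ a) p)
        eq : ∀ P r x y → ((P * 0ℚ - 0ℚ * 1ℚ) * r - (P * 1ℚ + 0ℚ * 0ℚ) * 0ℚ) * x - ((P * 0ℚ - 0ℚ * 1ℚ) * 0ℚ + (P * 1ℚ + 0ℚ * 0ℚ) * r) * y
          ≡ - (P * r * y)
        eq = solve-∀ ℚ-ring
        bounded : ∀ P y → g ≤ P → h ≤ y → g * r * h ≤ P * r * y
        bounded P y g≤P h≤y = *-mono (g * r) (P * r) h y
          (*-nonNeg P r (ℚₚ.≤-trans (ℚₚ.<⇒≤ 0<g) g≤P) (ℚₚ.<⇒≤ 0<r)) (ℚₚ.<⇒≤ 0<h)
          (ℚₚ.*-monoʳ-≤-nonNeg r {{ℚ.nonNegative (ℚₚ.<⇒≤ 0<r)}} g≤P) h≤y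

      -- Once the quadratic form is diagonal in (s , t), the term is a function of s times a
      -- function of t.
      separate : ∀ τ ρ σ u v s t r → r ≡ ρ * ((s ℤ.* s) / 1) + σ * ((t ℤ.* t) / 1) →
        q^ τ r *ᶜ e^2i u s *ᶜ e^2i v t ≃ᶜ theta-term (exponent τ ρ) u s *ᶜ theta-term (exponent τ σ) v t
      separate τ ρ σ u v s t _ refl = ≃ᶜ-trans
        (ℂᵣ.*-congʳ (ℂᵣ.*-congʳ (≃ᶜ-trans
          (exp-cong (≃ᶜ-trans (exponent-+ τ _ _) (ℂᵣ.+-cong (exponent-* τ ρ (s ℤ.* s)) (exponent-* τ σ (t ℤ.* t)))))
          (exp-+ _ _))))
        (eq (exp (exponent τ ρ *ᶜ ofℤ (s ℤ.* s))) (exp (exponent τ σ *ᶜ ofℤ (t ℤ.* t))) (e^2i u s) (e^2i v t))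
        where
        open ℂ-Solver
        eq : ∀ a b x y → a *ᶜ b *ᶜ x *ᶜ y ≃ᶜ (a *ᶜ x) *ᶜ (b *ᶜ y)
        eq = solve 4 (λ a b x y → a :* b :* x :* y := (a :* x) :* (b :* y)) ≃ᶜ-refl

      A-term≃ : ∀ d b u v τ m n → A-term d b u v τ (m , n) ≃ᶜ
        theta-term (exponent τ (ρ⁺ d b)) u (m ℤ.+ n) *ᶜ theta-term (exponent τ (ρ⁻ d b)) v (m ℤ.- n)
      A-term≃ d b u v τ m n = separate τ (ρ⁺ d b) (ρ⁻ d b) u v (m ℤ.+ n) (m ℤ.- n) _ (A-exponent d b m n)

      C-term≃ : ∀ d b u v τ m n → C-term d b u v τ (m , n) ≃ᶜ
        theta-term (exponent τ (ρ⁺ d b)) u (m ℤ.+ n ℤ.+ + 1) *ᶜ theta-term (exponent τ (ρ⁻ d b)) v (m ℤ.- n)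
      C-term≃ d b u v τ m n = separate τ (ρ⁺ d b) (ρ⁻ d b) u v (m ℤ.+ n ℤ.+ + 1) (m ℤ.- n) _ (C-exponent d b m n)

      ϑ₄-term≃ : ∀ z τ n → ϑ₄-term z τ n ≃ᶜ [-1]^ n *ᶜ theta-term (exponent τ 1ℚ) z n
      ϑ₄-term≃ z τ n = ≃ᶜ-trans (ℂᵣ.*-assoc _ _ _) (ℂᵣ.*-congˡ (ℂᵣ.*-congʳ (exp-cong
        (≃ᶜ-trans (≡⇒≃ᶜ (cong (exponent τ) (sym (ℚₚ.*-identityˡ ((n ℤ.* n) / 1))))) (exponent-* τ 1ℚ (n ℤ.* n))))))

  -- Signs and parity classes of indices

  abstract

    [-1]^even : ∀ j → (ℤ.- (+ 1)) ℤ.^ ℤ.∣ even j ∣ ≡ + 1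
    [-1]^even j = trans (cong ((ℤ.- (+ 1)) ℤ.^_) (∣even∣ j)) (go ℤ.∣ j ∣)
      where
      go : ∀ n → (ℤ.- (+ 1)) ℤ.^ (n ℕ.+ n) ≡ + 1
      go zero    = refl
      go (suc n) = trans (cong (λ k → (ℤ.- (+ 1)) ℤ.* (ℤ.- (+ 1)) ℤ.^ k) (ℕₚ.+-suc n n))
        (cong (λ x → (ℤ.- (+ 1)) ℤ.* ((ℤ.- (+ 1)) ℤ.* x)) (go n))

    [-1]^suc : ∀ k → (ℤ.- (+ 1)) ℤ.^ ℤ.∣ k ℤ.+ + 1 ∣ ≡ (ℤ.- (+ 1)) ℤ.* (ℤ.- (+ 1)) ℤ.^ ℤ.∣ k ∣
    [-1]^suc (+ n)          = cong ((ℤ.- (+ 1)) ℤ.^_) (ℕₚ.+-comm n 1)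
    [-1]^suc -[1+ zero ]    = refl
    -- Here |k + 1| is one less than |k|, and (-1)² = 1 makes up for the two steps between the
    -- sides.
    [-1]^suc -[1+ suc n ]   = eq ((ℤ.- (+ 1)) ℤ.^ suc n)
      where
      eq : ∀ x → x ≡ (ℤ.- (+ 1)) ℤ.* ((ℤ.- (+ 1)) ℤ.* x)
      eq = ℤ-Solver.solve-∀

    [-1]^odd : ∀ j → (ℤ.- (+ 1)) ℤ.^ ℤ.∣ odd j ∣ ≡ ℤ.- (+ 1)
    [-1]^odd j = trans ([-1]^suc (even j)) (cong ((ℤ.- (+ 1)) ℤ.*_) ([-1]^even j))

  -- Solutions (m , n) of the index equations: `rotate` gives (s , t) = (2j , 2k) for A and (2j + 1
  -- , 2k) for C, `A-odd` gives (2j + 1 , 2k + 1), and `C-odd` gives (2j , 2k + 1).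
  rotate A-odd C-odd : ℤ × ℤ → ℤ × ℤ
  rotate (j , k) = j ℤ.+ k , j ℤ.- k
  A-odd (j , k) = j ℤ.+ k ℤ.+ + 1 , j ℤ.- k
  C-odd (j , k) = j ℤ.+ k , j ℤ.- k ℤ.- + 1

  -- (s , t) ranges over the pairs of equal parity for A, and over those of opposite parity for C.
  A-index C-index : ℤ × ℤ → ℤ × ℤ
  A-index (m , n) = m ℤ.+ n , m ℤ.- n
  C-index (m , n) = m ℤ.+ n ℤ.+ + 1 , m ℤ.- n

  private
    sum-eq : ∀ j k → j ℤ.+ k ℤ.+ (j ℤ.- k) ≡ + 2 ℤ.* j
    sum-eq = ℤ-Solver.solve-∀
    diff-eq : ∀ j k → j ℤ.+ k ℤ.- (j ℤ.- k) ≡ + 2 ℤ.* k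
    diff-eq = ℤ-Solver.solve-∀

  abstract

    A-index-even : ∀ j k → A-index (rotate (j , k)) ≡ (even j , even k)
    A-index-even j k = cong₂ _,_ (sum-eq j k) (diff-eq j k)

    A-index-odd : ∀ j k → A-index (A-odd (j , k)) ≡ (odd j , odd k)
    A-index-odd j k = cong₂ _,_ (eq₁ j k) (eq₂ j k)
      where
      eq₁ : ∀ j k → j ℤ.+ k ℤ.+ + 1 ℤ.+ (j ℤ.- k) ≡ + 2 ℤ.* j ℤ.+ + 1
      eq₁ = ℤ-Solver.solve-∀
      eq₂ : ∀ j k → j ℤ.+ k ℤ.+ + 1 ℤ.- (j ℤ.- k) ≡ + 2 ℤ.* k ℤ.+ + 1
      eq₂ = ℤ-Solver.solve-∀

    C-index-even : ∀ j k → C-index (rotate (j , k)) ≡ (odd j , even k)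
    C-index-even j k = cong₂ _,_ (cong (ℤ._+ + 1) (sum-eq j k)) (diff-eq j k)

    C-index-odd : ∀ j k → C-index (C-odd (j , k)) ≡ (even j , odd k)
    C-index-odd j k = cong₂ _,_ (eq₁ j k) (eq₂ j k)
      where
      eq₁ : ∀ j k → j ℤ.+ k ℤ.+ (j ℤ.- k ℤ.- + 1) ℤ.+ + 1 ≡ + 2 ℤ.* j
      eq₁ = ℤ-Solver.solve-∀
      eq₂ : ∀ j k → j ℤ.+ k ℤ.- (j ℤ.- k ℤ.- + 1) ≡ + 2 ℤ.* k ℤ.+ + 1
      eq₂ = ℤ-Solver.solve-∀

    -- The composite of χ and h is injective in each coordinate, hence h is injective.
    indexed-injective : ∀ (χ h : ℤ × ℤ → ℤ × ℤ) {φ ψ : ℤ → ℤ} →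
      (∀ {j k} → φ j ≡ φ k → j ≡ k) → (∀ {j k} → ψ j ≡ ψ k → j ≡ k) →
      (∀ j k → χ (h (j , k)) ≡ (φ j , ψ k)) → ∀ {x y} → h x ≡ h y → x ≡ y
    indexed-injective χ h {φ} {ψ} φ-inj ψ-inj χh {j , k} {j′ , k′} eq =
      cong₂ _,_ (φ-inj (cong proj₁ indices)) (ψ-inj (cong proj₂ indices))
      where
      indices : (φ j , ψ k) ≡ (φ j′ , ψ k′)
      indices = trans (sym (χh j k)) (trans (cong χ eq) (χh j′ k′))

    solve-difference : ∀ m n {d} → m ℤ.- n ≡ d → m ≡ n ℤ.+ d
    solve-difference m n refl = eq m n
      where
      eq : ∀ m n → m ≡ n ℤ.+ (m ℤ.- n)
      eq = ℤ-Solver.solve-∀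

    A-halves : Halves rotate A-odd
    A-halves = record
      { φ-injective = indexed-injective A-index rotate even-injective even-injective A-index-even
      ; ψ-injective = indexed-injective A-index A-odd odd-injective odd-injective A-index-odd
      ; disjoint    = λ (j , k) (j′ , k′) eq → even≢odd j j′
          (cong proj₁ (trans (sym (A-index-even j k)) (trans (cong A-index eq) (A-index-odd j′ k′))))
      -- Both maps have second component j - k, so j = n + k whichever parity m - n has.
      ; surjective  = λ (m , n) → let (k , p) = parity (m ℤ.- n) in (n ℤ.+ k , k) , from m n k p }
      where
      eq₁ : ∀ n k → n ℤ.+ + 2 ℤ.* k ≡ n ℤ.+ k ℤ.+ k
      eq₁ = ℤ-Solver.solve-∀
      eq₂ : ∀ n k → n ≡ n ℤ.+ k ℤ.- k
      eq₂ = ℤ-Solver.solve-∀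
      eq₃ : ∀ n k → n ℤ.+ (+ 2 ℤ.* k ℤ.+ + 1) ≡ n ℤ.+ k ℤ.+ k ℤ.+ + 1
      eq₃ = ℤ-Solver.solve-∀
      from : ∀ m n k → m ℤ.- n ≡ even k ⊎ m ℤ.- n ≡ odd k → (m , n) ≡ rotate (n ℤ.+ k , k) ⊎ (m , n) ≡ A-odd (n ℤ.+ k , k)
      from m n k (inj₁ e) = inj₁ (cong₂ _,_ (trans (solve-difference m n e) (eq₁ n k)) (eq₂ n k))
      from m n k (inj₂ e) = inj₂ (cong₂ _,_ (trans (solve-difference m n e) (eq₃ n k)) (eq₂ n k))

    C-halves : Halves rotate C-odd
    C-halves = record
      { φ-injective = indexed-injective C-index rotate odd-injective even-injective C-index-even
      ; ψ-injective = indexed-injective C-index C-odd even-injective odd-injective C-index-odd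
      ; disjoint    = λ (j , k) (j′ , k′) eq → even≢odd k k′
          (cong proj₂ (trans (sym (C-index-even j k)) (trans (cong C-index eq) (C-index-odd j′ k′))))
      ; surjective  = λ (m , n) → let (k , p) = parity (m ℤ.- n) in from m n k p }
      where
      eq₁ : ∀ n k → n ℤ.+ + 2 ℤ.* k ≡ n ℤ.+ k ℤ.+ k
      eq₁ = ℤ-Solver.solve-∀
      eq₂ : ∀ n k → n ≡ n ℤ.+ k ℤ.- k
      eq₂ = ℤ-Solver.solve-∀
      eq₃ : ∀ n k → n ℤ.+ (+ 2 ℤ.* k ℤ.+ + 1) ≡ n ℤ.+ k ℤ.+ + 1 ℤ.+ k
      eq₃ = ℤ-Solver.solve-∀
      eq₄ : ∀ n k → n ≡ n ℤ.+ k ℤ.+ + 1 ℤ.- k ℤ.- + 1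
      eq₄ = ℤ-Solver.solve-∀
      from : ∀ m n k → m ℤ.- n ≡ even k ⊎ m ℤ.- n ≡ odd k → ∃[ i ] ((m , n) ≡ rotate i ⊎ (m , n) ≡ C-odd i)
      from m n k (inj₁ e) = (n ℤ.+ k , k) ,
        inj₁ (cong₂ _,_ (trans (solve-difference m n e) (eq₁ n k)) (eq₂ n k))
      -- The second component of `C-odd` is j - k - 1, hence the additional 1 in j.
      from m n k (inj₂ e) = (n ℤ.+ k ℤ.+ + 1 , k) ,
        inj₂ (cong₂ _,_ (trans (solve-difference m n e) (eq₃ n k)) (eq₄ n k))

    even-odd-halves : Halves even odd
    even-odd-halves = record
      { φ-injective = even-injective ; ψ-injective = odd-injective ; disjoint = even≢odd ; surjective = parity }

    -- The limits depend on the `NegativeRe` proofs through the constants chosen; uniqueness of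
    -- limits identifies them.
    ∑-limit-cong : ∀ {p p′ z z′ φ} (neg : NegativeRe p) (neg′ : NegativeRe p′) (dom : Dominating φ) →
      (∀ j → theta-term p z (φ j) ≃ᶜ theta-term p′ z′ (φ j)) → ∑-limit neg z dom ≃ᶜ ∑-limit neg′ z′ dom
    ∑-limit-cong {z = z} {z′} neg neg′ dom same = ⟶-unique
      (⟶-cong (λ n → ∑ᶜ.∑-cong (interval n) same) ≃ᶜ-refl (∑-limit-⟶ neg z dom))
      (∑-limit-⟶ neg′ z′ dom)

    ∑-limit-neg : ∀ {p z z′ φ} (neg : NegativeRe p) (dom : Dominating φ) →
      (∀ j → theta-term p z (φ j) ≃ᶜ -ᶜ theta-term p z′ (φ j)) → ∑-limit neg z dom ≃ᶜ -ᶜ ∑-limit neg z′ dom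
    ∑-limit-neg {z = z} {z′} neg dom opposite = ⟶-unique
      (∑-limit-⟶ neg z dom)
      (⟶-cong (λ n → ≃ᶜ-sym (≃ᶜ-trans (∑ᶜ.∑-cong (interval n) opposite) (∑ᶜ.∑-neg (interval n) _))) ≃ᶜ-refl
        (⟶-neg (∑-limit-⟶ neg z′ dom)))

    theta-term-cong : ∀ {p p′} → p ≃ᶜ p′ → ∀ z s → theta-term p z s ≃ᶜ theta-term p′ z s
    theta-term-cong p≃p′ z s = ℂᵣ.*-congʳ (exp-cong (ℂᵣ.*-congʳ p≃p′))

  -- The shift by π/2

  module _ (π : ℝ) (isPi : IsPi π) where
    open Theta π

    private
      iπ : ℂ
      iπ = 𝕚 *ᶜ ofℝ π

    abstract

      private
        -1*-1 : -ᶜ 1ᶜ *ᶜ -ᶜ 1ᶜ ≃ᶜ 1ᶜ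
        -1*-1 = pointwiseᶜ (λ _ → refl) (λ _ → refl)

        exp-2iπ : exp (iπ +ᶜ iπ) ≃ᶜ 1ᶜ
        exp-2iπ = ≃ᶜ-trans (exp-+ iπ iπ) (≃ᶜ-trans (ℂᵣ.*-cong (exp-iπ π isPi) (exp-iπ π isPi)) -1*-1)

        exp-neg-2iπ : exp (-ᶜ (iπ +ᶜ iπ)) ≃ᶜ 1ᶜ
        exp-neg-2iπ = ≃ᶜ-trans (≃ᶜ-sym (ℂᵣ.*-identityˡ _))
          (≃ᶜ-trans (ℂᵣ.*-congʳ (≃ᶜ-sym exp-2iπ)) (exp-inverse (iπ +ᶜ iπ)))

      exp-iπ-even : ∀ j → exp (iπ *ᶜ ofℤ (even j)) ≃ᶜ 1ᶜ
      exp-iπ-even j = ≃ᶜ-trans (exp-cong (≃ᶜ-trans (ℂᵣ.*-congˡ (ofℤ-* (+ 2) j)) (eq iπ (ofℤ j)))) (period j)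
        where
        eq : ∀ a b → a *ᶜ (fromℚ (1ℚ + 1ℚ) *ᶜ b) ≃ᶜ (a +ᶜ a) *ᶜ b
        eq = solve 2 (λ a b → a :* (con (1ℚ + 1ℚ) :* b) := (a :+ a) :* b) ≃ᶜ-refl
          where open ℂ-Solver
        period : ∀ j → exp ((iπ +ᶜ iπ) *ᶜ ofℤ j) ≃ᶜ 1ᶜ
        period (+ n)    = ≃ᶜ-trans (exp-*ℕ (iπ +ᶜ iπ) n) (^ᶜ-one exp-2iπ n)
        period -[1+ n ] = ≃ᶜ-trans (exp-*-neg (iπ +ᶜ iπ) (+ suc n))
          (≃ᶜ-trans (exp-*ℕ (-ᶜ (iπ +ᶜ iπ)) (suc n)) (^ᶜ-one exp-neg-2iπ (suc n)))

      exp-iπ-odd : ∀ j → exp (iπ *ᶜ ofℤ (odd j)) ≃ᶜ -ᶜ 1ᶜ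
      exp-iπ-odd j = ≃ᶜ-trans (exp-cong (≃ᶜ-trans (ℂᵣ.*-congˡ (ofℤ-+ (even j) (+ 1))) (eq iπ (ofℤ (even j)))))
        (≃ᶜ-trans (exp-+ _ iπ) (≃ᶜ-trans (ℂᵣ.*-cong (exp-iπ-even j) (exp-iπ π isPi)) (ℂᵣ.*-identityˡ (-ᶜ 1ᶜ))))
        where
        eq : ∀ a b → a *ᶜ (b +ᶜ fromℚ 1ℚ) ≃ᶜ a *ᶜ b +ᶜ a
        eq = solve 2 (λ a b → a :* (b :+ con 1ℚ) := a :* b :+ a) ≃ᶜ-refl
          where open ℂ-Solver

      -- The shift contributes the factor e^(2i (π/2) s) = e^(iπs), the sign (-1)^s.
      theta-term-shift : ∀ p z s → theta-term p (z +ᶜ π/2) s ≃ᶜ exp (iπ *ᶜ ofℤ s) *ᶜ theta-term p z s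
      theta-term-shift p z s = begin
        exp (p *ᶜ ofℤ (s ℤ.* s)) *ᶜ exp (ofℤ (+ 2) *ᶜ 𝕚 *ᶜ (z +ᶜ π/2) *ᶜ ofℤ s)
          ≈⟨ ℂᵣ.*-congˡ (exp-cong (≃ᶜ-trans (ℂᵣ.*-congʳ (ℂᵣ.*-congˡ (ℂᵣ.+-congˡ π/2≃))) (eq₁ 𝕚 z (ofℝ π) (ofℤ s)))) ⟩
        exp (p *ᶜ ofℤ (s ℤ.* s)) *ᶜ exp (iπ *ᶜ ofℤ s +ᶜ ofℤ (+ 2) *ᶜ 𝕚 *ᶜ z *ᶜ ofℤ s)
          ≈⟨ ℂᵣ.*-congˡ (exp-+ (iπ *ᶜ ofℤ s) (ofℤ (+ 2) *ᶜ 𝕚 *ᶜ z *ᶜ ofℤ s)) ⟩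
        exp (p *ᶜ ofℤ (s ℤ.* s)) *ᶜ (exp (iπ *ᶜ ofℤ s) *ᶜ exp (ofℤ (+ 2) *ᶜ 𝕚 *ᶜ z *ᶜ ofℤ s))
          ≈⟨ eq₂ (exp (p *ᶜ ofℤ (s ℤ.* s))) (exp (iπ *ᶜ ofℤ s)) (exp (ofℤ (+ 2) *ᶜ 𝕚 *ᶜ z *ᶜ ofℤ s)) ⟩
        exp (iπ *ᶜ ofℤ s) *ᶜ theta-term p z s ∎
        where
        open SetoidReasoning ℂᵣ.setoid
        π/2≃ : π/2 ≃ᶜ fromℚ ½ *ᶜ ofℝ π
        π/2≃ = pointwiseᶜ (λ n → eq (seq π n)) (λ n → eq′ (seq π n))
          where
          eq : ∀ p → ½ * p ≡ ½ * p - 0ℚ * 0ℚ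
          eq = solve-∀ ℚ-ring
          eq′ : ∀ p → 0ℚ ≡ ½ * 0ℚ + 0ℚ * p
          eq′ = solve-∀ ℚ-ring
        eq₁ : ∀ i z p s → fromℚ (1ℚ + 1ℚ) *ᶜ i *ᶜ (z +ᶜ fromℚ ½ *ᶜ p) *ᶜ s ≃ᶜ i *ᶜ p *ᶜ s +ᶜ fromℚ (1ℚ + 1ℚ) *ᶜ i *ᶜ z *ᶜ s
        eq₁ = solve 4 (λ i z p s → con (1ℚ + 1ℚ) :* i :* (z :+ con ½ :* p) :* s
          := i :* p :* s :+ con (1ℚ + 1ℚ) :* i :* z :* s) ≃ᶜ-refl
          where open ℂ-Solver
        eq₂ : ∀ a b c → a *ᶜ (b *ᶜ c) ≃ᶜ b *ᶜ (a *ᶜ c)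
        eq₂ = solve 3 (λ a b c → a :* (b :* c) := b :* (a :* c)) ≃ᶜ-refl
          where open ℂ-Solver

      evenSum-shift : ∀ {p} (neg : NegativeRe p) z → evenSum neg (z +ᶜ π/2) ≃ᶜ evenSum neg z
      evenSum-shift {p} neg z = ∑-limit-cong neg neg even-dominating λ j →
        ≃ᶜ-trans (theta-term-shift p z (even j)) (≃ᶜ-trans (ℂᵣ.*-congʳ (exp-iπ-even j)) (ℂᵣ.*-identityˡ _))

      oddSum-shift : ∀ {p} (neg : NegativeRe p) z → oddSum neg (z +ᶜ π/2) ≃ᶜ -ᶜ oddSum neg z
      oddSum-shift {p} neg z = ∑-limit-neg neg odd-dominating λ j →
        ≃ᶜ-trans (theta-term-shift p z (odd j)) (≃ᶜ-trans (ℂᵣ.*-congʳ (exp-iπ-odd j)) (eq (theta-term p z (odd j))))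
        where
        eq : ∀ a → -ᶜ 1ᶜ *ᶜ a ≃ᶜ -ᶜ a
        eq = solve 1 (λ a → (:- con 1ℚ) :* a := :- a) ≃ᶜ-refl
          where open ℂ-Solver

  -- The series A, C, ϑ₄ and the two identities

  module Functions (π : ℝ) (isPi : IsPi π) where
    open Theta π
    open IsPi isPi

    exponent⁻ : ∀ τ {r} → 0ℚ < r → NegativeRe (exponent π τ r)
    exponent⁻ τ {r} = exponent-negative π 0<π τ r

    -- The sign (-1)ⁿ is resolved by parity, so that the value has the shape of the factors Uₑ - Uₒ
    -- and Vₑ - Vₒ.
    ϑ₄ : ℂ → ℍ → ℂ
    ϑ₄ z τ = evenSum (exponent⁻ τ 0<1) z -ᶜ oddSum (exponent⁻ τ 0<1) z

    ϑ₄-HasSum : ∀ z τ → HasSum (ϑ₄-term z τ) (ϑ₄ z τ)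
    ϑ₄-HasSum z τ = halves-HasSum even-odd-halves <ℤ (ϑ₄-term z τ) L.weight term-≼′
        (weights-cauchy L.C L.0≤C even-dominating) (weights-cauchy L.C L.0≤C odd-dominating)
        {evenSum neg z} { -ᶜ oddSum neg z}
        (⟶-cong (λ n → ∑ᶜ.∑-cong (interval n) (λ j → ≃ᶜ-sym (even-term j))) ≃ᶜ-refl (L.∑-limit-⟶ even-dominating))
        (⟶-cong (λ n → ≃ᶜ-sym (≃ᶜ-trans (∑ᶜ.∑-cong (interval n) odd-term) (∑ᶜ.∑-neg (interval n) _))) ≃ᶜ-refl
          (⟶-neg (L.∑-limit-⟶ odd-dominating)))
      where
      neg : NegativeRe (exponent π τ 1ℚ)
      neg = exponent⁻ τ 0<1
      module L = Lattice neg z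
      T : ℤ → ℂ
      T = theta-term (exponent π τ 1ℚ) z
      even-term : ∀ j → ϑ₄-term z τ (even j) ≃ᶜ T (even j)
      even-term j = ≃ᶜ-trans (ϑ₄-term≃ π z τ (even j))
        (≃ᶜ-trans (ℂᵣ.*-congʳ (≡⇒≃ᶜ (cong ofℤ ([-1]^even j)))) (ℂᵣ.*-identityˡ _))
      odd-term : ∀ j → ϑ₄-term z τ (odd j) ≃ᶜ -ᶜ T (odd j)
      odd-term j = ≃ᶜ-trans (ϑ₄-term≃ π z τ (odd j))
        (≃ᶜ-trans (ℂᵣ.*-congʳ (≡⇒≃ᶜ (cong ofℤ ([-1]^odd j)))) (eq (T (odd j))))
        where
        eq : ∀ a → fromℚ (- 1ℚ) *ᶜ a ≃ᶜ -ᶜ a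
        eq = solve 1 (λ a → con (- 1ℚ) :* a := :- a) ≃ᶜ-refl
          where open ℂ-Solver
      -- Splitting by parity replaces the sign by 1 or -1, neither of which affects the bound.
      term-≼′ : ∀ s → ϑ₄-term z τ s ≼ L.weight s
      term-≼′ s = let (j , p) = parity s in from s j p
        where
        from : ∀ s j → s ≡ even j ⊎ s ≡ odd j → ϑ₄-term z τ s ≼ L.weight s
        from _ j (inj₁ refl) = ≼-cong (≃ᶜ-sym (even-term j)) (L.term-≼ (even j))
        from _ j (inj₂ refl) = ≼-cong (≃ᶜ-sym (odd-term j)) (≼-neg (L.term-≼ (odd j)))

    module _ (b d : ℤ) (-2d<b : ℤ.- (+ 2 ℤ.* d) ℤ.< b) (b<2d : b ℤ.< + 2 ℤ.* d) where

      0<ρ⁺ : 0ℚ < ρ⁺ d b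
      0<ρ⁺ = *-pos ((+ 2 ℤ.* d ℤ.+ b) / 1) ¼ (/1-pos (0<2d+b d b -2d<b)) (half-pos ½ 0<½)

      0<ρ⁻ : 0ℚ < ρ⁻ d b
      0<ρ⁻ = *-pos ((+ 2 ℤ.* d ℤ.- b) / 1) ¼ (/1-pos (0<2d-b d b b<2d)) (half-pos ½ 0<½)

      Uₑ Uₒ Vₑ Vₒ : ℂ → ℍ → ℂ
      Uₑ u τ = evenSum (exponent⁻ τ 0<ρ⁺) u
      Uₒ u τ = oddSum  (exponent⁻ τ 0<ρ⁺) u
      Vₑ v τ = evenSum (exponent⁻ τ 0<ρ⁻) v
      Vₒ v τ = oddSum  (exponent⁻ τ 0<ρ⁻) v

      A C : ℂ → ℂ → ℍ → ℂ
      A u v τ = Uₑ u τ *ᶜ Vₑ v τ +ᶜ Uₒ u τ *ᶜ Vₒ v τ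
      C u v τ = Uₒ u τ *ᶜ Vₑ v τ +ᶜ Uₑ u τ *ᶜ Vₒ v τ

      A-HasSum : ∀ u v τ → HasSum (A-term d b u v τ) (A u v τ)
      A-HasSum u v τ = theta-product-HasSum (exponent⁻ τ 0<ρ⁺) u (exponent⁻ τ 0<ρ⁻) v
        (A-term d b u v τ) A-index (λ (m , n) → A-term≃ π d b u v τ m n) A-halves
        even-dominating even-dominating odd-dominating odd-dominating A-index-even A-index-odd

      C-HasSum : ∀ u v τ → HasSum (C-term d b u v τ) (C u v τ)
      C-HasSum u v τ = theta-product-HasSum (exponent⁻ τ 0<ρ⁺) u (exponent⁻ τ 0<ρ⁻) v
        (C-term d b u v τ) C-index (λ (m , n) → C-term≃ π d b u v τ m n) C-halves
        odd-dominating even-dominating even-dominating odd-dominating C-index-even C-index-odd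

      -- The factor ¼ in `ρ⁺` and `ρ⁻` cancels against 4τ, which leaves the parameters (2d + b)τ and
      -- (2d - b)τ.
      exponent-4 : ∀ k 0<k 0<4 τ → exponent π (scale (+ 4) 0<4 τ) ((k / 1) * ¼) ≃ᶜ exponent π (scale k 0<k τ) 1ℚ
      exponent-4 k 0<k 0<4 τ = ≃ᶜ-trans (exponent-scale π (+ 4) 0<4 τ ((k / 1) * ¼))
        (≃ᶜ-trans (≡⇒≃ᶜ (cong (exponent π τ) (eq (k / 1)))) (≃ᶜ-sym (exponent-scale π k 0<k τ 1ℚ)))
        where
        eq : ∀ x → x * ¼ * (+ 4 / 1) ≡ 1ℚ * x
        eq = solve-∀ ℚ-ring

      product-formula : ∀ 0<4 u v τ → A u v (scale (+ 4) 0<4 τ) -ᶜ C u v (scale (+ 4) 0<4 τ)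
        ≃ᶜ ϑ₄ u (scale (+ 2 ℤ.* d ℤ.+ b) (0<2d+b d b -2d<b) τ) *ᶜ ϑ₄ v (scale (+ 2 ℤ.* d ℤ.- b) (0<2d-b d b b<2d) τ)
      product-formula 0<4 u v τ = ≃ᶜ-trans
        (factor (Uₑ u 4τ) (Uₒ u 4τ) (Vₑ v 4τ) (Vₒ v 4τ))
        (ℂᵣ.*-cong
          (-ᶜ-cong₂ (∑-limit-cong _ _ even-dominating (λ j → theta-term-cong U≃ u (even j)))
                    (∑-limit-cong _ _ odd-dominating (λ j → theta-term-cong U≃ u (odd j))))
          (-ᶜ-cong₂ (∑-limit-cong _ _ even-dominating (λ j → theta-term-cong V≃ v (even j)))
                    (∑-limit-cong _ _ odd-dominating (λ j → theta-term-cong V≃ v (odd j)))))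
        where
        4τ : ℍ
        4τ = scale (+ 4) 0<4 τ
        U≃ : exponent π 4τ (ρ⁺ d b) ≃ᶜ exponent π (scale (+ 2 ℤ.* d ℤ.+ b) (0<2d+b d b -2d<b) τ) 1ℚ
        U≃ = exponent-4 (+ 2 ℤ.* d ℤ.+ b) (0<2d+b d b -2d<b) 0<4 τ
        V≃ : exponent π 4τ (ρ⁻ d b) ≃ᶜ exponent π (scale (+ 2 ℤ.* d ℤ.- b) (0<2d-b d b b<2d) τ) 1ℚ
        V≃ = exponent-4 (+ 2 ℤ.* d ℤ.- b) (0<2d-b d b b<2d) 0<4 τ
        factor : ∀ a b c d → (a *ᶜ c +ᶜ b *ᶜ d) -ᶜ (b *ᶜ c +ᶜ a *ᶜ d) ≃ᶜ (a -ᶜ b) *ᶜ (c -ᶜ d)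
        factor = solve 4 (λ a b c d → (a :* c :+ b :* d) :- (b :* c :+ a :* d) := (a :- b) :* (c :- d)) ≃ᶜ-refl
          where open ℂ-Solver

      difference-of-squares : ∀ u v τ → (A u v τ) ² -ᶜ (C u v τ) ² ≃ᶜ (A u (v +ᶜ π/2) τ) ² -ᶜ (C u (v +ᶜ π/2) τ) ²
      difference-of-squares u v τ = ≃ᶜ-trans (eq (Uₑ u τ) (Uₒ u τ) (Vₑ v τ) (Vₒ v τ)) (≃ᶜ-sym (-ᶜ-cong₂ (square-cong A-shift) (square-cong C-shift)))
        where
        square-cong : ∀ {z w} → z ≃ᶜ w → z ² ≃ᶜ w ²
        square-cong z≃w = ℂᵣ.*-cong z≃w z≃w
        Vₑ-shift : Vₑ (v +ᶜ π/2) τ ≃ᶜ Vₑ v τ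
        Vₑ-shift = evenSum-shift π isPi (exponent⁻ τ 0<ρ⁻) v
        Vₒ-shift : Vₒ (v +ᶜ π/2) τ ≃ᶜ -ᶜ Vₒ v τ
        Vₒ-shift = oddSum-shift π isPi (exponent⁻ τ 0<ρ⁻) v
        A-shift : A u (v +ᶜ π/2) τ ≃ᶜ Uₑ u τ *ᶜ Vₑ v τ +ᶜ Uₒ u τ *ᶜ -ᶜ Vₒ v τ
        A-shift = ℂᵣ.+-cong (ℂᵣ.*-congˡ Vₑ-shift) (ℂᵣ.*-congˡ Vₒ-shift)
        C-shift : C u (v +ᶜ π/2) τ ≃ᶜ Uₒ u τ *ᶜ Vₑ v τ +ᶜ Uₑ u τ *ᶜ -ᶜ Vₒ v τ
        C-shift = ℂᵣ.+-cong (ℂᵣ.*-congˡ Vₑ-shift) (ℂᵣ.*-congˡ Vₒ-shift)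
        eq : ∀ a b c d → (a *ᶜ c +ᶜ b *ᶜ d) *ᶜ (a *ᶜ c +ᶜ b *ᶜ d) -ᶜ (b *ᶜ c +ᶜ a *ᶜ d) *ᶜ (b *ᶜ c +ᶜ a *ᶜ d)
          ≃ᶜ (a *ᶜ c +ᶜ b *ᶜ -ᶜ d) *ᶜ (a *ᶜ c +ᶜ b *ᶜ -ᶜ d) -ᶜ (b *ᶜ c +ᶜ a *ᶜ -ᶜ d) *ᶜ (b *ᶜ c +ᶜ a *ᶜ -ᶜ d)
        eq = solve 4 (λ a b c d → (a :* c :+ b :* d) :* (a :* c :+ b :* d) :- (b :* c :+ a :* d) :* (b :* c :+ a :* d)
          := (a :* c :+ b :* :- d) :* (a :* c :+ b :* :- d) :- (b :* c :+ a :* :- d) :* (b :* c :+ a :* :- d)) ≃ᶜ-refl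
          where open ℂ-Solver

open Analysis

open import Data.Integer using (-_; _+_; _-_; _*_; _<_; +<+)
open import Data.Nat using (z≤n; s≤s)
open import Data.Product using (Σ-syntax)

-- Convergence is part of the claim: the functions are exhibited together with proofs that they are
-- the unordered sums of their series.
theorem5p1 : (π : ℝ) → IsPi π → let open Theta π in
    (b d : ℤ) (-2d<b : - (+ 2 * d) < b) (b<2d : b < + 2 * d) →
    Σ[ A ∈ (ℂ → ℂ → ℍ → ℂ) ] Σ[ C ∈ (ℂ → ℂ → ℍ → ℂ) ] Σ[ ϑ₄ ∈ (ℂ → ℍ → ℂ) ]
    (∀ u v τ → HasSum (A-term d b u v τ) (A u v τ)) ×
    (∀ u v τ → HasSum (C-term d b u v τ) (C u v τ)) ×
    (∀ z τ → HasSum (ϑ₄-term z τ) (ϑ₄ z τ)) ×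
    (∀ u v τ →
    (let 4τ = scale (+ 4) (+<+ (s≤s z≤n)) τ in A u v 4τ -ᶜ C u v 4τ)
    ≃ᶜ ϑ₄ u (scale (+ 2 * d + b) (0<2d+b d b -2d<b) τ)
    *ᶜ ϑ₄ v (scale (+ 2 * d - b) (0<2d-b d b b<2d) τ)) ×
    (∀ u v τ →
    (A u v τ) ² -ᶜ (C u v τ) ²
    ≃ᶜ (A u (v +ᶜ π/2) τ) ² -ᶜ (C u (v +ᶜ π/2) τ) ²)
theorem5p1 π isPi b d -2d<b b<2d =
  F.A b d -2d<b b<2d , F.C b d -2d<b b<2d , F.ϑ₄ ,
  F.A-HasSum b d -2d<b b<2d , F.C-HasSum b d -2d<b b<2d , F.ϑ₄-HasSum ,
  F.product-formula b d -2d<b b<2d (+<+ (s≤s z≤n)) ,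
  F.difference-of-squares b d -2d<b b<2d
  where
  module F = Functions π isPi
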